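{- Let $\widehat{G}$ be a signed bigraph. Then $\widehat{G}$ is a chordal signed bigraph if and only if it is $\mathcal{F}$-free.
   Context: A signed graph is a finite simple graph with each edge assigned a sign, positive or negative; induced subgraphs inherit signs; containment is up to sign-preserving isomorphism. A signed bigraph has bipartite underlying graph with bipartition $(X,Y)$. A subgraph is a biclique if every vertex of it in $X$ is adjacent to every vertex of it in $Y$; positive if all edges positive. For an edge $uv$, $N(uv)=(N(u)\cup N(v))\setminus\{u,v\}$; $uv$ is signed simplicial if $N(uv)$ induces a positive biclique. A signed bigraph is a chordal signed bigraph if its edges can be ordered $e_1,\dots,e_m$ so that each $e_i$ is signed simplicial in the graph obtained by deleting edges $e_1,\dots,e_{i-1}$ (keeping vertices). "Arbitrary" signs mean all choices are included. Tadpoles: a tadpole of type 1 with parameter $k\ge1$ has distinct vertices $w,y,z,x_1,\dots,x_k$ and edges exactly $wy,wz,x_ky,x_kz$ and $x_ix_{i+1}$ ($1\le i\le k-1$), with $x_ky,x_kz$ negative and others arbitrary; a tadpole of type 2 ($k\ge2$) is a type 1 tadpole with an extra negative edge $wx_{k-1}$; its end is $x_1$. $W_1$ denotes the type 1 tadpoles with $k=1$. The family $\mathcal{F}$ is the union of: $F_1$: $K_{2,2}$ with all edges negative; $F_2$: $K_{2,3}$, parts $\{a,b\},\{p,q,r\}$, $pa,aq,qb,br$ negative, $bp,ar$ arbitrary; $F_3$: $K_{2,4}$, parts $\{a,b\},\{p,q,r,s\}$, $ap,aq,br,bs$ negative, $bp,bq,ar,as$ arbitrary; $F_4$: $K_{3,3}$,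 parts $\{a,b,c\},\{p,q,r\}$, $ap,bq,cr$ negative, others arbitrary; $F_5$: parts $\{a,b,c\},\{p,q,r\}$, all cross pairs edges except $ar$, $bp,cq$ negative, others arbitrary; $F_6$: parts $\{a,b,c,d\},\{p,q,r,s\}$, edges exactly $pa,pb,pc,pd,qa,qb,qc,qd,rc,rd,sc,sd$, with $ap,bp,cq,dr,ds$ negative and the rest arbitrary; $\mathcal{C}$: all signed cycles of length $2k$, $k\ge3$; $D$: parts $\{a,b,c\},\{p,q,r\}$, edges exactly $ap,aq,bp,bq,br,cq,cr$, $bq$ negative, others arbitrary; $\mathcal{S}$ (sums): graphs obtained from two vertex-disjoint tadpoles $T,T'$ with ends $x,x'$ by identifying $x$ and $x'$; $\mathcal{J}$ (joins): for vertex-disjoint tadpoles $T$ (end $x$, heads $w,y,z$) and $T'$ (end $x'$, heads $w',y',z'$) with a bipartition of their union extending bipartitions of each, the graph obtained by adding positive edges from $x$ to every vertex of $T'$ in the part opposite to $x$ and from $x'$ to every vertex of $T$ in the part opposite to $x'$, except that if $T'\in W_1$ then $x,x'$ lie in opposite parts (so $xx'$ is an added edge) and the added edge $xw'$ (to the vertex at distance 2 from $x'$ in $T'$) may be positive or negative, and symmetrically if $T\in W_1$ then $xx'$ is an added edge and the added edge $x'w$ may be positive or negative. A signed graph is $\mathcal{F}$-free if it contains no member of $\mathcal{F}$ as an induced subgraph. -}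

module Defs where

open import Data.Nat using (ℕ; zero; suc; _≤_; _*_; _≡ᵇ_)
open import Data.Fin using (Fin; zero; suc; toℕ; _≟_)
open import Data.Bool using (Bool; true; false; not; _∧_; _∨_; _xor_; if_then_else_)
open import Data.Maybe using (Maybe; just; nothing; _<∣>_)
open import Data.Product using (Σ; ∃; _×_; _,_)
open import Data.Sum using (_⊎_)
open import Data.List using (List; []; _∷_)
open import Relation.Nullary using (¬_)
open import Relation.Nullary.Decidable using (⌊_⌋)
open import Relation.Binary.PropositionalEquality using (_≡_; _≢_)
open import Function.Definitions using (Injective)

-- Signs and signed graphs (as edge functions: nothing = non-edge)

data Sign : Set where
  pos neg : Sign

symClose : {V : Set} → (V → V → Maybe Sign) → V → V → Maybe Sign
symClose adj u v = adj u v <∣> adj v u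

-- A signed bigraph on vertex set Fin n, with a fixed bipartition
-- (side u = false : u ∈ X,  side u = true : u ∈ Y).
record SignedBigraph (n : ℕ) : Set where
  field
    edge     : Fin n → Fin n → Maybe Sign
    edge-sym : ∀ u v → edge u v ≡ edge v u
    edge-irr : ∀ u → edge u u ≡ nothing
    side     : Fin n → Bool
    bip      : ∀ u v s → edge u v ≡ just s → side u ≢ side v

module _ {n : ℕ} where

  Adj : (Fin n → Fin n → Maybe Sign) → Fin n → Fin n → Set
  Adj E a b = ∃ λ s → E a b ≡ just s

  InN : (Fin n → Fin n → Maybe Sign) → Fin n → Fin n → Fin n → Set
  InN E u v a = a ≢ u × a ≢ v × (Adj E u a ⊎ Adj E v a)

  SignedSimplicial : (Fin n → Bool) → (Fin n → Fin n → Maybe Sign) → Fin n → Fin n → Set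
  SignedSimplicial side E u v =
    ∀ a b → InN E u v a → InN E u v b → side a ≢ side b → E a b ≡ just pos

  deleteEdge : Fin n → Fin n → (Fin n → Fin n → Maybe Sign) → Fin n → Fin n → Maybe Sign
  deleteEdge u v E a b =
    if (⌊ a ≟ u ⌋ ∧ ⌊ b ≟ v ⌋) ∨ (⌊ a ≟ v ⌋ ∧ ⌊ b ≟ u ⌋) then nothing else E a b

  data ChordalOrder (side : Fin n → Bool) :
         (Fin n → Fin n → Maybe Sign) → List (Fin n × Fin n) → Set where
    done : ∀ {E} → (∀ a b → E a b ≡ nothing) → ChordalOrder side E []
    step : ∀ {E u v es} → Adj E u v → SignedSimplicial side E u v →
           ChordalOrder side (deleteEdge u v E) es →
           ChordalOrder side E ((u , v) ∷ es)

Chordal : {n : ℕ} → SignedBigraph n → Set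
Chordal G = ∃ λ es → ChordalOrder (SignedBigraph.side G) (SignedBigraph.edge G) es

Embeds : {V : Set} → (V → V → Maybe Sign) → {n : ℕ} → (Fin n → Fin n → Maybe Sign) → Set
Embeds {V} H {n} E =
  Σ (V → Fin n) λ f → Injective _≡_ _≡_ f × (∀ u v → E (f u) (f v) ≡ H u v)

-- The small forbidden graphs.  σ supplies the "arbitrary" signs; it is
-- only consulted on the edges whose sign is arbitrary.

data V1 : Set where a b p q : V1
F1adj : V1 → V1 → Maybe Sign
F1adj a p = just neg
F1adj a q = just neg
F1adj b p = just neg
F1adj b q = just neg
F1adj _ _ = nothing

data V2 : Set where a b p q r : V2
F2adj : (V2 → V2 → Sign) → V2 → V2 → Maybe Sign
F2adj σ a p = just neg
F2adj σ a q = just neg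
F2adj σ b q = just neg
F2adj σ b r = just neg
F2adj σ b p = just (σ b p)
F2adj σ a r = just (σ a r)
F2adj σ _ _ = nothing

data V3 : Set where a b p q r s : V3
F3adj : (V3 → V3 → Sign) → V3 → V3 → Maybe Sign
F3adj σ a p = just neg
F3adj σ a q = just neg
F3adj σ b r = just neg
F3adj σ b s = just neg
F3adj σ b p = just (σ b p)
F3adj σ b q = just (σ b q)
F3adj σ a r = just (σ a r)
F3adj σ a s = just (σ a s)
F3adj σ _ _ = nothing

data V4 : Set where a b c p q r : V4
F4adj : (V4 → V4 → Sign) → V4 → V4 → Maybe Sign
F4adj σ a p = just neg
F4adj σ b q = just neg
F4adj σ c r = just neg
F4adj σ a q = just (σ a q)
F4adj σ a r = just (σ a r)
F4adj σ b p = just (σ b p)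
F4adj σ b r = just (σ b r)
F4adj σ c p = just (σ c p)
F4adj σ c q = just (σ c q)
F4adj σ _ _ = nothing

F5adj : (V4 → V4 → Sign) → V4 → V4 → Maybe Sign
F5adj σ b p = just neg
F5adj σ c q = just neg
F5adj σ a p = just (σ a p)
F5adj σ a q = just (σ a q)
F5adj σ b q = just (σ b q)
F5adj σ b r = just (σ b r)
F5adj σ c p = just (σ c p)
F5adj σ c r = just (σ c r)
F5adj σ _ _ = nothing

data V6 : Set where a b c d p q r s : V6
F6adj : (V6 → V6 → Sign) → V6 → V6 → Maybe Sign
F6adj σ a p = just neg
F6adj σ b p = just neg
F6adj σ c q = just neg
F6adj σ d r = just neg
F6adj σ d s = just neg
F6adj σ c p = just (σ c p)
F6adj σ d p = just (σ d p)
F6adj σ a q = just (σ a q)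
F6adj σ b q = just (σ b q)
F6adj σ d q = just (σ d q)
F6adj σ c r = just (σ c r)
F6adj σ c s = just (σ c s)
F6adj σ _ _ = nothing

Dadj : (V4 → V4 → Sign) → V4 → V4 → Maybe Sign
Dadj σ b q = just neg
Dadj σ a p = just (σ a p)
Dadj σ a q = just (σ a q)
Dadj σ b p = just (σ b p)
Dadj σ b r = just (σ b r)
Dadj σ c q = just (σ c q)
Dadj σ c r = just (σ c r)
Dadj σ _ _ = nothing

cycleAdj : (L : ℕ) → (ℕ → Sign) → Fin L → Fin L → Maybe Sign
cycleAdj L σ i j =
  if suc (toℕ i) ≡ᵇ toℕ j then just (σ (toℕ i))
  else if (toℕ j ≡ᵇ 0) ∧ (suc (toℕ i) ≡ᵇ L) then just (σ (toℕ i))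
  else nothing

-- Tadpoles.  Parameter k = suc m; x (i) stands for x_{i+1}, so the end
-- x_1 is x zero and x_k is x (fromℕ m).

data TType : Set where
  type1 type2 : TType

data TV (m : ℕ) : Set where
  w y z : TV m
  x : Fin (suc m) → TV m

isType2 : TType → Bool
isType2 type1 = false
isType2 type2 = true

tadAdj : (tt : TType) (m : ℕ) → (TV m → TV m → Sign) → TV m → TV m → Maybe Sign
tadAdj tt m σ w y = just (σ w y)
tadAdj tt m σ w z = just (σ w z)
tadAdj tt m σ (x i) y = if toℕ i ≡ᵇ m then just neg else nothing
tadAdj tt m σ (x i) z = if toℕ i ≡ᵇ m then just neg else nothing
tadAdj tt m σ (x i) (x j) =
  if suc (toℕ i) ≡ᵇ toℕ j then just (σ (x i) (x j)) else nothing
tadAdj tt m σ w (x i) =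
  if isType2 tt ∧ (suc (toℕ i) ≡ᵇ m) then just neg else nothing
tadAdj tt m σ _ _ = nothing

record Tadpole : Set where
  field
    tt    : TType
    m     : ℕ                       -- k = suc m  (so k ≥ 1)
    valid : tt ≡ type2 → 1 ≤ m
    σ     : TV m → TV m → Sign

tadE : (T : Tadpole) → TV (Tadpole.m T) → TV (Tadpole.m T) → Maybe Sign
tadE T = symClose (tadAdj (Tadpole.tt T) (Tadpole.m T) (Tadpole.σ T))

isW1 : Tadpole → Bool
isW1 T = not (isType2 (Tadpole.tt T)) ∧ (Tadpole.m T ≡ᵇ 0)

isEnd : {m : ℕ} → TV m → Bool
isEnd (x zero) = true
isEnd _        = false

isW : {m : ℕ} → TV m → Bool
isW w = true
isW _ = false

-- Sums: identify the ends of T and T'.  The vertices of T' other than its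
-- end are represented by TVne.

data TVne (m : ℕ) : Set where
  w′ y′ z′ : TVne m
  xs : Fin m → TVne m

liftne : {m : ℕ} → TVne m → TV m
liftne w′ = w
liftne y′ = y
liftne z′ = z
liftne (xs j) = x (suc j)

data SumV (m m′ : ℕ) : Set where
  l : TV m → SumV m m′
  r : TVne m′ → SumV m m′

sumE : (T T′ : Tadpole) → SumV (Tadpole.m T) (Tadpole.m T′) →
       SumV (Tadpole.m T) (Tadpole.m T′) → Maybe Sign
sumE T T′ (l u) (l v) = tadE T u v
sumE T T′ (r u) (r v) = tadE T′ (liftne u) (liftne v)
sumE T T′ (l u) (r v) = if isEnd u then tadE T′ (x zero) (liftne v) else nothing
sumE T T′ (r u) (l v) = if isEnd v then tadE T′ (liftne u) (x zero) else nothing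

-- Joins.  Bipartition of a tadpole: parity of the distance to the end
-- (x_i ↦ i-1, y,z ↦ k, w ↦ k-1).  The bipartition of the union is
-- determined by `opp` : whether the end x′ of T′ lies in the part opposite
-- to the end x of T.

odd : ℕ → Bool
odd zero    = false
odd (suc k) = not (odd k)

col : {m : ℕ} → TV m → Bool
col {m} w = odd m
col {m} y = odd (suc m)
col {m} z = odd (suc m)
col (x i) = odd (toℕ i)

record JoinData : Set where
  field
    T T′   : Tadpole
    opp    : Bool
    oppW1  : (isW1 T ≡ true ⊎ isW1 T′ ≡ true) → opp ≡ true
    s₁ s₂  : Sign

module _ (J : JoinData) where
  open JoinData J

  private
    m₁ = Tadpole.m T
    m₂ = Tadpole.m T′

  -- side in the union (false = part of x)
  sideL : TV m₁ → Bool
  sideL u = col u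
  sideR : TV m₂ → Bool
  sideR v = col v xor opp

  joinCross : TV m₁ → TV m₂ → Maybe Sign
  joinCross u v =
    if (isEnd u ∧ sideR v) ∨ (isEnd v ∧ (sideL u xor opp))
    then just (if isW1 T′ ∧ isEnd u ∧ isW v then s₁
               else if isW1 T ∧ isEnd v ∧ isW u then s₂
               else pos)
    else nothing

  data JoinV : Set where
    jl : TV m₁ → JoinV
    jr : TV m₂ → JoinV

  joinE : JoinV → JoinV → Maybe Sign
  joinE (jl u) (jl v) = tadE T u v
  joinE (jr u) (jr v) = tadE T′ u v
  joinE (jl u) (jr v) = joinCross u v
  joinE (jr v) (jl u) = joinCross u v

data HasF {n : ℕ} (E : Fin n → Fin n → Maybe Sign) : Set where
  hasF1 : Embeds (symClose F1adj) E → HasF E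
  hasF2 : (σ : V2 → V2 → Sign) → Embeds (symClose (F2adj σ)) E → HasF E
  hasF3 : (σ : V3 → V3 → Sign) → Embeds (symClose (F3adj σ)) E → HasF E
  hasF4 : (σ : V4 → V4 → Sign) → Embeds (symClose (F4adj σ)) E → HasF E
  hasF5 : (σ : V4 → V4 → Sign) → Embeds (symClose (F5adj σ)) E → HasF E
  hasF6 : (σ : V6 → V6 → Sign) → Embeds (symClose (F6adj σ)) E → HasF E
  hasC  : (k : ℕ) → 3 ≤ k → (σ : ℕ → Sign) →
          Embeds (symClose (cycleAdj (2 * k) σ)) E → HasF E
  hasD  : (σ : V4 → V4 → Sign) → Embeds (symClose (Dadj σ)) E → HasF E
  hasS  : (T T′ : Tadpole) → Embeds (sumE T T′) E → HasF E
  hasJ  : (J : JoinData) → Embeds (joinE J) E → HasF E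

FFree : {n : ℕ} → SignedBigraph n → Set
FFree G = ¬ HasF (SignedBigraph.edge G)

{-# OPTIONS --safe #-}

-- Call a signed graph stuck if any two vertices u and v, adjacent or not, have neighbours
-- h and g with g h not a positive edge.  All members of ℱ are stuck, so the deletion of a
-- signed simplicial edge neither creates nor destroys an induced member of ℱ.  It remains
-- to find a signed simplicial edge in an ℱ-free graph with an edge; suppose there is none.
--
-- Let C be a component of G - N[u v], for an edge u v, and let S be the set of vertices
-- outside C with neighbours in C.  As there are no holes and no D, S is a positive biclique;
-- if C is minimal, then S is complete to C and the graph on C is a chain graph.  The
-- obstructions in this chain graph are F₁, …, F₆ or a tadpole with at most five vertices
-- that has its end in S and the rest in C.  Choose two such sets C₁, C₂ separated from each
-- other, with ends s₁, s₂ of small tadpoles.  Shortest paths from s₁ to the boundary of C₂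
-- and from s₂ to the boundary of C₁ then extend the two tadpoles so as to give a sum or
-- a join.
module Submission where

open import Defs hiding (a; b; c; d; p; q; r; s; w; x; y; z; l; w′; y′; z′; xs; jl; jr)
open import Data.Nat using (ℕ; zero; suc; _+_; _*_; _≤_; _<_; _≡ᵇ_; z≤n; s≤s)
import Data.Nat.Properties as ℕ
open import Data.Fin using (Fin; zero; suc; toℕ; fromℕ; fromℕ<; inject₁; combine; remQuot; _≟_)
import Data.Fin.Properties as Fin
open import Data.Fin.Subset as Sub using (Subset)
import Data.Fin.Subset.Properties as Sub
open import Data.Fin.Subset.Induction using (⊂-wellFounded; Acc; acc)
open import Data.Bool using (Bool; true; false; not; _∧_; _∨_; _xor_; if_then_else_)
import Data.Bool.Properties as Bool
open import Data.Maybe using (Maybe; just; nothing; _<∣>_)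
open import Data.Product using (Σ; ∃; ∃₂; _×_; _,_; proj₁; proj₂)
open import Data.Sum using (_⊎_; inj₁; inj₂; [_,_]′)
open import Data.Empty using (⊥; ⊥-elim)
open import Data.Unit using (tt)
open import Data.List using (List; []; _∷_; length; lookup; cartesianProduct; find)
open import Data.List.Relation.Unary.All as All using (All; []; _∷_)
open import Data.List.Relation.Unary.AllPairs using (AllPairs; []; _∷_)
open import Data.List.Relation.Unary.Any as Any using (here; there)
import Data.List.Relation.Unary.Any.Properties as Any
open import Data.List.Membership.Propositional using (_∈_)
open import Data.Vec using (tabulate)
open import Data.Vec.Properties using (lookup∘tabulate; lookup⇒[]=; []=⇒lookup)
open import Relation.Nullary using (¬_; Dec; yes; no; contradiction)
open import Relation.Nullary.Decidable using (⌊_⌋; True; toWitness; _×-dec_; _⊎-dec_; ¬?; map′; decidable-stable)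
open import Relation.Binary.Definitions using (DecidableEquality; tri<; tri≈; tri>)
open import Relation.Binary.PropositionalEquality hiding (J)
open import Function using (_∘_; id; case_of_)
open import Function.Bundles using (_⇔_; mk⇔)
open import Function.Definitions using (Injective)

-- The existence half works towards a contradiction throughout, so components of vertex sets may be
-- used as if reachability were decided. Its main induction runs over sets `B` whose boundary is
-- complete to them; the set of all nonisolated vertices is the first one, with empty boundary. If
-- the graph on `B` is a chain graph, many edges are simplicial in the unsigned sense and only
-- negative edges block them. Two induced disjoint edges in `B` give instead the two separated sets.
-- The obstacle is the join: each end has to be positive to the whole opposite part of the other
-- tadpole. Complete boundaries give adjacency to the small tadpole, and a negative sign there leads
-- to F₄, F₅ or a sum. The one failure is a W₁ whose end already lies on the boundary of the other
-- set: its vertices are then too close to the other tadpole for a sum, so the sign at `w` stays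
-- free. This is the source of the exception for W₁ in 𝒥. If the ends are then in the same part, F₁,
-- F₂, F₃, F₆ or a join with rearranged tadpoles appears.

private variable
  n : ℕ
  V : Set

-- Blocked pairs and the deletion of signed simplicial edges

Edges : Set → Set
Edges V = V → V → Maybe Sign

Edge : Edges V → V → V → Set
Edge H u v = ∃ λ σ → H u v ≡ just σ

edge? : (e : Maybe Sign) → Dec (∃ λ σ → e ≡ just σ)
edge? nothing  = no λ ()
edge? (just σ) = yes (σ , refl)

nothing-or-edge : (e : Maybe Sign) → e ≡ nothing ⊎ ∃ λ σ → e ≡ just σ
nothing-or-edge nothing  = inj₁ refl
nothing-or-edge (just σ) = inj₂ (σ , refl)

not-both : ∀ {e : Maybe Sign} {σ} → e ≡ nothing → e ≢ just σ
not-both refl ()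

-- (g , h) prevents the pair (u , v), adjacent or not, from being the ends of a
-- signed simplicial edge.
Blocks : Edges V → V → V → V → V → Set
Blocks H u v g h = g ≢ u × h ≢ v × Edge H v g × Edge H u h × H g h ≢ just pos

-- Asking this of nonadjacent pairs too means that no member of ℱ is created or
-- destroyed by the deletion of a signed simplicial edge.
Stuck : Edges V → Set
Stuck H = ∀ u v → u ≢ v → ∃₂ (Blocks H u v)

Bichromatic : (Fin n → Bool) → (Fin n → Fin n → Maybe Sign) → Set
Bichromatic side E = ∀ u v → Edge E u v → side u ≢ side v

both-differ : ∀ {i j k l} → i ≢ j → k ≢ j → l ≢ i → k ≢ l
both-differ {i} {j} i≢j k≢j l≢i refl =
  i≢j (trans (trans (Bool.¬-not (l≢i ∘ sym)) refl) (sym (Bool.¬-not (k≢j ∘ sym))))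

module _ {E : Fin n → Fin n → Maybe Sign} where

  delete-edge : ∀ u v → deleteEdge u v E u v ≡ nothing
  delete-edge u v with u ≟ u | v ≟ v
  ... | yes _  | yes _  = refl
  ... | yes _  | no v≢v = contradiction refl v≢v
  ... | no u≢u | _      = contradiction refl u≢u

  delete-other : ∀ u v i j → ¬ (i ≡ u × j ≡ v) → ¬ (i ≡ v × j ≡ u) →
                 deleteEdge u v E i j ≡ E i j
  delete-other u v i j ¬uv ¬vu with i ≟ u | j ≟ v | i ≟ v | j ≟ u
  ... | yes i≡u | yes j≡v | _       | _       = contradiction (i≡u , j≡v) ¬uv
  ... | yes _   | no _    | yes i≡v | yes j≡u = contradiction (i≡v , j≡u) ¬vu
  ... | no _    | _       | yes i≡v | yes j≡u = contradiction (i≡v , j≡u) ¬vu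
  ... | yes _   | no _    | yes _   | no _    = refl
  ... | yes _   | no _    | no _    | _       = refl
  ... | no _    | _       | yes _   | no _    = refl
  ... | no _    | _       | no _    | _       = refl

  delete-⊆ : ∀ u v i j {σ} → deleteEdge u v E i j ≡ just σ → E i j ≡ just σ
  delete-⊆ u v i j eq with (⌊ i ≟ u ⌋ ∧ ⌊ j ≟ v ⌋) ∨ (⌊ i ≟ v ⌋ ∧ ⌊ j ≟ u ⌋)
  ... | false = eq

  module _ {side : Fin n → Bool} (bi : Bichromatic side E) (sm : ∀ u v → E u v ≡ E v u)
           {u v : Fin n} (uv : Edge E u v) (simp : SignedSimplicial side E u v) where

    simplicial-unblocked : ∀ g h → g ≢ u → h ≢ v → Edge E v g → Edge E u h → E g h ≡ just pos
    simplicial-unblocked g h g≢u h≢v vg uh = simp g h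
      (g≢u , (λ { refl → bi _ _ vg refl }) , inj₂ vg)
      ((λ { refl → bi _ _ uh refl }) , h≢v , inj₁ uh)
      (both-differ (bi _ _ uv) (bi _ _ vg ∘ sym) (bi _ _ uh ∘ sym))

    module _ {H : Edges V} (stuck : Stuck H) where

      private
        u≢v : u ≢ v
        u≢v refl = bi _ _ uv refl

      -- Serves embeddings into the graph both before and after the deletion: `pull` is only asked
      -- for vertices `g` sent away from `u` and `v`, where the deletion changes nothing.
      not-both-in-image : {f : V → Fin n} → Injective _≡_ _≡_ f →
        (∀ g h {σ} → H g h ≡ just σ → E (f g) (f h) ≡ just σ) →
        (∀ g h → E (f g) (f h) ≡ just pos → f g ≢ u → f g ≢ v → H g h ≡ just pos) →
        ∀ i j → f i ≡ u → f j ≡ v → ⊥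
      not-both-in-image inj incl pull i j refl refl with stuck i j (u≢v ∘ cong _)
      ... | g , h , g≢i , h≢j , (σ , jg) , (τ , ih) , notpos = notpos (pull g h
        (simplicial-unblocked _ _ (g≢i ∘ inj) (h≢j ∘ inj) (σ , incl j g jg) (τ , incl i h ih))
        (g≢i ∘ inj)
        (λ eq → bi _ _ (σ , incl j g jg) (cong side (sym eq))))

      not-deleted : {f : V → Fin n} → (∀ i j → f i ≡ u → f j ≡ v → ⊥) →
        ∀ i j → deleteEdge u v E (f i) (f j) ≡ E (f i) (f j)
      not-deleted no-both i j = delete-other u v _ _
        (λ (i≡u , j≡v) → no-both i j i≡u j≡v) (λ (i≡v , j≡u) → no-both j i j≡u i≡v)

      embeds-delete : Embeds H E → Embeds H (deleteEdge u v E)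
      embeds-delete (f , inj , emb) = f , inj , λ i j → trans (not-deleted no-both i j) (emb i j)
        where no-both = not-both-in-image inj (λ g h eq → trans (emb g h) eq)
                          (λ g h eq _ _ → trans (sym (emb g h)) eq)

      embeds-undelete : Embeds H (deleteEdge u v E) → Embeds H E
      embeds-undelete (f , inj , emb) = f , inj , λ i j → trans (sym (not-deleted no-both i j)) (emb i j)
        where no-both = not-both-in-image inj (λ g h eq → delete-⊆ u v _ _ (trans (emb g h) eq))
                          (λ g h eq g≢u g≢v → trans (sym (emb g h))
                            (trans (delete-other u v _ _ (g≢u ∘ proj₁) (g≢v ∘ proj₁)) eq))

-- The finite members of ℱ are checked by evaluation.  The blocking pair is found by
-- search with all free signs positive, the worst case, and then verified for the
-- unknown signs σ.

module Enumerated (vs : List V) (complete : ∀ v → v ∈ vs) where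

  private
    position : V → Fin (Data.List.length vs)
    position v = Any.index (complete v)

  _≟ᵛ_ : DecidableEquality V
  u ≟ᵛ v = map′ (λ eq → trans (lookup-index u) (trans (cong (lookup vs) eq) (sym (lookup-index v))))
                (cong position) (position u ≟ position v)
    where
    lookup-index : ∀ v → v ≡ lookup vs (position v)
    lookup-index v = Any.lookup-index (complete v)

  notpos? : (e : Maybe Sign) → Dec (e ≢ just pos)
  notpos? nothing    = yes λ ()
  notpos? (just neg) = yes λ ()
  notpos? (just pos) = no λ f → f refl

  blocks? : (H : Edges V) → ∀ u v g h → Dec (Blocks H u v g h)
  blocks? H u v g h = ¬? (g ≟ᵛ u) ×-dec ¬? (h ≟ᵛ v) ×-dec edge? (H v g) ×-dec edge? (H u h) ×-dec notpos? (H g h)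

  blocker : Edges V → V → V → V × V
  blocker H u v with find (λ (g , h) → blocks? H u v g h) (cartesianProduct vs vs)
  ... | just gh = gh
  -- A failed search returns a pair that violates `g ≢ u`, so that `Checked` rejects it.
  ... | nothing = u , v

  Checked : Edges V → Edges V → Set
  Checked H₀ H = True (All.all? (λ u → All.all? (λ v →
    (u ≟ᵛ v) ⊎-dec blocks? H u v (proj₁ (blocker H₀ u v)) (proj₂ (blocker H₀ u v))) vs) vs)

  checked⇒stuck : ∀ {H₀ H} → Checked H₀ H → Stuck H
  checked⇒stuck {H₀} {H} chk u v u≢v
    with All.lookup (All.lookup (toWitness chk) (complete u)) (complete v)
  ... | inj₁ u≡v = contradiction u≡v u≢v
  ... | inj₂ blk = _ , _ , blk

allPos : V → V → Sign
allPos _ _ = pos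

stuckF1 : Stuck (symClose F1adj)
stuckF1 = Enumerated.checked⇒stuck (V1.a ∷ V1.b ∷ V1.p ∷ V1.q ∷ []) (λ
  { V1.a → here refl ; V1.b → there (here refl) ; V1.p → there (there (here refl))
  ; V1.q → there (there (there (here refl))) }) {symClose F1adj} tt

complete4 : ∀ v → v ∈ V4.a ∷ V4.b ∷ V4.c ∷ V4.p ∷ V4.q ∷ V4.r ∷ []
complete4 V4.a = here refl
complete4 V4.b = there (here refl)
complete4 V4.c = there (there (here refl))
complete4 V4.p = there (there (there (here refl)))
complete4 V4.q = there (there (there (there (here refl))))
complete4 V4.r = there (there (there (there (there (here refl)))))

complete6 : ∀ v → v ∈ V6.a ∷ V6.b ∷ V6.c ∷ V6.d ∷ V6.p ∷ V6.q ∷ V6.r ∷ V6.s ∷ []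
complete6 V6.a = here refl
complete6 V6.b = there (here refl)
complete6 V6.c = there (there (here refl))
complete6 V6.d = there (there (there (here refl)))
complete6 V6.p = there (there (there (there (here refl))))
complete6 V6.q = there (there (there (there (there (here refl)))))
complete6 V6.r = there (there (there (there (there (there (here refl))))))
complete6 V6.s = there (there (there (there (there (there (there (here refl)))))))

stuckF2 : ∀ σ → Stuck (symClose (F2adj σ))
stuckF2 σ = Enumerated.checked⇒stuck (V2.a ∷ V2.b ∷ V2.p ∷ V2.q ∷ V2.r ∷ []) (λ
  { V2.a → here refl ; V2.b → there (here refl) ; V2.p → there (there (here refl))
  ; V2.q → there (there (there (here refl))) ; V2.r → there (there (there (there (here refl)))) })
  {symClose (F2adj allPos)} tt

stuckF3 : ∀ σ → Stuck (symClose (F3adj σ))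
stuckF3 σ = Enumerated.checked⇒stuck (V3.a ∷ V3.b ∷ V3.p ∷ V3.q ∷ V3.r ∷ V3.s ∷ []) (λ
  { V3.a → here refl ; V3.b → there (here refl) ; V3.p → there (there (here refl))
  ; V3.q → there (there (there (here refl))) ; V3.r → there (there (there (there (here refl))))
  ; V3.s → there (there (there (there (there (here refl))))) })
  {symClose (F3adj allPos)} tt

stuckF4 : ∀ σ → Stuck (symClose (F4adj σ))
stuckF4 σ = Enumerated.checked⇒stuck _ complete4 {symClose (F4adj allPos)} tt

stuckF5 : ∀ σ → Stuck (symClose (F5adj σ))
stuckF5 σ = Enumerated.checked⇒stuck _ complete4 {symClose (F5adj allPos)} tt

stuckF6 : ∀ σ → Stuck (symClose (F6adj σ))
stuckF6 σ = Enumerated.checked⇒stuck _ complete6 {symClose (F6adj allPos)} tt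

stuckD : ∀ σ → Stuck (symClose (Dadj σ))
stuckD σ = Enumerated.checked⇒stuck _ complete4 {symClose (Dadj allPos)} tt

≡ᵇ-true : ∀ {i j} → i ≡ j → (i ≡ᵇ j) ≡ true
≡ᵇ-true {i} {j} eq with i ≡ᵇ j | ℕ.≡⇒≡ᵇ i j eq
... | true | _ = refl

≡ᵇ-false : ∀ {i j} → i ≢ j → (i ≡ᵇ j) ≡ false
≡ᵇ-false {i} {j} i≢j with i ≡ᵇ j | ℕ.≡ᵇ⇒≡ i j
... | false | _ = refl
... | true  | f = contradiction (f _) i≢j

module _ {A : Edges V} where

  symClose-edge : ∀ {u v} → Edge A u v ⊎ Edge A v u → Edge (symClose A) u v
  symClose-edge {u} {v} (inj₁ (σ , eq)) rewrite eq = σ , refl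
  symClose-edge {u} {v} (inj₂ (σ , eq)) with A u v
  ... | just τ  = τ , refl
  ... | nothing = σ , eq

  symClose-edge⁻ : ∀ {u v} → Edge (symClose A) u v → Edge A u v ⊎ Edge A v u
  symClose-edge⁻ {u} {v} (σ , eq) with A u v
  ... | just τ  = inj₁ (τ , refl)
  ... | nothing = inj₂ (σ , eq)

Symm : Edges V → Set
Symm H = ∀ u v → H u v ≡ H v u

blocks-sym : {H : Edges V} → Symm H → ∀ {u v g h} → Blocks H u v g h → Blocks H v u h g
blocks-sym sm (g≢u , h≢v , vg , uh , notpos) =
  h≢v , g≢u , uh , vg , λ eq → notpos (trans (sm _ _) eq)

swap-blocks : {H : Edges V} → Symm H → ∀ {u v} → ∃₂ (Blocks H u v) → ∃₂ (Blocks H v u)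
swap-blocks sm (g , h , blk) = h , g , blocks-sym sm blk

edge-sym′ : {H : Edges V} → Symm H → ∀ {u v} → Edge H u v → Edge H v u
edge-sym′ sm (σ , eq) = σ , trans (sm _ _) eq

-- Cycles

greatest : ∀ {k L} → suc k ≤ L → ∃ λ (i : Fin L) → suc (toℕ i) ≡ L
greatest {L = suc L} _ = fromℕ L , cong suc (Fin.toℕ-fromℕ L)

module Cycle (L : ℕ) (5≤L : 5 ≤ L) (σ : ℕ → Sign) where

  Succ : Fin L → Fin L → Set
  Succ i j = suc (toℕ i) ≡ toℕ j ⊎ (toℕ j ≡ 0 × suc (toℕ i) ≡ L)

  H : Edges (Fin L)
  H = symClose (cycleAdj L σ)

  succ⇒edge : ∀ {i j} → Succ i j → Edge (cycleAdj L σ) i j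
  succ⇒edge {i} (inj₁ eq) rewrite ≡ᵇ-true eq = _ , refl
  succ⇒edge {i} {j} (inj₂ (j≡0 , eq)) with suc (toℕ i) ≡ᵇ toℕ j
  ... | true = _ , refl
  ... | false rewrite ≡ᵇ-true j≡0 | ≡ᵇ-true eq = _ , refl

  edge⇒succ : ∀ {i j} → Edge (cycleAdj L σ) i j → Succ i j
  edge⇒succ {i} {j} (τ , eq)
    with suc (toℕ i) ≡ᵇ toℕ j in e₁ | toℕ j ≡ᵇ 0 in e₂ | suc (toℕ i) ≡ᵇ L in e₃ | eq
  ... | true  | _     | _    | _ = inj₁ (ℕ.≡ᵇ⇒≡ _ _ (subst Data.Bool.T (sym e₁) _))
  ... | false | true  | true | _ = inj₂ (ℕ.≡ᵇ⇒≡ _ _ (subst Data.Bool.T (sym e₂) _) , ℕ.≡ᵇ⇒≡ _ _ (subst Data.Bool.T (sym e₃) _))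

  succ-injective : ∀ {i i′ j} → Succ i j → Succ i′ j → i ≡ i′
  succ-injective (inj₁ e) (inj₁ e′) = Fin.toℕ-injective (ℕ.suc-injective (trans e (sym e′)))
  succ-injective (inj₁ e) (inj₂ (j≡0 , _)) with () ← trans e j≡0
  succ-injective (inj₂ (j≡0 , _)) (inj₁ e) with () ← trans e j≡0
  succ-injective (inj₂ (_ , e)) (inj₂ (_ , e′)) = Fin.toℕ-injective (ℕ.suc-injective (trans e (sym e′)))

  succ-functional : ∀ {i j j′} → Succ i j → Succ i j′ → j ≡ j′
  succ-functional (inj₁ e) (inj₁ e′) = Fin.toℕ-injective (trans (sym e) e′)
  succ-functional {j = j} (inj₁ e) (inj₂ (_ , e′)) = contradiction (trans (sym e) e′) (ℕ.<⇒≢ (Fin.toℕ<n j))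
  succ-functional {j′ = j} (inj₂ (_ , e′)) (inj₁ e) = contradiction (trans (sym e) e′) (ℕ.<⇒≢ (Fin.toℕ<n j))
  succ-functional (inj₂ (e , _)) (inj₂ (e′ , _)) = Fin.toℕ-injective (trans e (sym e′))

  next : ∀ i → ∃ (Succ i)
  next i with suc (toℕ i) ℕ.<? L
  ... | yes lt = fromℕ< lt , inj₁ (sym (Fin.toℕ-fromℕ< lt))
  ... | no ¬lt = fromℕ< {0} (ℕ.≤-trans (s≤s z≤n) 5≤L) ,
                 inj₂ (Fin.toℕ-fromℕ< _ , ℕ.≤-antisym (Fin.toℕ<n i) (ℕ.≮⇒≥ ¬lt))

  prev : ∀ i → ∃ λ h → Succ h i
  prev i with toℕ i | Fin.toℕ<n i
  ... | suc k | k<L = fromℕ< (ℕ.<-trans (ℕ.n<1+n k) k<L) , inj₁ (cong suc (Fin.toℕ-fromℕ< _))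
  ... | zero  | _ = proj₁ (greatest 5≤L) , inj₂ (refl , proj₂ (greatest 5≤L))

  data Steps : ℕ → Fin L → Fin L → Set where
    []  : ∀ {i} → Steps 0 i i
    _∷_ : ∀ {t i j k} → Succ i j → Steps t j k → Steps (suc t) i k

  -- The number `e` counts the passages from the last vertex to vertex 0, each of which costs `L`.
  advance : ∀ {t i j} → Steps t i j → ∃ λ e → toℕ i + t ≡ toℕ j + e * L
  advance {i = i} [] = 0 , refl
  advance {suc t} {i} {j} (st ∷ sts) with advance sts | st
  ... | e , eq | inj₁ s = e , trans (ℕ.+-suc (toℕ i) t) (trans (cong (_+ t) s) eq)
  ... | e , eq | inj₂ (k≡0 , s) = suc e , (begin
      toℕ i + suc t         ≡⟨ ℕ.+-suc (toℕ i) t ⟩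
      suc (toℕ i) + t       ≡⟨ cong (_+ t) s ⟩
      L + t                 ≡⟨ cong (L +_) (trans (cong (_+ t) (sym k≡0)) eq) ⟩
      L + (toℕ j + e * L)   ≡⟨ sym (ℕ.+-assoc L (toℕ j) _) ⟩
      L + toℕ j + e * L     ≡⟨ cong (_+ e * L) (ℕ.+-comm L (toℕ j)) ⟩
      toℕ j + L + e * L     ≡⟨ ℕ.+-assoc (toℕ j) L _ ⟩
      toℕ j + (L + e * L)   ∎)
    where open ≡-Reasoning

  no-return : ∀ {t i} → suc t < L → ¬ Steps (suc t) i i
  no-return {t} {i} t<L sts with advance sts
  ... | e , eq with ℕ.+-cancelˡ-≡ (toℕ i) (suc t) (e * L) eq
  ...   | eq′ with e
  ...     | suc e′ = ℕ.<⇒≱ t<L (ℕ.≤-trans (ℕ.m≤m+n L (e′ * L)) (ℕ.≤-reflexive (sym eq′)))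

  H-sym : Symm H
  H-sym u v with cycleAdj L σ u v in e₁ | cycleAdj L σ v u in e₂
  ... | nothing | nothing = refl
  ... | nothing | just _  = refl
  ... | just _  | nothing = refl
  ... | just _  | just _  = contradiction (edge⇒succ {u} {v} (_ , e₁) ∷ (edge⇒succ {v} {u} (_ , e₂) ∷ []))
                              (no-return (ℕ.≤-trans (s≤s (s≤s (s≤s z≤n))) 5≤L))

  edge⇒ : ∀ {i j} → Edge H i j → Succ i j ⊎ Succ j i
  edge⇒ {i} {j} e with symClose-edge⁻ {A = cycleAdj L σ} {i} {j} e
  ... | inj₁ e′ = inj₁ (edge⇒succ {i} {j} e′)
  ... | inj₂ e′ = inj₂ (edge⇒succ {j} {i} e′)

  ⇒edge : ∀ {i j} → Succ i j ⊎ Succ j i → Edge H i j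
  ⇒edge {i} {j} (inj₁ e) = symClose-edge {A = cycleAdj L σ} {i} {j} (inj₁ (succ⇒edge e))
  ⇒edge {i} {j} (inj₂ e) = symClose-edge {A = cycleAdj L σ} {i} {j} (inj₂ (succ⇒edge e))

  -- On the path `h`, `i`, `j`, `g` an edge between the outer vertices would close a cycle of length
  -- three or four, or force `g` back to `i`; `5 ≤ L` excludes this.
  stuck-succ : ∀ {i j} → Succ i j → ∃₂ (Blocks H i j)
  stuck-succ {i} {j} ij with prev i | next j
  ... | h , hi | g , jg = g , h
    , (λ { refl → no-return 2<L (ij ∷ (jg ∷ [])) })
    , (λ { refl → no-return 2<L (hi ∷ (ij ∷ [])) })
    , ⇒edge (inj₁ jg) , ⇒edge (inj₂ hi)
    , λ eq → case edge⇒ (_ , eq) of λ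
      { (inj₁ gh) → no-return 5≤L (hi ∷ (ij ∷ (jg ∷ (gh ∷ []))))
      ; (inj₂ hg) → case succ-functional hg hi of λ { refl → no-return 2<L (ij ∷ (jg ∷ [])) } }
    where 2<L = ℕ.≤-trans (s≤s (s≤s (s≤s z≤n))) 5≤L

  stuckC : Stuck H
  stuckC i j i≢j with nothing-or-edge (H i j)
  ... | inj₂ ij with edge⇒ ij
  ...   | inj₁ s = stuck-succ s
  ...   | inj₂ s = swap-blocks H-sym (stuck-succ s)
  -- Both vertices move forward. If their successors were consecutive, `succ-injective` would give
  -- `g ≡ i` or `h ≡ j`, hence an edge between `i` and `j`.
  stuckC i j i≢j | inj₁ ¬ij with next i | next j
  ... | h , ih | g , jg = g , h
    , (λ { refl → not-both ¬ij (proj₂ (⇒edge (inj₂ jg))) })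
    , (λ { refl → not-both ¬ij (proj₂ (⇒edge (inj₁ ih))) })
    , ⇒edge (inj₁ jg) , ⇒edge (inj₁ ih)
    , λ eq → case edge⇒ (_ , eq) of λ
      { (inj₁ gh) → case succ-injective gh ih of λ { refl → not-both ¬ij (proj₂ (⇒edge (inj₂ jg))) }
      ; (inj₂ hg) → case succ-injective hg jg of λ { refl → not-both ¬ij (proj₂ (⇒edge (inj₁ ih))) } }

-- Tadpoles

module Tad (𝕋 : Tadpole) where

  open Tadpole 𝕋 renaming (tt to ty)
  open TV

  H : Edges (TV m)
  H = tadE 𝕋

  x-y : ∀ i → toℕ i ≡ m → H (x i) y ≡ just neg
  x-y i eq rewrite ≡ᵇ-true eq = refl

  x-z : ∀ i → toℕ i ≡ m → H (x i) z ≡ just neg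
  x-z i eq rewrite ≡ᵇ-true eq = refl

  x≁y : ∀ i → toℕ i ≢ m → H (x i) y ≡ nothing
  x≁y i ne rewrite ≡ᵇ-false ne = refl

  x-w : ∀ i → H (x i) w ≡ just neg × ty ≡ type2 × suc (toℕ i) ≡ m ⊎ H (x i) w ≡ nothing
  x-w i with ty
  ... | type1 = inj₂ refl
  ... | type2 with suc (toℕ i) ℕ.≟ m
  ...   | yes eq rewrite ≡ᵇ-true eq = inj₁ (refl , refl , eq)
  ...   | no ne rewrite ≡ᵇ-false ne = inj₂ refl

  x-w-notpos : ∀ i → H (x i) w ≢ just pos
  x-w-notpos i eq with x-w i
  ... | inj₁ (e , _) with () ← trans (sym e) eq
  ... | inj₂ e       with () ← trans (sym e) eq

  x-x : ∀ i j → suc (toℕ i) ≡ toℕ j → Edge H (x i) (x j)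
  x-x i j eq rewrite ≡ᵇ-true eq = _ , refl

  x≁x : ∀ i j → suc (toℕ i) ≢ toℕ j → suc (toℕ j) ≢ toℕ i → H (x i) (x j) ≡ nothing
  x≁x i j ne ne′ rewrite ≡ᵇ-false ne | ≡ᵇ-false ne′ = refl

  H-sym : Symm H
  H-sym w w = refl
  H-sym w y = refl
  H-sym w z = refl
  H-sym w (x i) with isType2 ty ∧ (suc (toℕ i) ≡ᵇ m)
  ... | true  = refl
  ... | false = refl
  H-sym y w = refl
  H-sym y y = refl
  H-sym y z = refl
  H-sym y (x i) with toℕ i ≡ᵇ m
  ... | true  = refl
  ... | false = refl
  H-sym z w = refl
  H-sym z y = refl
  H-sym z z = refl
  H-sym z (x i) with toℕ i ≡ᵇ m
  ... | true  = refl
  ... | false = refl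
  H-sym (x i) w with isType2 ty ∧ (suc (toℕ i) ≡ᵇ m)
  ... | true  = refl
  ... | false = refl
  H-sym (x i) y with toℕ i ≡ᵇ m
  ... | true  = refl
  ... | false = refl
  H-sym (x i) z with toℕ i ≡ᵇ m
  ... | true  = refl
  ... | false = refl
  H-sym (x i) (x j) with suc (toℕ i) ≡ᵇ toℕ j in e₁ | suc (toℕ j) ≡ᵇ toℕ i in e₂
  ... | false | false = refl
  ... | false | true  = refl
  ... | true  | false = refl
  ... | true  | true  = contradiction
    (ℕ.<-trans (ℕ.≤-reflexive (ℕ.≡ᵇ⇒≡ (suc (toℕ i)) (toℕ j) (subst Data.Bool.T (sym e₁) _)))
               (ℕ.≤-reflexive (ℕ.≡ᵇ⇒≡ (suc (toℕ j)) (toℕ i) (subst Data.Bool.T (sym e₂) _))))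
    (ℕ.<-irrefl refl)

  end : TV m
  end = x zero

  beyond : ∀ i → (toℕ i ≡ m) ⊎ ∃ λ k → toℕ k ≡ suc (toℕ i)
  beyond i with toℕ i ℕ.≟ m
  ... | yes eq = inj₁ eq
  ... | no ne  = inj₂ (fromℕ< lt , Fin.toℕ-fromℕ< lt)
    where lt = s≤s (ℕ.≤∧≢⇒< (ℕ.≤-pred (Fin.toℕ<n i)) ne)

  nonend-nbr : ∀ u → ∃ λ g → g ≢ end × Edge H u g
  nonend-nbr w = y , (λ ()) , _ , refl
  nonend-nbr y = w , (λ ()) , _ , refl
  nonend-nbr z = w , (λ ()) , _ , refl
  nonend-nbr (x i) with beyond i
  ... | inj₁ eq = y , (λ ()) , _ , x-y i eq
  ... | inj₂ (k , eq) = x k , (λ { refl → case eq of λ () }) , x-x i k (sym eq)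

  private
    back : ∀ i → Edge H (x (suc i)) (x (inject₁ i))
    back i = edge-sym′ {H = H} H-sym {x (inject₁ i)} {x (suc i)} (x-x _ _ (cong suc (Fin.toℕ-inject₁ i)))

    back<m : ∀ i → toℕ (inject₁ {m} i) ≢ m
    back<m i eq = ℕ.<⇒≢ (Fin.toℕ<n i) (trans (sym (Fin.toℕ-inject₁ i)) eq)

    last : Fin (suc m)
    last = fromℕ m

    -- The blocking vertices point away from each other: the predecessor of the first vertex and the
    -- successor of the second, with `y` as the successor of the last `x`.
    block-xx : ∀ i j → toℕ i < toℕ j → ∃₂ (Blocks H (x (suc i)) (x (suc j)))
    block-xx i j i<j with beyond (suc j)
    ... | inj₁ eq = y , x (inject₁ i) , (λ ()) , h≢v , (_ , x-y (suc j) eq) , back i ,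
          not-both (trans (H-sym y (x (inject₁ i))) (x≁y _ (back<m i)))
      where
      h≢v : x (inject₁ i) ≢ x (suc j)
      h≢v eq with cong (λ { (x k) → toℕ k ; _ → 0 }) eq
      ... | e = ℕ.<⇒≢ (ℕ.<-trans i<j (ℕ.n<1+n _)) (trans (sym (Fin.toℕ-inject₁ i)) e)
    ... | inj₂ (k , eq) = x k , x (inject₁ i)
      , (λ e → ℕ.<⇒≢ (s≤s (ℕ.<-trans i<j (ℕ.n<1+n _))) (trans (sym (cong toℕ′ e)) eq))
      , (λ e → ℕ.<⇒≢ (ℕ.<-trans i<j (ℕ.n<1+n _)) (trans (sym (Fin.toℕ-inject₁ i)) (cong toℕ′ e)))
      , x-x (suc j) k (sym eq) , back i
      , not-both (x≁x k (inject₁ i)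
          (λ e → ℕ.<⇒≢ (ℕ.<-trans i<j (s≤s (ℕ.≤-trans (ℕ.n≤1+n _) (ℕ.n≤1+n _))))
                   (trans (sym (Fin.toℕ-inject₁ i)) (trans (sym e) (cong suc eq))))
          (λ e → ℕ.<⇒≢ (s≤s (ℕ.<-trans i<j (ℕ.n<1+n _)))
                   (trans (cong suc (sym (Fin.toℕ-inject₁ i))) (trans e eq))))
      where
      toℕ′ : TV m → ℕ
      toℕ′ (x k) = toℕ k
      toℕ′ _     = 0

    block-xw : ∀ i → ∃₂ (Blocks H (x (suc i)) w)
    block-xw i = y , x (inject₁ i) , (λ ()) , (λ ()) , (_ , refl) , back i ,
      not-both (trans (H-sym y (x (inject₁ i))) (x≁y _ (back<m i)))

    block-xy : ∀ i → ∃₂ (Blocks H (x (suc i)) y)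
    block-xy i = w , x (inject₁ i) , (λ ()) , (λ ()) , (_ , refl) , back i ,
      λ eq → x-w-notpos (inject₁ i) (trans (H-sym (x (inject₁ i)) w) eq)

    block-xz : ∀ i → ∃₂ (Blocks H (x (suc i)) z)
    block-xz i = w , x (inject₁ i) , (λ ()) , (λ ()) , (_ , refl) , back i ,
      λ eq → x-w-notpos (inject₁ i) (trans (H-sym (x (inject₁ i)) w) eq)

    y-last : H y (x last) ≡ just neg
    y-last = trans (H-sym y (x last)) (x-y _ (Fin.toℕ-fromℕ m))

    z-last : H z (x last) ≡ just neg
    z-last = trans (H-sym z (x last)) (x-z _ (Fin.toℕ-fromℕ m))

    neg≢pos : ∀ {e} → e ≡ just neg → e ≢ just pos
    neg≢pos refl ()

    block-yw : ∃₂ (Blocks H y w)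
    block-yw = z , x last , (λ ()) , (λ ()) , (_ , refl) , (_ , y-last) , neg≢pos z-last

    block-zw : ∃₂ (Blocks H z w)
    block-zw = y , x last , (λ ()) , (λ ()) , (_ , refl) , (_ , z-last) , neg≢pos y-last

    block-yz : ∃₂ (Blocks H y z)
    block-yz = x last , w , (λ ()) , (λ ()) , (_ , z-last) , (_ , refl) , x-w-notpos last

  -- The end is left out because it may have a single neighbour in its tadpole, which cannot block
  -- the edge between the two. The other half of a sum or join takes care of it.
  nonend-blocked : ∀ u v → u ≢ v → u ≢ end → v ≢ end → ∃₂ (Blocks H u v)
  nonend-blocked w w u≢v _ _ = contradiction refl u≢v
  nonend-blocked w y _ _ _ = swap-blocks H-sym block-yw
  nonend-blocked w z _ _ _ = swap-blocks H-sym block-zw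
  nonend-blocked y w _ _ _ = block-yw
  nonend-blocked y y u≢v _ _ = contradiction refl u≢v
  nonend-blocked y z _ _ _ = block-yz
  nonend-blocked z w _ _ _ = block-zw
  nonend-blocked z y _ _ _ = swap-blocks H-sym block-yz
  nonend-blocked z z u≢v _ _ = contradiction refl u≢v
  nonend-blocked (x zero) _ _ u≢end _ = contradiction refl u≢end
  nonend-blocked _ (x zero) _ _ v≢end = contradiction refl v≢end
  nonend-blocked w (x (suc j)) _ _ _ = swap-blocks H-sym (block-xw j)
  nonend-blocked y (x (suc j)) _ _ _ = swap-blocks H-sym (block-xy j)
  nonend-blocked z (x (suc j)) _ _ _ = swap-blocks H-sym (block-xz j)
  nonend-blocked (x (suc i)) w _ _ _ = block-xw i
  nonend-blocked (x (suc i)) y _ _ _ = block-xy i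
  nonend-blocked (x (suc i)) z _ _ _ = block-xz i
  nonend-blocked (x (suc i)) (x (suc j)) u≢v _ _ with ℕ.<-cmp (toℕ i) (toℕ j)
  ... | tri< i<j _ _ = block-xx i j i<j
  ... | tri≈ _ i≡j _ = contradiction (cong (x ∘ suc) (Fin.toℕ-injective i≡j)) u≢v
  ... | tri> _ _ j<i = swap-blocks H-sym (block-xx j i j<i)

  end? : ∀ u → Dec (u ≡ end)
  end? w = no λ ()
  end? y = no λ ()
  end? z = no λ ()
  end? (x zero) = yes refl
  end? (x (suc i)) = no λ ()

-- Sums and joins are stuck

module Glue {W : Set} {H : Edges W} (sm : Symm H) (T₁ T₂ : Tadpole)
  (L : TV (Tadpole.m T₁) → W) (R : TV (Tadpole.m T₂) → W)
  (L-inj : Injective _≡_ _≡_ L) (R-inj : Injective _≡_ _≡_ R)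
  (HL : ∀ u v → H (L u) (L v) ≡ tadE T₁ u v)
  (HR : ∀ u v → H (R u) (R v) ≡ tadE T₂ u v)
  (far : ∀ u v → u ≢ Tad.end T₁ → v ≢ Tad.end T₂ → H (L u) (R v) ≡ nothing)
  (L≢R : ∀ u v → u ≢ Tad.end T₁ ⊎ v ≢ Tad.end T₂ → L u ≢ R v)
  (Lout : ∃ λ v → v ≢ Tad.end T₂ × Edge H (L (Tad.end T₁)) (R v))
  (Rout : ∃ λ u → u ≢ Tad.end T₁ × Edge H (R (Tad.end T₂)) (L u))
  where

  private
    edgeL : ∀ {u v} → Edge (tadE T₁) u v → Edge H (L u) (L v)
    edgeL (σ , eq) = σ , trans (HL _ _) eq

    edgeR : ∀ {u v} → Edge (tadE T₂) u v → Edge H (R u) (R v)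
    edgeR (σ , eq) = σ , trans (HR _ _) eq

  blocked-LL : ∀ u v → u ≢ v → u ≢ Tad.end T₁ → v ≢ Tad.end T₁ → ∃₂ (Blocks H (L u) (L v))
  blocked-LL u v u≢v u≢e v≢e with Tad.nonend-blocked T₁ u v u≢v u≢e v≢e
  ... | g , h , g≢u , h≢v , vg , uh , notpos =
    L g , L h , g≢u ∘ L-inj , h≢v ∘ L-inj , edgeL vg , edgeL uh , λ eq → notpos (trans (sym (HL _ _)) eq)

  -- Every vertex has a non-end neighbour in its own tadpole, and non-ends of different tadpoles are
  -- not adjacent. In a sum the two ends coincide, so one of `u` and `v` has to be a non-end.
  blocked-LR : ∀ u v → u ≢ Tad.end T₁ ⊎ v ≢ Tad.end T₂ → ∃₂ (Blocks H (L u) (R v))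
  blocked-LR u v ne with Tad.nonend-nbr T₁ u | Tad.nonend-nbr T₂ v
  ... | h , h≢e , uh | g , g≢e , vg = R g , L h , L≢R u g (inj₂ g≢e) ∘ sym , L≢R h v (inj₁ h≢e)
    , edgeR vg , edgeL uh , not-both (trans (sm _ _) (far h g h≢e g≢e))

  -- Here the neighbour of the end is taken in the other tadpole, where `far` separates it from the
  -- neighbour of `v`.
  blocked-end-L : ∀ v → v ≢ Tad.end T₁ → ∃₂ (Blocks H (L (Tad.end T₁)) (L v))
  blocked-end-L v v≢e = let g , g≢e , vg = Tad.nonend-nbr T₁ v ; h , h≢e , uh = Lout in L g , R h , g≢e ∘ L-inj , L≢R v h (inj₁ v≢e) ∘ sym
    , edgeL vg , uh , not-both (far g h g≢e h≢e)

  blocked-L : ∀ u v → L u ≢ L v → ∃₂ (Blocks H (L u) (L v))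
  blocked-L u v u≢v with Tad.end? T₁ u | Tad.end? T₁ v
  ... | yes refl | yes refl = contradiction refl u≢v
  ... | yes refl | no v≢e   = blocked-end-L v v≢e
  ... | no u≢e   | yes refl = swap-blocks sm (blocked-end-L u u≢e)
  ... | no u≢e   | no v≢e   = blocked-LL u v (u≢v ∘ cong L) u≢e v≢e

  blocked-ends : ∃₂ (Blocks H (L (Tad.end T₁)) (R (Tad.end T₂)))
  blocked-ends with Tad.nonend-nbr T₁ (Tad.end T₁) | Tad.nonend-nbr T₂ (Tad.end T₂)
  ... | h , h≢e , uh | g , g≢e , vg = R g , L h , L≢R _ g (inj₂ g≢e) ∘ sym , L≢R h _ (inj₁ h≢e)
    , edgeR vg , edgeL uh , not-both (trans (sm _ _) (far h g h≢e g≢e))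

  blocked-cross : ∀ u v → ∃₂ (Blocks H (L u) (R v))
  blocked-cross u v with Tad.end? T₁ u | Tad.end? T₂ v
  ... | yes refl | yes refl = blocked-ends
  ... | no u≢e   | _        = blocked-LR u v (inj₁ u≢e)
  ... | yes _    | no v≢e   = blocked-LR u v (inj₂ v≢e)

not-end : ∀ {m} (u : TV m) → u ≢ TV.x zero → isEnd u ≡ false
not-end TV.w ne = refl
not-end TV.y ne = refl
not-end TV.z ne = refl
not-end (TV.x zero) ne = contradiction refl ne
not-end (TV.x (suc i)) ne = refl

stuckJ : ∀ J → Stuck (joinE J)
stuckJ J = stuck
  where
  open JoinData J

  sm : Symm (joinE J)
  sm (JoinV.jl u) (JoinV.jl v) = Tad.H-sym T u v
  sm (JoinV.jr u) (JoinV.jr v) = Tad.H-sym T′ u v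
  sm (JoinV.jl u) (JoinV.jr v) = refl
  sm (JoinV.jr u) (JoinV.jl v) = refl

  far : ∀ u v → u ≢ Tad.end T → v ≢ Tad.end T′ → joinCross J u v ≡ nothing
  far u v u≢e v≢e rewrite not-end u u≢e | not-end v v≢e = refl

  -- The vertices `y` and `w` of a tadpole lie in different parts, so the end of the other tadpole
  -- is joined to one of them.
  y-or-w : ∀ m o → ((not (odd m) xor o) ≡ true) ⊎ ((odd m xor o) ≡ true)
  y-or-w m o with odd m | o
  ... | true  | true  = inj₁ refl
  ... | true  | false = inj₂ refl
  ... | false | true  = inj₂ refl
  ... | false | false = inj₁ refl

  edgeL : ∀ v → sideR J v ≡ true → Edge (joinE J) (JoinV.jl (TV.x zero)) (JoinV.jr v)
  edgeL v eq rewrite eq = _ , refl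

  edgeR : ∀ u → (sideL J u xor opp) ≡ true → Edge (joinE J) (JoinV.jr (TV.x zero)) (JoinV.jl u)
  edgeR u eq rewrite eq | Bool.∨-zeroʳ (isEnd u ∧ opp) = _ , refl

  Lout : ∃ λ v → v ≢ Tad.end T′ × Edge (joinE J) (JoinV.jl (TV.x zero)) (JoinV.jr v)
  Lout with y-or-w (Tadpole.m T′) opp
  ... | inj₁ eq = TV.y , (λ ()) , edgeL TV.y eq
  ... | inj₂ eq = TV.w , (λ ()) , edgeL TV.w eq

  Rout : ∃ λ u → u ≢ Tad.end T × Edge (joinE J) (JoinV.jr (TV.x zero)) (JoinV.jl u)
  Rout with y-or-w (Tadpole.m T) opp
  ... | inj₁ eq = TV.y , (λ ()) , edgeR TV.y eq
  ... | inj₂ eq = TV.w , (λ ()) , edgeR TV.w eq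

  jl-inj : Injective _≡_ _≡_ (JoinV.jl {J})
  jl-inj refl = refl

  jr-inj : Injective _≡_ _≡_ (JoinV.jr {J})
  jr-inj refl = refl

  module G = Glue sm T T′ JoinV.jl JoinV.jr jl-inj jr-inj (λ _ _ → refl) (λ _ _ → refl)
                  far (λ _ _ _ ()) Lout Rout
  module G′ = Glue sm T′ T JoinV.jr JoinV.jl jr-inj jl-inj (λ _ _ → refl) (λ _ _ → refl)
                  (λ u v u≢e v≢e → far v u v≢e u≢e) (λ _ _ _ ()) Rout Lout

  stuck : Stuck (joinE J)
  stuck (JoinV.jl u) (JoinV.jl v) = G.blocked-L u v
  stuck (JoinV.jr u) (JoinV.jr v) = G′.blocked-L u v
  stuck (JoinV.jl u) (JoinV.jr v) _ = G.blocked-cross u v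
  stuck (JoinV.jr u) (JoinV.jl v) _ = G′.blocked-cross u v

stuckS : ∀ T T′ → Stuck (sumE T T′)
stuckS T T′ = stuck
  where
  open SumV
  open TVne

  R : TV (Tadpole.m T′) → SumV (Tadpole.m T) (Tadpole.m T′)
  R TV.w = r w′
  R TV.y = r y′
  R TV.z = r z′
  R (TV.x zero) = l (TV.x zero)
  R (TV.x (suc i)) = r (xs i)

  R-inj : Injective _≡_ _≡_ R
  R-inj {TV.w} {TV.w} refl = refl
  R-inj {TV.y} {TV.y} refl = refl
  R-inj {TV.z} {TV.z} refl = refl
  R-inj {TV.x zero} {TV.x zero} refl = refl
  R-inj {TV.x (suc i)} {TV.x (suc i)} refl = refl
  R-inj {TV.w} {TV.x zero} ()
  R-inj {TV.y} {TV.x zero} ()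
  R-inj {TV.z} {TV.x zero} ()
  R-inj {TV.x (suc _)} {TV.x zero} ()
  R-inj {TV.w} {TV.x (suc _)} ()
  R-inj {TV.y} {TV.x (suc _)} ()
  R-inj {TV.z} {TV.x (suc _)} ()

  r≡R : ∀ v → r v ≡ R (liftne v)
  r≡R w′ = refl
  r≡R y′ = refl
  r≡R z′ = refl
  r≡R (xs i) = refl

  toTail : ∀ v → v ≢ TV.x zero → ∃ λ t → v ≡ liftne t
  toTail TV.w _ = w′ , refl
  toTail TV.y _ = y′ , refl
  toTail TV.z _ = z′ , refl
  toTail (TV.x zero) ne = contradiction refl ne
  toTail (TV.x (suc i)) _ = xs i , refl

  HRt : ∀ u v → sumE T T′ (R (liftne u)) (R (liftne v)) ≡ tadE T′ (liftne u) (liftne v)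
  HRt u v = cong₂ (sumE T T′) (sym (r≡R u)) (sym (r≡R v))

  HR : ∀ u v → sumE T T′ (R u) (R v) ≡ tadE T′ u v
  HR u v with Tad.end? T′ u | Tad.end? T′ v
  ... | yes refl | yes refl = refl
  ... | yes refl | no v≢e with toTail v v≢e
  ...   | t , refl = cong (sumE T T′ (l (TV.x zero))) (sym (r≡R t))
  HR u v | no u≢e | yes refl with toTail u u≢e
  ...   | t , refl = cong (λ o → sumE T T′ o (l (TV.x zero))) (sym (r≡R t))
  HR u v | no u≢e | no v≢e with toTail u u≢e | toTail v v≢e
  ...   | t , refl | t′ , refl = HRt t t′

  sm : Symm (sumE T T′)
  sm (l u) (l v) = Tad.H-sym T u v
  sm (r u) (r v) = Tad.H-sym T′ (liftne u) (liftne v)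
  sm (l u) (r v) with isEnd u
  ... | true  = Tad.H-sym T′ (TV.x zero) (liftne v)
  ... | false = refl
  sm (r v) (l u) with isEnd u
  ... | true  = Tad.H-sym T′ (liftne v) (TV.x zero)
  ... | false = refl

  far : ∀ u v → u ≢ Tad.end T → v ≢ Tad.end T′ → sumE T T′ (l u) (R v) ≡ nothing
  far u v u≢e v≢e with toTail v v≢e
  ... | t , refl rewrite sym (r≡R t) | not-end u u≢e = refl

  l≢R : ∀ u v → u ≢ Tad.end T ⊎ v ≢ Tad.end T′ → l u ≢ R v
  l≢R u v ne eq with Tad.end? T′ v
  ... | no v≢e with toTail v v≢e
  ...   | t , refl with () ← trans eq (sym (r≡R t))
  l≢R u v (inj₁ u≢e) refl | yes refl = u≢e refl
  l≢R u v (inj₂ v≢e) refl | yes refl = v≢e refl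

  R≢l : ∀ u v → u ≢ Tad.end T′ ⊎ v ≢ Tad.end T → R u ≢ l v
  R≢l u v (inj₁ u≢e) eq = l≢R v u (inj₂ u≢e) (sym eq)
  R≢l u v (inj₂ v≢e) eq = l≢R v u (inj₁ v≢e) (sym eq)

  Lout : ∃ λ v → v ≢ Tad.end T′ × Edge (sumE T T′) (R (TV.x zero)) (R v)
  Lout with Tad.nonend-nbr T′ (TV.x zero)
  ... | g , g≢e , σ , eq = g , g≢e , σ , trans (HR (TV.x zero) g) eq

  Rout : ∃ λ u → u ≢ Tad.end T × Edge (sumE T T′) (l (TV.x zero)) (l u)
  Rout with Tad.nonend-nbr T (TV.x zero)
  ... | g , g≢e , σ , eq = g , g≢e , σ , eq

  l-inj : ∀ {u v} → _≡_ {A = SumV (Tadpole.m T) (Tadpole.m T′)} (l u) (l v) → u ≡ v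
  l-inj refl = refl

  module G = Glue sm T T′ l R l-inj R-inj (λ _ _ → refl) HR far l≢R Lout Rout
  module G′ = Glue sm T′ T R l R-inj l-inj HR (λ _ _ → refl)
    (λ u v u≢e v≢e → trans (sm (R u) (l v)) (far v u v≢e u≢e))
    R≢l Rout Lout

  stuck : Stuck (sumE T T′)
  stuck (l u) (l v) ne = G.blocked-L u v ne
  stuck (l u) (r v) _ rewrite r≡R v = G.blocked-cross u (liftne v)
  stuck (r u) (l v) _ rewrite r≡R u = G′.blocked-cross (liftne u) v
  stuck (r u) (r v) rewrite r≡R u | r≡R v = G′.blocked-L (liftne u) (liftne v)

-- A chordal order excludes the members of ℱ

data Member {n : ℕ} (E : Fin n → Fin n → Maybe Sign) : Set₁ where
  member : {V : Set} (H : Edges V) → Stuck H → (u v : V) → u ≢ v → Embeds H E →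
           (∀ {E′ : Fin n → Fin n → Maybe Sign} → Embeds H E′ → HasF E′) → Member E

-- Treats the ten kinds of members uniformly. The two distinct vertices that are recorded make
-- `Stuck` produce an edge, so that no member survives in an edgeless graph.
hasF-member : {E : Fin n → Fin n → Maybe Sign} → HasF E → Member E
hasF-member (hasF1 e)   = member _ stuckF1 V1.a V1.b (λ ()) e hasF1
hasF-member (hasF2 σ e) = member _ (stuckF2 σ) V2.a V2.b (λ ()) e (hasF2 σ)
hasF-member (hasF3 σ e) = member _ (stuckF3 σ) V3.a V3.b (λ ()) e (hasF3 σ)
hasF-member (hasF4 σ e) = member _ (stuckF4 σ) V4.a V4.b (λ ()) e (hasF4 σ)
hasF-member (hasF5 σ e) = member _ (stuckF5 σ) V4.a V4.b (λ ()) e (hasF5 σ)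
hasF-member (hasF6 σ e) = member _ (stuckF6 σ) V6.a V6.b (λ ()) e (hasF6 σ)
hasF-member (hasD σ e)  = member _ (stuckD σ) V4.a V4.b (λ ()) e (hasD σ)
hasF-member (hasC k 3≤k σ e) = member _ (Cycle.stuckC (2 * k) 5≤2k σ) i₀ i₁ i₀≢i₁ e (hasC k 3≤k σ)
  where
  5≤2k : 5 ≤ 2 * k
  5≤2k = ℕ.≤-trans (ℕ.n≤1+n 5) (ℕ.*-monoʳ-≤ 2 3≤k)
  i₀ i₁ : Fin (2 * k)
  i₀ = fromℕ< {0} (ℕ.≤-trans (s≤s z≤n) 5≤2k)
  i₁ = fromℕ< {1} (ℕ.≤-trans (s≤s (s≤s z≤n)) 5≤2k)
  i₀≢i₁ : i₀ ≢ i₁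
  i₀≢i₁ eq with () ← trans (sym (Fin.toℕ-fromℕ< _)) (trans (cong toℕ eq) (Fin.toℕ-fromℕ< _))
hasF-member (hasS T T′ e) = member _ (stuckS T T′) (SumV.l TV.w) (SumV.l TV.y) (λ ()) e (hasS T T′)
hasF-member (hasJ J e)    = member _ (stuckJ J) (JoinV.jl TV.w) (JoinV.jl TV.y) (λ ()) e (hasJ J)

hasF-edge : {E : Fin n → Fin n → Maybe Sign} → HasF E → ∃₂ (Edge E)
hasF-edge hf with hasF-member hf
... | member H stuck u v u≢v (f , _ , emb) _ with stuck u v u≢v
...   | g , _ , _ , _ , (σ , eq) , _ = f v , f g , σ , trans (emb v g) eq

module _ {E : Fin n → Fin n → Maybe Sign} {side : Fin n → Bool}
         (bi : Bichromatic side E) (sm : ∀ u v → E u v ≡ E v u)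
         {u v : Fin n} (uv : Edge E u v) (simp : SignedSimplicial side E u v) where

  hasF-delete : HasF E → HasF (deleteEdge u v E)
  hasF-delete hf with hasF-member hf
  ... | member H stuck _ _ _ e build = build (embeds-delete bi sm uv simp stuck e)

  hasF-undelete : HasF (deleteEdge u v E) → HasF E
  hasF-undelete hf with hasF-member hf
  ... | member H stuck _ _ _ e build = build (embeds-undelete bi sm uv simp stuck e)

  delete-bichromatic : Bichromatic side (deleteEdge u v E)
  delete-bichromatic i j (σ , eq) = bi i j (σ , delete-⊆ {E = E} u v i j eq)

  delete-sym : ∀ i j → deleteEdge u v E i j ≡ deleteEdge u v E j i
  delete-sym i j with ⌊ i ≟ u ⌋ | ⌊ j ≟ v ⌋ | ⌊ i ≟ v ⌋ | ⌊ j ≟ u ⌋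
  ... | true  | true  | true  | true  = refl
  ... | true  | true  | true  | false = refl
  ... | true  | true  | false | true  = refl
  ... | true  | true  | false | false = refl
  ... | true  | false | true  | true  = refl
  ... | true  | false | true  | false = sm i j
  ... | true  | false | false | true  = sm i j
  ... | true  | false | false | false = sm i j
  ... | false | true  | true  | true  = refl
  ... | false | true  | true  | false = sm i j
  ... | false | true  | false | true  = sm i j
  ... | false | true  | false | false = sm i j
  ... | false | false | true  | true  = refl
  ... | false | false | true  | false = sm i j
  ... | false | false | false | true  = sm i j
  ... | false | false | false | false = sm i j

-- A member of ℱ survives every deletion of the order, but the order ends in a graph without edges.
order⇒FFree : {E : Fin n → Fin n → Maybe Sign} {side : Fin n → Bool} →
  Bichromatic side E → (∀ u v → E u v ≡ E v u) → ∀ {es} → ChordalOrder side E es → ¬ HasF E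
order⇒FFree bi sm (done none) hf with hasF-edge hf
... | u , v , uv = not-both (none u v) (proj₂ uv)
order⇒FFree bi sm (step uv simp rest) hf =
  order⇒FFree (delete-bichromatic bi sm uv simp) (delete-sym bi sm uv simp) rest (hasF-delete bi sm uv simp hf)

-- Embedding the small members into a signed bigraph

sgn : Maybe Sign → Sign
sgn (just σ) = σ
sgn nothing  = pos

pairwise : {R : V → V → Set} {vs : List V} → AllPairs R vs →
           ∀ {u v} → u ∈ vs → v ∈ vs → u ≡ v ⊎ R u v ⊎ R v u
pairwise (_ ∷ _)  (here refl) (here refl) = inj₁ refl
pairwise (r ∷ _)  (here refl) (there v∈)  = inj₂ (inj₁ (All.lookup r v∈))
pairwise (r ∷ _)  (there u∈)  (here refl) = inj₂ (inj₂ (All.lookup r u∈))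
pairwise (_ ∷ rs) (there u∈)  (there v∈)  = pairwise rs u∈ v∈

-- The vertices of the path `v , us`, with `v` at index 0; the default beyond the end is immaterial.
nth : V → List V → ℕ → V
nth v us       zero    = v
nth v []       (suc k) = v
nth v (u ∷ us) (suc k) = nth u us k

nth-all : {P : V → Set} {v : V} {us : List V} → All P us → ∀ k → suc k ≤ length us → P (nth v us (suc k))
nth-all (px ∷ _)   zero    _         = px
nth-all (_ ∷ pxs)  (suc k) (s≤s k<l) = nth-all pxs k k<l

module Bigraph {n : ℕ} (G : SignedBigraph n) where

  open SignedBigraph G public

  infix 4 _~_ _~?_

  _~_ : Fin n → Fin n → Set
  u ~ v = Edge edge u v

  Neg Pos : Fin n → Fin n → Set
  Neg u v = edge u v ≡ just neg
  Pos u v = edge u v ≡ just pos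

  Same Opp : Fin n → Fin n → Set
  Same u v = side u ≡ side v
  Opp u v = side u ≢ side v

  private variable
    i j k l s t u v : Fin n
    us : List (Fin n)

  _~?_ : ∀ u v → Dec (u ~ v)
  u ~? v with nothing-or-edge (edge u v)
  ... | inj₁ eq = no (not-both eq ∘ proj₂)
  ... | inj₂ uv = yes uv

  ~-sym : u ~ v → v ~ u
  ~-sym (σ , eq) = σ , trans (edge-sym _ _) eq

  neg-sym : Neg u v → Neg v u
  neg-sym eq = trans (edge-sym _ _) eq

  pos-sym : Pos u v → Pos v u
  pos-sym eq = trans (edge-sym _ _) eq

  neg~ : Neg u v → u ~ v
  neg~ eq = neg , eq

  pos~ : Pos u v → u ~ v
  pos~ eq = pos , eq

  neg-not-pos : Neg u v → Pos u v → ⊥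
  neg-not-pos eq eq′ with () ← trans (sym eq) eq′

  not-pos⇒neg : u ~ v → ¬ Pos u v → Neg u v
  not-pos⇒neg (pos , eq) ¬p = contradiction eq ¬p
  not-pos⇒neg (neg , eq) ¬p = eq

  not-neg⇒pos : u ~ v → ¬ Neg u v → Pos u v
  not-neg⇒pos (pos , eq) ¬n = eq
  not-neg⇒pos (neg , eq) ¬n = contradiction eq ¬n

  nonadjacent : ¬ u ~ v → edge u v ≡ nothing
  nonadjacent {u} {v} ¬uv with nothing-or-edge (edge u v)
  ... | inj₁ eq = eq
  ... | inj₂ uv = contradiction uv ¬uv

  ~-opp : u ~ v → Opp u v
  ~-opp (σ , eq) = bip _ _ σ eq

  ~-distinct : u ~ v → u ≢ v
  ~-distinct uv refl = ~-opp uv refl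

  opp-sym : Opp u v → Opp v u
  opp-sym o = o ∘ sym

  opp-opp : Opp u v → Opp v t → Same u t
  opp-opp uv vt = trans (Bool.¬-not uv) (sym (Bool.¬-not (vt ∘ sym)))

  opp? : ∀ u v → Same u v ⊎ Opp u v
  opp? u v with side u Bool.≟ side v
  ... | yes eq = inj₁ eq
  ... | no ne  = inj₂ ne

  same-opp : Same u v → Opp v t → Opp u t
  same-opp eq o eq′ = o (trans (sym eq) eq′)

  same-≁ : Same u v → ¬ u ~ v
  same-≁ eq uv = ~-opp uv eq

  common : u ~ t → v ~ t → Same u v
  common ut vt = opp-opp (~-opp ut) (opp-sym (~-opp vt))

  separated-by : u ~ t → ¬ v ~ t → u ≢ v
  separated-by ut ¬vt refl = ¬vt ut

  opp-distinct : Opp u v → u ≢ v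
  opp-distinct o refl = o refl

  Entry : Fin n → Fin n → Maybe Sign → Set
  Entry u v e = u ≢ v × edge u v ≡ e

  same-entry : u ≢ v → Same u v → Entry u v nothing
  same-entry ne eq = ne , nonadjacent (same-≁ eq)

  neg-entry : Neg u v → Entry u v (just neg)
  neg-entry uv = ~-distinct (neg~ uv) , uv

  adj-entry : u ~ v → Entry u v (just (sgn (edge u v)))
  adj-entry uv@(σ , eq) = ~-distinct uv , trans eq (cong (just ∘ sgn) (sym eq))

  non-entry : Opp u v → ¬ u ~ v → Entry u v nothing
  non-entry o ¬uv = opp-distinct o , nonadjacent ¬uv

  -- Only pairs in list order have to be checked; the symmetry of `H`, included in each entry, gives
  -- the others.
  embedding : {vs : List V} → (∀ v → v ∈ vs) → {H : Edges V} (f : V → Fin n) →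
    All (λ v → H v v ≡ nothing) vs →
    AllPairs (λ u v → Entry (f u) (f v) (H u v) × H u v ≡ H v u) vs → Embeds H edge
  embedding complete {H} f loops entries = f , inj , emb
    where
    cmp : ∀ u v → _
    cmp u v = pairwise entries (complete u) (complete v)
    inj : Injective _≡_ _≡_ f
    inj {u} {v} eq with cmp u v
    ... | inj₁ u≡v = u≡v
    ... | inj₂ (inj₁ ((ne , _) , _)) = contradiction eq ne
    ... | inj₂ (inj₂ ((ne , _) , _)) = contradiction (sym eq) ne
    emb : ∀ u v → edge (f u) (f v) ≡ H u v
    emb u v with cmp u v
    ... | inj₁ refl = trans (edge-irr (f u)) (sym (All.lookup loops (complete u)))
    ... | inj₂ (inj₁ ((_ , e) , _)) = e
    ... | inj₂ (inj₂ ((_ , e) , hs)) = trans (edge-sym (f u) (f v)) (trans e hs)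

  -- The arbitrary signs of a member are read off the edges on which it is placed.
  signs : (V → Fin n) → V → V → Sign
  signs f u v = sgn (edge (f u) (f v))

  place4 : (i j k p q r : Fin n) → V4 → Fin n
  place4 i j k p q r V4.a = i
  place4 i j k p q r V4.b = j
  place4 i j k p q r V4.c = k
  place4 i j k p q r V4.p = p
  place4 i j k p q r V4.q = q
  place4 i j k p q r V4.r = r

  module Free (free : FFree G) where

    noF1 : ∀ {i j p q} → i ≢ j → p ≢ q → Neg i p → Neg i q → Neg j p → Neg j q → ⊥
    noF1 {i} {j} {p} {q} i≢j p≢q ip iq jp jq = free (hasF1 (embedding (λ
      { V1.a → here refl ; V1.b → there (here refl) ; V1.p → there (there (here refl))
      ; V1.q → there (there (there (here refl))) }) f (refl ∷ refl ∷ refl ∷ refl ∷ [])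
      ( ((same-entry i≢j (common (neg~ ip) (neg~ jp)) , refl) ∷ (neg-entry ip , refl) ∷ (neg-entry iq , refl) ∷ [])
      ∷ ((neg-entry jp , refl) ∷ (neg-entry jq , refl) ∷ [])
      ∷ ((same-entry p≢q (common (neg~ (neg-sym ip)) (neg~ (neg-sym iq))) , refl) ∷ [])
      ∷ [] ∷ [])))
      where
      f : V1 → Fin n
      f V1.a = i
      f V1.b = j
      f V1.p = p
      f V1.q = q

    noF2 : ∀ {i j p q r} → i ≢ j → p ≢ q → p ≢ r → q ≢ r →
           Neg i p → Neg i q → Neg j q → Neg j r → j ~ p → i ~ r → ⊥
    noF2 {i} {j} {p} {q} {r} i≢j p≢q p≢r q≢r ip iq jq jr jp ir = free (hasF2 (signs f) (embedding (λ
      { V2.a → here refl ; V2.b → there (here refl) ; V2.p → there (there (here refl))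
      ; V2.q → there (there (there (here refl))) ; V2.r → there (there (there (there (here refl)))) })
      f (refl ∷ refl ∷ refl ∷ refl ∷ refl ∷ [])
      ( ((same-entry i≢j (common ir (neg~ jr)) , refl) ∷ (neg-entry ip , refl) ∷ (neg-entry iq , refl) ∷ (adj-entry ir , refl) ∷ [])
      ∷ ((adj-entry jp , refl) ∷ (neg-entry jq , refl) ∷ (neg-entry jr , refl) ∷ [])
      ∷ ((same-entry p≢q (common (neg~ (neg-sym ip)) (neg~ (neg-sym iq))) , refl)
        ∷ (same-entry p≢r (common (~-sym jp) (neg~ (neg-sym jr))) , refl) ∷ [])
      ∷ ((same-entry q≢r (common (neg~ (neg-sym jq)) (neg~ (neg-sym jr))) , refl) ∷ [])
      ∷ [] ∷ [])))
      where
      f : V2 → Fin n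
      f V2.a = i
      f V2.b = j
      f V2.p = p
      f V2.q = q
      f V2.r = r

    noF3 : ∀ {i j p q r s} → i ≢ j → p ≢ q → p ≢ r → p ≢ s → q ≢ r → q ≢ s → r ≢ s →
           Neg i p → Neg i q → Neg j r → Neg j s → j ~ p → j ~ q → i ~ r → i ~ s → ⊥
    noF3 {i} {j} {p} {q} {r} {s} i≢j p≢q p≢r p≢s q≢r q≢s r≢s ip iq jr js jp jq ir is =
      free (hasF3 (signs f) (embedding (λ
      { V3.a → here refl ; V3.b → there (here refl) ; V3.p → there (there (here refl))
      ; V3.q → there (there (there (here refl))) ; V3.r → there (there (there (there (here refl))))
      ; V3.s → there (there (there (there (there (here refl))))) })
      f (refl ∷ refl ∷ refl ∷ refl ∷ refl ∷ refl ∷ [])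
      ( ((same-entry i≢j (common ir (neg~ jr)) , refl) ∷ (neg-entry ip , refl) ∷ (neg-entry iq , refl)
        ∷ (adj-entry ir , refl) ∷ (adj-entry is , refl) ∷ [])
      ∷ ((adj-entry jp , refl) ∷ (adj-entry jq , refl) ∷ (neg-entry jr , refl) ∷ (neg-entry js , refl) ∷ [])
      ∷ ((same-entry p≢q (cols jp jq) , refl) ∷ (same-entry p≢r (cols jp jr′) , refl) ∷ (same-entry p≢s (cols jp js′) , refl) ∷ [])
      ∷ ((same-entry q≢r (cols jq jr′) , refl) ∷ (same-entry q≢s (cols jq js′) , refl) ∷ [])
      ∷ ((same-entry r≢s (cols jr′ js′) , refl) ∷ [])
      ∷ [] ∷ [])))
      where
      jr′ = neg~ jr
      js′ = neg~ js
      cols : ∀ {u v} → j ~ u → j ~ v → Same u v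
      cols ju jv = common (~-sym ju) (~-sym jv)
      f : V3 → Fin n
      f V3.a = i
      f V3.b = j
      f V3.p = p
      f V3.q = q
      f V3.r = r
      f V3.s = s

    noF4 : ∀ {i j k p q r} → i ≢ j → i ≢ k → j ≢ k → p ≢ q → p ≢ r → q ≢ r →
           Neg i p → Neg j q → Neg k r → i ~ q → i ~ r → j ~ p → j ~ r → k ~ p → k ~ q → ⊥
    noF4 {i} {j} {k} {p} {q} {r} i≢j i≢k j≢k p≢q p≢r q≢r ip jq kr iq ir jp jr kp kq =
      free (hasF4 (signs (place4 i j k p q r)) (embedding complete4 (place4 i j k p q r)
      (refl ∷ refl ∷ refl ∷ refl ∷ refl ∷ refl ∷ [])
      ( ((same-entry i≢j (common ir jr) , refl) ∷ (same-entry i≢k (common iq kq) , refl)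
        ∷ (neg-entry ip , refl) ∷ (adj-entry iq , refl) ∷ (adj-entry ir , refl) ∷ [])
      ∷ ((same-entry j≢k (common jp kp) , refl)
        ∷ (adj-entry jp , refl) ∷ (neg-entry jq , refl) ∷ (adj-entry jr , refl) ∷ [])
      ∷ ((adj-entry kp , refl) ∷ (adj-entry kq , refl) ∷ (neg-entry kr , refl) ∷ [])
      ∷ ((same-entry p≢q (common (~-sym kp) (~-sym kq)) , refl) ∷ (same-entry p≢r (common (~-sym jp) (~-sym jr)) , refl) ∷ [])
      ∷ ((same-entry q≢r (common (~-sym iq) (~-sym ir)) , refl) ∷ [])
      ∷ [] ∷ [])))

    noF5 : ∀ {i j k p q r} → j ≢ k → p ≢ q → Neg j p → Neg k q →
           i ~ p → i ~ q → j ~ q → j ~ r → k ~ p → k ~ r → ¬ i ~ r → ⊥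
    noF5 {i} {j} {k} {p} {q} {r} j≢k p≢q jp kq ip iq jq jr kp kr ¬ir =
      free (hasF5 (signs (place4 i j k p q r)) (embedding complete4 (place4 i j k p q r)
      (refl ∷ refl ∷ refl ∷ refl ∷ refl ∷ refl ∷ [])
      ( ((same-entry (separated-by jr ¬ir ∘ sym) (common iq jq) , refl) ∷ (same-entry (separated-by kr ¬ir ∘ sym) (common ip kp) , refl)
        ∷ (adj-entry ip , refl) ∷ (adj-entry iq , refl) ∷ (non-entry (same-opp (common iq jq) (~-opp jr)) ¬ir , refl) ∷ [])
      ∷ ((same-entry j≢k (common jr kr) , refl)
        ∷ (neg-entry jp , refl) ∷ (adj-entry jq , refl) ∷ (adj-entry jr , refl) ∷ [])
      ∷ ((adj-entry kp , refl) ∷ (neg-entry kq , refl) ∷ (adj-entry kr , refl) ∷ [])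
      ∷ ((same-entry p≢q (common (~-sym ip) (~-sym iq)) , refl)
        ∷ (same-entry (λ { refl → ¬ir ip }) (common (~-sym kp) (~-sym kr)) , refl) ∷ [])
      ∷ ((same-entry (λ { refl → ¬ir iq }) (common (~-sym jq) (~-sym jr)) , refl) ∷ [])
      ∷ [] ∷ [])))

    noD : ∀ {i j k p q r} → Neg j q → i ~ p → i ~ q → j ~ p → j ~ r → k ~ q → k ~ r →
          ¬ i ~ r → ¬ k ~ p → ⊥
    noD {i} {j} {k} {p} {q} {r} jq ip iq jp jr kq kr ¬ir ¬kp =
      free (hasD (signs (place4 i j k p q r)) (embedding complete4 (place4 i j k p q r)
      (refl ∷ refl ∷ refl ∷ refl ∷ refl ∷ refl ∷ [])
      ( ((same-entry (separated-by jr ¬ir ∘ sym) (common ip jp) , refl) ∷ (same-entry (separated-by ip ¬kp) (common iq kq) , refl)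
        ∷ (adj-entry ip , refl) ∷ (adj-entry iq , refl) ∷ (non-entry (same-opp (common ip jp) (~-opp jr)) ¬ir , refl) ∷ [])
      ∷ ((same-entry (separated-by jp ¬kp) (common jr kr) , refl)
        ∷ (adj-entry jp , refl) ∷ (neg-entry jq , refl) ∷ (adj-entry jr , refl) ∷ [])
      ∷ ((non-entry (same-opp (common kr jr) (~-opp jp)) ¬kp , refl) ∷ (adj-entry kq , refl) ∷ (adj-entry kr , refl) ∷ [])
      ∷ ((same-entry (λ { refl → ¬kp kq }) (common (~-sym ip) (~-sym iq)) , refl)
        ∷ (same-entry (λ { refl → ¬ir ip }) (common (~-sym jp) (~-sym jr)) , refl) ∷ [])
      ∷ ((same-entry (λ { refl → ¬ir iq }) (common (~-sym kq) (~-sym kr)) , refl) ∷ [])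
      ∷ [] ∷ [])))

    noF6 : ∀ {i j k l p q r s} → i ≢ j → k ≢ l → p ≢ q → r ≢ s →
           Neg i p → Neg j p → Neg k q → Neg l r → Neg l s → i ~ q → j ~ q → k ~ p → l ~ p → l ~ q → k ~ r → k ~ s →
           ¬ i ~ r → ¬ i ~ s → ¬ j ~ r → ¬ j ~ s → ⊥
    noF6 {i} {j} {k} {l} {p} {q} {r} {s} i≢j k≢l p≢q r≢s ip jp kq lr ls iq jq kp lp lq kr ks ¬ir ¬is ¬jr ¬js =
      free (hasF6 (signs f) (embedding complete6 f
      (refl ∷ refl ∷ refl ∷ refl ∷ refl ∷ refl ∷ refl ∷ refl ∷ [])
      ( ((same-entry i≢j (common iq jq) , refl) ∷ (same-entry (separated-by kr ¬ir ∘ sym) (rows ip′ kp) , refl)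
        ∷ (same-entry (separated-by lr′ ¬ir ∘ sym) (rows ip′ lp) , refl)
        ∷ (neg-entry ip , refl) ∷ (adj-entry iq , refl) ∷ (non-entry (same-opp (rows ip′ kp) (~-opp kr)) ¬ir , refl)
        ∷ (non-entry (same-opp (rows ip′ kp) (~-opp ks)) ¬is , refl) ∷ [])
      ∷ ((same-entry (separated-by kr ¬jr ∘ sym) (rows jp′ kp) , refl) ∷ (same-entry (separated-by lr′ ¬jr ∘ sym) (rows jp′ lp) , refl)
        ∷ (neg-entry jp , refl) ∷ (adj-entry jq , refl) ∷ (non-entry (same-opp (rows jp′ kp) (~-opp kr)) ¬jr , refl)
        ∷ (non-entry (same-opp (rows jp′ kp) (~-opp ks)) ¬js , refl) ∷ [])
      ∷ ((same-entry k≢l (rows kp lp) , refl)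
        ∷ (adj-entry kp , refl) ∷ (neg-entry kq , refl) ∷ (adj-entry kr , refl) ∷ (adj-entry ks , refl) ∷ [])
      ∷ ((adj-entry lp , refl) ∷ (adj-entry lq , refl) ∷ (neg-entry lr , refl) ∷ (neg-entry ls , refl) ∷ [])
      ∷ ((same-entry p≢q (cols lp lq) , refl) ∷ (same-entry (λ { refl → ¬ir ip′ }) (cols lp lr′) , refl)
        ∷ (same-entry (λ { refl → ¬is ip′ }) (cols lp ls′) , refl) ∷ [])
      ∷ ((same-entry (λ { refl → ¬ir iq }) (cols lq lr′) , refl) ∷ (same-entry (λ { refl → ¬is iq }) (cols lq ls′) , refl) ∷ [])
      ∷ ((same-entry r≢s (cols lr′ ls′) , refl) ∷ [])
      ∷ [] ∷ [])))
      where
      ip′ = neg~ ip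
      jp′ = neg~ jp
      lr′ = neg~ lr
      ls′ = neg~ ls
      rows : ∀ {u v} → u ~ p → v ~ p → Same u v
      rows = common
      cols : ∀ {u v} → l ~ u → l ~ v → Same u v
      cols lu lv = common (~-sym lu) (~-sym lv)
      f : V6 → Fin n
      f V6.a = i
      f V6.b = j
      f V6.c = k
      f V6.d = l
      f V6.p = p
      f V6.q = q
      f V6.r = r
      f V6.s = s

half-bound : ∀ h → 3 ≤ 2 * h → 3 ≤ suc h
half-bound (suc zero)    (s≤s (s≤s ()))
half-bound (suc (suc h)) _ = s≤s (s≤s (s≤s z≤n))

-- Induced paths and holes

module Paths {n : ℕ} (G : SignedBigraph n) (free : FFree G) where

  open Bigraph G
  open Free free

  private variable
    s t u v o : Fin n
    us : List (Fin n)

  Apart : Fin n → Fin n → Set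
  Apart u v = u ≢ v × ¬ u ~ v

  -- Induced paths v , us with last vertex o.
  data Path (o : Fin n) : Fin n → List (Fin n) → Set where
    []  : Path o o []
    add : v ~ u → All (Apart v) us → Path o u us → Path o v (u ∷ us)

  path-parity : Path o v us → ∃ λ h → (Same v o × length us ≡ 2 * h) ⊎ (Opp v o × length us ≡ suc (2 * h))
  path-parity [] = 0 , inj₁ (refl , refl)
  path-parity (add vu _ p) with path-parity p
  ... | h , inj₁ (uo , eq) = h , inj₂ (opp-sym (same-opp (sym uo) (~-opp (~-sym vu))) , cong suc eq)
  ... | h , inj₂ (uo , eq) = suc h , inj₁ (opp-opp (~-opp vu) uo , trans (cong suc eq) (cong suc (sym (ℕ.+-suc h (h + 0)))))

  path-last : Path o v us → nth v us (length us) ≡ o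
  path-last [] = refl
  path-last (add _ _ p) = path-last p

  path-adj : Path o v us → ∀ i → suc i ≤ length us → nth v us i ~ nth v us (suc i)
  path-adj (add vu _ _) zero    _         = vu
  path-adj (add _ _ p)  (suc i) (s≤s i<l) = path-adj p i i<l

  path-apart : Path o v us → ∀ i j → suc i < j → j ≤ length us → Apart (nth v us i) (nth v us j)
  path-apart (add _ al _) zero    (suc zero)    (s≤s ())  _
  path-apart (add _ al _) zero    (suc (suc j)) _         (s≤s j<l) = nth-all al j j<l
  path-apart (add _ _ p)  (suc i) (suc j)       (s≤s i<j) (s≤s j≤l) = path-apart p i j i<j j≤l

  path-distinct : Path o v us → ∀ i j → i < j → j ≤ length us → nth v us i ≢ nth v us j
  path-distinct p i j i<j j≤l with suc i ℕ.≟ j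
  ... | yes refl = ~-distinct (path-adj p i j≤l)
  ... | no ne    = proj₁ (path-apart p i j (ℕ.≤∧≢⇒< i<j ne) j≤l)

  -- The ends `v` and `o` lie in the same part, so the path has even length `2 * h`. Together with
  -- `t` it closes to a cycle on `2 * suc h` vertices, and `3 ≤ length us` excludes the four-cycle.
  no-hole : Path o v us → t ~ v → t ~ o → 3 ≤ length us →
            All (λ u → u ≡ o ⊎ Apart t u) us → ⊥
  no-hole {o} {v} {us} {t} path tv to 3≤l apart with path-parity path
  ... | h , inj₂ (vo , _) = vo (common (~-sym tv) (~-sym to))
  ... | h , inj₁ (_ , l≡2h) = free (hasC (suc h) 3≤k σ (g ∘ toℕ , inj , emb))
    where
    L = 2 * suc h

    L≡ : L ≡ suc (suc (length us))
    L≡ = trans (cong suc (ℕ.+-suc h (h + 0))) (cong (2 +_) (sym l≡2h))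

    3≤k : 3 ≤ suc h
    3≤k = half-bound h (subst (3 ≤_) l≡2h 3≤l)

    open Cycle L (ℕ.≤-trans (ℕ.n≤1+n 5) (ℕ.*-monoʳ-≤ 2 3≤k)) using (H-sym)

    g : ℕ → Fin n
    g zero    = t
    g (suc i) = nth v us i

    -- The closing edge leads from index `L - 1` back to `t` at index 0.
    wrap : ℕ → ℕ
    wrap j = if j ≡ᵇ L then 0 else j

    σ : ℕ → Sign
    σ i = sgn (edge (g i) (g (wrap (suc i))))

    σ-edge : ∀ {i j} → wrap (suc i) ≡ j → g i ~ g j → edge (g i) (g j) ≡ just (σ i)
    σ-edge refl (τ , eq) = trans eq (cong (just ∘ sgn) (sym eq))

    t-apart : ∀ j → suc (suc j) ≤ length us → Apart t (nth v us (suc j))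
    t-apart j lt with nth-all apart j (ℕ.<⇒≤ lt)
    ... | inj₂ ap = ap
    ... | inj₁ eq = contradiction (trans eq (sym (path-last path))) (path-distinct path (suc j) (length us) lt ℕ.≤-refl)

    data View : ℕ → ℕ → Set where
      consecutive : ∀ {i} → suc i < L → g i ~ g (suc i) → View i (suc i)
      closing     : ∀ {j} → suc (suc j) ≡ L → 0 < j → g (suc j) ~ g 0 → View 0 (suc j)
      distant     : ∀ {i j} → suc i < j → (i ≡ 0 → suc j ≢ L) → Apart (g i) (g j) → View i j

    view : ∀ i j → i < j → j < L → View i j
    view zero (suc zero) _ lt = consecutive lt tv
    view zero (suc (suc j)) _ lt with suc (suc (suc j)) ℕ.≟ L
    ... | yes eq = closing eq (s≤s z≤n) (~-sym (subst (t ~_) (sym (trans (cong (nth v us) j≡) (path-last path))) to))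
      where
      j≡ : suc j ≡ length us
      j≡ = ℕ.suc-injective (ℕ.suc-injective (trans eq L≡))
    ... | no ne = distant (s≤s (s≤s z≤n)) (λ _ → ne)
          (t-apart j (ℕ.≤-pred (ℕ.≤-pred (subst (suc (suc (suc (suc j))) ≤_) L≡ (ℕ.≤∧≢⇒< lt ne)))))
    view (suc i) (suc j) (s≤s i<j) lt with suc i ℕ.≟ j
    ... | yes refl = consecutive lt (path-adj path i (ℕ.≤-pred (ℕ.≤-pred (subst (suc (suc (suc i)) ≤_) L≡ lt))))
    ... | no ne    = distant (s≤s (ℕ.≤∧≢⇒< i<j ne)) (λ ())
          (path-apart path i j (ℕ.≤∧≢⇒< i<j ne) (ℕ.≤-pred (ℕ.≤-pred (subst (suc (suc j) ≤_) L≡ lt))))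

    H : ℕ → ℕ → Maybe Sign
    H i j = (if suc i ≡ᵇ j then just (σ i) else if (j ≡ᵇ 0) ∧ (suc i ≡ᵇ L) then just (σ i) else nothing)
        <∣> (if suc j ≡ᵇ i then just (σ j) else if (i ≡ᵇ 0) ∧ (suc j ≡ᵇ L) then just (σ j) else nothing)

    view-edge : ∀ {i j} → View i j → edge (g i) (g j) ≡ H i j
    view-edge {i} (consecutive lt e)
      rewrite ≡ᵇ-true {i} refl = σ-edge (cong (λ b′ → if b′ then 0 else suc i) (≡ᵇ-false (ℕ.<⇒≢ lt))) e
    view-edge (closing {suc j} eq _ e)
      rewrite ≡ᵇ-true eq = trans (edge-sym _ _) (proj₂ (adj-entry e))
    view-edge {i} {suc j} (distant lt ne ap)
      rewrite ≡ᵇ-false (ℕ.<⇒≢ (ℕ.≤-pred lt))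
            | ≡ᵇ-false {suc (suc j)} {i} (λ { refl → ℕ.<⇒≱ lt (ℕ.m≤n+m _ 2) })
      with i
    ... | suc _ = nonadjacent (proj₂ ap)
    ... | zero rewrite ≡ᵇ-false (ne refl) = nonadjacent (proj₂ ap)

    view-distinct : ∀ {i j} → View i j → g i ≢ g j
    view-distinct (consecutive _ e) = ~-distinct e
    view-distinct (closing _ _ e)   = ~-distinct e ∘ sym
    view-distinct (distant _ _ ap)  = proj₁ ap

    emb : ∀ i j → edge (g (toℕ i)) (g (toℕ j)) ≡ symClose (cycleAdj L σ) i j
    emb i j with ℕ.<-cmp (toℕ i) (toℕ j)
    ... | tri< lt _ _ = view-edge (view _ _ lt (Fin.toℕ<n j))
    ... | tri> _ _ gt = trans (edge-sym _ _) (trans (view-edge (view _ _ gt (Fin.toℕ<n i))) (H-sym σ j i))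
    ... | tri≈ _ eq _ rewrite Fin.toℕ-injective eq = trans (edge-irr _) (sym loop)
      where
      loop : H (toℕ j) (toℕ j) ≡ nothing
      loop rewrite ≡ᵇ-false {suc (toℕ j)} {toℕ j} ℕ.1+n≢n with toℕ j ≡ᵇ 0 in e₁ | suc (toℕ j) ≡ᵇ L in e₂
      ... | false | _     = refl
      ... | true  | false = refl
      ... | true  | true  = contradiction
        (trans (sym (ℕ.≡ᵇ⇒≡ (suc (toℕ j)) L (subst Data.Bool.T (sym e₂) _)))
               (cong suc (ℕ.≡ᵇ⇒≡ (toℕ j) 0 (subst Data.Bool.T (sym e₁) _))))
        (λ { eq′ → case trans (sym L≡) eq′ of λ () })

    inj : Injective _≡_ _≡_ (g ∘ toℕ)
    inj {i} {j} eq with ℕ.<-cmp (toℕ i) (toℕ j)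
    ... | tri< lt _ _ = contradiction eq (view-distinct (view _ _ lt (Fin.toℕ<n j)))
    ... | tri> _ _ gt = contradiction (sym eq) (view-distinct (view _ _ gt (Fin.toℕ<n i)))
    ... | tri≈ _ e _  = Fin.toℕ-injective e

  _⊆ˡ_ : List (Fin n) → List (Fin n) → Set
  us ⊆ˡ vs = ∀ {i} → i ∈ us → i ∈ vs

  -- Extends an induced path by a new first vertex, cutting short to the neighbour
  -- closest to o.
  attach : ∀ y → Path o v us → (∃ λ us′ → Path o y us′ × us′ ⊆ˡ (v ∷ us)) ⊎ All (Apart y) (v ∷ us)
  attach {o} y [] with y ≟ o | y ~? o
  ... | yes refl | _      = inj₁ ([] , [] , λ ())
  ... | no _     | yes yo = inj₁ (_ , add yo [] [] , id)
  ... | no y≢o   | no ¬yo = inj₂ ((y≢o , ¬yo) ∷ [])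
  attach {v = v} y path@(add vu al p) with attach y p
  ... | inj₁ (us′ , p′ , sub) = inj₁ (us′ , p′ , there ∘ sub)
  ... | inj₂ none with y ≟ v | y ~? v
  ...   | yes refl | _      = inj₁ (_ , path , there)
  ...   | no _     | yes yv = inj₁ (_ , add yv none path , id)
  ...   | no y≢v   | no ¬yv = inj₂ ((y≢v , ¬yv) ∷ none)

  attach-adjacent : ∀ {y} → y ~ v → Path o v us → ∃ λ us′ → Path o y us′ × us′ ⊆ˡ (v ∷ us)
  attach-adjacent yv p with attach _ p
  ... | inj₁ r = r
  ... | inj₂ ((_ , ¬yv) ∷ _) = contradiction yv ¬yv

  -- Walks all of whose inner vertices satisfy A.
  data Walk (A : Fin n → Set) : Fin n → Fin n → Set where
    last : u ~ t → Walk A u t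
    via  : u ~ v → A v → Walk A v t → Walk A u t

  -- Keeps the part of the path from the neighbour `z` of `s` closest to `o`, so that `s` meets the
  -- rest at most in `o`.
  trim : ∀ s → Path o v us →
         (∃₂ λ z us′ → Path o z us′ × z ≢ o × s ~ z × All (λ u → u ≡ o ⊎ ¬ s ~ u) us′ × (z ∷ us′) ⊆ˡ (v ∷ us))
         ⊎ All (λ u → u ≡ o ⊎ ¬ s ~ u) (v ∷ us)
  trim s [] = inj₂ (inj₁ refl ∷ [])
  trim {o} {v} s path@(add vu al p) with trim s p
  ... | inj₁ (z , us′ , p′ , z≢o , sz , al′ , sub) = inj₁ (z , us′ , p′ , z≢o , sz , al′ , there ∘ sub)
  ... | inj₂ none with v ≟ o | s ~? v
  ...   | yes v≡o | _      = inj₂ (inj₁ v≡o ∷ none)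
  ...   | no v≢o  | yes sv = inj₁ (v , _ , path , v≢o , sv , none , id)
  ...   | no v≢o  | no ¬sv = inj₂ (inj₂ ¬sv ∷ none)

  walk-path : {A : Fin n → Set} → A v → Walk A v t →
              ∃ λ us → Path t v us × All (λ i → i ≡ t ⊎ A i) us
  walk-path _ (last vt) = _ , add vt [] [] , inj₁ refl ∷ []
  walk-path {v} av (via vu au wlk) with walk-path au wlk
  ... | us , p , al with attach-adjacent vu p
  ...   | us′ , p′ , sub = us′ , p′ , All.tabulate (λ i∈ → All.lookup (inj₂ au ∷ al) (sub i∈))

  module _ (su : s ~ u) (uv : u ~ v) (vt : v ~ t) where

    Avoids : Fin n → Set
    Avoids i = ¬ i ~ u × ¬ i ~ v

    -- A shortest s–t path through the walk closes up with u and v to a hole if s and t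
    -- are not adjacent; a negative edge s t gives D or a shorter hole.
    square-closes : ∀ {v₁} → s ~ v₁ → Avoids v₁ → Walk Avoids v₁ t → Pos s t
    square-closes {v₁} sv₁ av₁ wlk with walk-path av₁ wlk
    ... | us₀ , p₀ , al₀ with trim s p₀
    ...   | inj₂ (h ∷ _) = ⊥-elim ([ (λ { refl → proj₂ av₁ (~-sym vt) }) , (λ ¬sv₁ → ¬sv₁ sv₁) ]′ h)
    ...   | inj₁ (z , us , p , z≢t , sz , al , sub) with s ~? t
    ...     | yes st = not-neg⇒pos st (λ neg-st → negative neg-st p inner al)
      where
      inner : All (λ i → i ≡ t ⊎ Avoids i) (z ∷ us)
      inner = All.tabulate (λ i∈ → All.lookup (inj₂ av₁ ∷ al₀) (sub i∈))
      negative : ∀ {us} → Neg s t → Path t z us → All (λ i → i ≡ t ⊎ Avoids i) (z ∷ us) →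
                 All (λ i → i ≡ t ⊎ ¬ s ~ i) us → ⊥
      negative _ [] _ _ = z≢t refl
      negative _ (add zt _ []) _ _ = ~-opp zt (common (~-sym sz) (~-sym st))
      negative neg-st (add {u = x₂} zx₂ _ (add x₂t _ [])) (inj₁ z≡t ∷ _) _ = z≢t z≡t
      negative neg-st (add {u = x₂} zx₂ _ (add x₂t _ [])) (inj₂ az ∷ inj₁ x₂≡t ∷ _) _ = ~-distinct x₂t x₂≡t
      -- The squares `s u v t` and `s z x₂ t` share the negative edge `s t` and have no further
      -- edges between them: this is D.
      negative neg-st (add {u = x₂} zx₂ _ (add x₂t _ [])) (inj₂ az ∷ inj₂ ax₂ ∷ _) _ =
        noD neg-st (~-sym uv) vt su sz x₂t (~-sym zx₂) (proj₂ az ∘ ~-sym) (proj₁ ax₂)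
      negative neg-st path@(add _ _ (add _ _ (add _ _ _))) inn nb =
        -- With a longer path, `s` and the path alone form the hole, closed by the edge `s t`.
        no-hole path sz st (s≤s (s≤s (s≤s z≤n)))
          (All.zipWith apart (All.tail inn , nb))
        where
        apart : ∀ {i} → (i ≡ t ⊎ Avoids i) × (i ≡ t ⊎ ¬ s ~ i) → i ≡ t ⊎ Apart s i
        apart (inj₁ eq , _)      = inj₁ eq
        apart (inj₂ _ , inj₁ eq) = inj₁ eq
        apart (inj₂ ai , inj₂ ¬si) = inj₂ ((λ { refl → proj₁ ai su }) , ¬si)
    -- Without the edge `s t`, the hole consists of the induced path from `u` through `s` and `z` to
    -- `t`, closed by `v`.
    ...     | no ¬st = ⊥-elim (no-hole
               (add (~-sym su) (All.map u-apart inner) (add sz (All.zipWith s-apart (All.tail inner , al)) p))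
               (~-sym uv) vt (long p)
               (inj₂ (v≢s , same-≁ (common (~-sym uv) su)) ∷ All.map v-apart inner))
      where
      inner : All (λ i → i ≡ t ⊎ Avoids i) (z ∷ us)
      inner = All.tabulate (λ i∈ → All.lookup (inj₂ av₁ ∷ al₀) (sub i∈))
      u-apart : ∀ {i} → i ≡ t ⊎ Avoids i → Apart u i
      u-apart (inj₁ refl) = (λ { refl → ¬st su }) , same-≁ (common uv (~-sym vt))
      u-apart (inj₂ ai)   = (λ { refl → proj₂ ai uv }) , proj₁ ai ∘ ~-sym
      s-apart : ∀ {i} → (i ≡ t ⊎ Avoids i) × (i ≡ t ⊎ ¬ s ~ i) → Apart s i
      s-apart (inj₁ refl , _)      = opp-distinct s-opp-t , ¬st
        where
        s-opp-t : Opp s t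
        s-opp-t = opp-sym (same-opp (common (~-sym vt) uv) (opp-sym (~-opp su)))
      s-apart (inj₂ ai , inj₁ refl) = contradiction (~-sym vt) (proj₂ ai)
      s-apart (inj₂ ai , inj₂ ¬si) = (λ { refl → proj₁ ai su }) , ¬si
      v-apart : ∀ {i} → i ≡ t ⊎ Avoids i → i ≡ t ⊎ Apart v i
      v-apart (inj₁ eq) = inj₁ eq
      v-apart (inj₂ ai) = inj₂ ((λ { refl → proj₁ ai (~-sym uv) }) , proj₂ ai ∘ ~-sym)
      v≢s : v ≢ s
      v≢s refl = ¬st vt
      long : ∀ {us} → Path t z us → 3 ≤ length (s ∷ z ∷ us)
      long [] = contradiction refl z≢t
      long (add _ _ _) = s≤s (s≤s (s≤s z≤n))

-- Sums and joins

module Rootings {n : ℕ} (G : SignedBigraph n) (free : FFree G) where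

  open Bigraph G
  open Free free
  open Paths G free

  private variable
    i j k s t u v o : Fin n

  record Rooted (s : Fin n) (In : Fin n → Set) : Set where
    constructor rooted
    field
      T      : Tadpole
    open Tadpole T public using (m) renaming (tt to ty)
    field
      embed  : Embeds (tadE T) edge
    f : TV m → Fin n
    f = proj₁ embed
    f-inj : Injective _≡_ _≡_ f
    f-inj = proj₁ (proj₂ embed)
    f-emb : ∀ u v → edge (f u) (f v) ≡ tadE T u v
    f-emb = proj₂ (proj₂ embed)
    field
      root   : f (TV.x zero) ≡ s
      inside : ∀ u → u ≢ TV.x zero → In (f u)

    f-edge : ∀ {u v} → Edge (tadE T) u v → f u ~ f v
    f-edge (τ , eq) = τ , trans (f-emb _ _) eq

    off-root : ∀ u → u ≢ TV.x zero → f u ≢ s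
    off-root u u≢e eq = u≢e (f-inj (trans eq (sym root)))

    private
      flip : ∀ b {u v} → f u ~ f v → side (f u) ≡ b xor side s → side (f v) ≡ not b xor side s
      flip b uv eq = trans (Bool.¬-not (~-opp (~-sym uv))) (trans (cong not eq) (Bool.not-distribˡ-xor b (side s)))

      colour-x : ∀ k i → toℕ i ≡ k → side (f (TV.x i)) ≡ odd k xor side s
      colour-x zero zero _ = cong side root
      colour-x (suc k) (suc i) eq =
        flip (odd k) (f-edge (Tad.x-x T (inject₁ i) (suc i) (cong suc (Fin.toℕ-inject₁ i))))
             (colour-x k (inject₁ i) (trans (Fin.toℕ-inject₁ i) (ℕ.suc-injective eq)))

      colour-y : side (f TV.y) ≡ odd (suc m) xor side s
      colour-y = flip (odd m) (f-edge (neg , Tad.x-y T (fromℕ m) (Fin.toℕ-fromℕ m))) (colour-x m (fromℕ m) (Fin.toℕ-fromℕ m))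

    -- The part of the end determines the parts of all vertices, so the bipartition that 𝒥
    -- prescribes by `col` and `opp` is the one given by `side`.
    colour : ∀ u → side (f u) ≡ col u xor side s
    colour (TV.x i) = colour-x (toℕ i) i refl
    colour TV.y = colour-y
    colour TV.z = flip (odd m) (f-edge (neg , Tad.x-z T (fromℕ m) (Fin.toℕ-fromℕ m))) (colour-x m (fromℕ m) (Fin.toℕ-fromℕ m))
    colour TV.w = trans (flip (not (odd m)) (f-edge {TV.y} {TV.w} (_ , refl)) colour-y) (cong (_xor side s) (Bool.not-involutive (odd m)))

  weaken : {A B : Fin n → Set} → (∀ {i} → A i → B i) → Rooted s A → Rooted s B
  weaken A⊆B (rooted T embed root inside) = rooted T embed root (λ u u≢e → A⊆B (inside u u≢e))

  rootedA : {In : Fin n → Set} → i ≢ j → Neg s i → Neg s j → o ~ i → o ~ j → o ≢ s → In i → In j → In o → Rooted s In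
  rootedA {i} {j} {s} {o} {In} i≢j si sj oi oj o≢s Ii Ij Io = rooted T (embedding complete f (refl ∷ refl ∷ refl ∷ refl ∷ [])
      ( ((same-entry (o≢s ∘ sym) (common (neg~ si) oi) , refl) ∷ (neg-entry si , refl) ∷ (neg-entry sj , refl) ∷ [])
      ∷ ((adj-entry oi , refl) ∷ (adj-entry oj , refl) ∷ [])
      ∷ ((same-entry i≢j (common (~-sym oi) (~-sym oj)) , refl) ∷ [])
      ∷ [] ∷ [])) refl inside
    where
    f : TV 0 → Fin n
    f TV.w = o
    f TV.y = i
    f TV.z = j
    f (TV.x zero) = s
    T : Tadpole
    T = record { tt = type1 ; m = 0 ; valid = λ () ; σ = signs f }
    complete : ∀ v → v ∈ TV.x zero ∷ TV.w ∷ TV.y ∷ TV.z ∷ []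
    complete (TV.x zero) = here refl
    complete (TV.x (suc ()))
    complete TV.w = there (here refl)
    complete TV.y = there (there (here refl))
    complete TV.z = there (there (there (here refl)))
    inside : ∀ u → u ≢ TV.x zero → In (f u)
    inside TV.w _ = Io
    inside TV.y _ = Ii
    inside TV.z _ = Ij
    inside (TV.x zero) ne = contradiction refl ne

  -- A tadpole of type 2 with two path vertices, `s` and `k`: the additional negative edge at `w`
  -- leads to the end `s` itself.
  rootedB : {In : Fin n → Set} → i ≢ j → Neg k i → Neg k j → Neg o s → k ~ s → o ~ i → o ~ j → k ≢ o → i ≢ s → j ≢ s →
            In i → In j → In k → In o → Rooted s In
  rootedB {i} {j} {k} {o} {s} {In} i≢j ki kj os ks oi oj k≢o i≢s j≢s Ii Ij Ik Io =
    rooted T (embedding complete f (refl ∷ refl ∷ refl ∷ refl ∷ refl ∷ [])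
      ( ((adj-entry (~-sym ks) , refl) ∷ (neg-entry (neg-sym os) , refl)
        ∷ (same-entry (i≢s ∘ sym) (common (~-sym ks) (neg~ (neg-sym ki))) , refl)
        ∷ (same-entry (j≢s ∘ sym) (common (~-sym ks) (neg~ (neg-sym kj))) , refl) ∷ [])
      ∷ ((same-entry k≢o (common (neg~ ki) oi) , refl) ∷ (neg-entry ki , refl) ∷ (neg-entry kj , refl) ∷ [])
      ∷ ((adj-entry oi , refl) ∷ (adj-entry oj , refl) ∷ [])
      ∷ ((same-entry i≢j (common (~-sym oi) (~-sym oj)) , refl) ∷ [])
      ∷ [] ∷ [])) refl inside
    where
    f : TV 1 → Fin n
    f TV.w = o
    f TV.y = i
    f TV.z = j
    f (TV.x zero) = s
    f (TV.x (suc zero)) = k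
    T : Tadpole
    T = record { tt = type2 ; m = 1 ; valid = λ _ → s≤s z≤n ; σ = signs f }
    complete : ∀ v → v ∈ TV.x zero ∷ TV.x (suc zero) ∷ TV.w ∷ TV.y ∷ TV.z ∷ []
    complete (TV.x zero) = here refl
    complete (TV.x (suc zero)) = there (here refl)
    complete (TV.x (suc (suc ())))
    complete TV.w = there (there (here refl))
    complete TV.y = there (there (there (here refl)))
    complete TV.z = there (there (there (there (here refl))))
    inside : ∀ u → u ≢ TV.x zero → In (f u)
    inside TV.w _ = Io
    inside TV.y _ = Ii
    inside TV.z _ = Ij
    inside (TV.x zero) ne = contradiction refl ne
    inside (TV.x (suc zero)) _ = Ik

  -- The small tadpoles that chain graphs produce: a member of W₁, and type 2 with two path
  -- vertices. They are kept as bare vertices because the signs towards the other end are later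
  -- examined vertex by vertex.
  data LeafAt (C : Fin n → Set) (s : Fin n) : Set where
    leafA : ∀ {i j o} → i ≢ j → Neg s i → Neg s j → o ~ i → o ~ j → o ≢ s → C i → C j → C o → LeafAt C s
    leafB : ∀ {i j k o} → i ≢ j → Neg k i → Neg k j → Neg o s → k ~ s → o ~ i → o ~ j → k ≢ o → i ≢ s → j ≢ s →
            C i → C j → C k → C o → LeafAt C s

  leaf-rooted : {C : Fin n → Set} → LeafAt C s → Rooted s C
  leaf-rooted (leafA n₁ e₁ e₂ e₃ e₄ n₂ c₁ c₂ c₃) = rootedA n₁ e₁ e₂ e₃ e₄ n₂ c₁ c₂ c₃
  leaf-rooted (leafB n₁ e₁ e₂ e₃ e₄ e₅ e₆ n₂ n₃ n₄ c₁ c₂ c₃ c₄) = rootedB n₁ e₁ e₂ e₃ e₄ e₅ e₆ n₂ n₃ n₄ c₁ c₂ c₃ c₄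

  extend : {A B : Fin n → Set} (ρ : Rooted s A) → v ~ s → (∀ {i} → A i → Apart v i) →
           (∀ {i} → A i → B i) → B s → Rooted v B
  extend {s} {v} {A} {B} ρ vs apart A⊆B Bs = rooted T⁺ (f⁺ , inj , emb) refl inside⁺
    where
    open Rooted ρ
    open Tadpole T using (σ; valid)
    f⁺ : TV (suc m) → Fin n
    f⁺ TV.w = f TV.w
    f⁺ TV.y = f TV.y
    f⁺ TV.z = f TV.z
    f⁺ (TV.x zero) = v
    f⁺ (TV.x (suc i)) = f (TV.x i)

    old : TV (suc m) → TV m
    old TV.w = TV.w
    old TV.y = TV.y
    old TV.z = TV.z
    old (TV.x zero) = TV.x zero
    old (TV.x (suc i)) = TV.x i

    σ⁺ : TV (suc m) → TV (suc m) → Sign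
    σ⁺ (TV.x zero) _ = sgn (edge v s)
    σ⁺ u u′ = σ (old u) (old u′)

    T⁺ : Tadpole
    T⁺ = record { tt = ty ; m = suc m ; valid = λ _ → s≤s z≤n ; σ = σ⁺ }

    v-apart : ∀ u → u ≢ TV.x zero → Apart v (f u)
    v-apart u ne = apart (inside u ne)

    v≢f : ∀ u → v ≢ f u
    v≢f u with Tad.end? T u
    ... | yes refl = λ eq → ~-distinct vs (trans eq root)
    ... | no ne    = proj₁ (v-apart u ne)

    -- In type 2 the old `m` is positive, so the vertex that carries the additional edge to `w` is
    -- not the new end.
    no-w : isType2 ty ∧ (0 ≡ᵇ m) ≡ false
    no-w with ty | valid
    ... | type1 | _   = refl
    ... | type2 | val with m | val refl
    ...   | suc _ | _ = refl

    v-none : ∀ u → u ≢ TV.x zero → edge v (f u) ≡ nothing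
    v-none u ne = nonadjacent (proj₂ (v-apart u ne))

    v-emb : ∀ u → edge v (f⁺ u) ≡ tadE T⁺ (TV.x zero) u
    v-emb TV.w rewrite no-w = v-none TV.w λ ()
    v-emb TV.y = v-none TV.y λ ()
    v-emb TV.z = v-none TV.z λ ()
    v-emb (TV.x zero) = edge-irr v
    v-emb (TV.x (suc zero)) rewrite root = proj₂ (adj-entry vs)
    v-emb (TV.x (suc (suc i))) = v-none (TV.x (suc i)) λ ()

    emb : ∀ u u′ → edge (f⁺ u) (f⁺ u′) ≡ tadE T⁺ u u′
    emb (TV.x zero) u = v-emb u
    emb u@TV.w (TV.x zero) = trans (edge-sym _ _) (trans (v-emb u) (Tad.H-sym T⁺ (TV.x zero) u))
    emb u@TV.y (TV.x zero) = trans (edge-sym _ _) (trans (v-emb u) (Tad.H-sym T⁺ (TV.x zero) u))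
    emb u@TV.z (TV.x zero) = trans (edge-sym _ _) (trans (v-emb u) (Tad.H-sym T⁺ (TV.x zero) u))
    emb u@(TV.x (suc _)) (TV.x zero) = trans (edge-sym _ _) (trans (v-emb u) (Tad.H-sym T⁺ (TV.x zero) u))
    emb TV.w TV.w = f-emb TV.w TV.w
    emb TV.w TV.y = f-emb TV.w TV.y
    emb TV.w TV.z = f-emb TV.w TV.z
    emb TV.w (TV.x (suc i)) = f-emb TV.w (TV.x i)
    emb TV.y TV.w = f-emb TV.y TV.w
    emb TV.y TV.y = f-emb TV.y TV.y
    emb TV.y TV.z = f-emb TV.y TV.z
    emb TV.y (TV.x (suc i)) = f-emb TV.y (TV.x i)
    emb TV.z TV.w = f-emb TV.z TV.w
    emb TV.z TV.y = f-emb TV.z TV.y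
    emb TV.z TV.z = f-emb TV.z TV.z
    emb TV.z (TV.x (suc i)) = f-emb TV.z (TV.x i)
    emb (TV.x (suc i)) TV.w = f-emb (TV.x i) TV.w
    emb (TV.x (suc i)) TV.y = f-emb (TV.x i) TV.y
    emb (TV.x (suc i)) TV.z = f-emb (TV.x i) TV.z
    emb (TV.x (suc i)) (TV.x (suc j)) = f-emb (TV.x i) (TV.x j)

    f⁺-old : ∀ u → u ≡ TV.x zero ⊎ (f⁺ u ≡ f (old u) × (∀ {u′} → f⁺ u′ ≡ f (old u′) → u′ ≢ TV.x zero → old u ≡ old u′ → u ≡ u′))
    f⁺-old TV.w = inj₂ (refl , λ { {TV.w} _ _ _ → refl ; {TV.x zero} _ ne _ → contradiction refl ne ; {TV.x (suc _)} _ _ () })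
    f⁺-old TV.y = inj₂ (refl , λ { {TV.y} _ _ _ → refl ; {TV.x zero} _ ne _ → contradiction refl ne ; {TV.x (suc _)} _ _ () })
    f⁺-old TV.z = inj₂ (refl , λ { {TV.z} _ _ _ → refl ; {TV.x zero} _ ne _ → contradiction refl ne ; {TV.x (suc _)} _ _ () })
    f⁺-old (TV.x zero) = inj₁ refl
    f⁺-old (TV.x (suc i)) = inj₂ (refl , λ { {TV.x zero} _ ne _ → contradiction refl ne ; {TV.x (suc _)} _ _ refl → refl })

    inj : Injective _≡_ _≡_ f⁺
    inj {u} {u′} eq with f⁺-old u | f⁺-old u′
    ... | inj₁ refl | inj₁ refl = refl
    ... | inj₁ refl | inj₂ (eq′ , _) = contradiction (trans eq eq′) (v≢f (old u′))
    ... | inj₂ (eq′ , _) | inj₁ refl = contradiction (trans (sym eq) eq′) (v≢f (old u))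
    ... | inj₂ (eq₁ , back) | inj₂ (eq₂ , _) with Tad.end? T⁺ u′
    ...   | no ne = back eq₂ ne (f-inj (trans (sym eq₁) (trans eq eq₂)))
    ...   | yes refl = contradiction (trans (sym eq) eq₁) (v≢f (old u))

    inside⁺ : ∀ u → u ≢ TV.x zero → B (f⁺ u)
    inside⁺ TV.w _ = A⊆B (inside TV.w λ ())
    inside⁺ TV.y _ = A⊆B (inside TV.y λ ())
    inside⁺ TV.z _ = A⊆B (inside TV.z λ ())
    inside⁺ (TV.x zero) ne = contradiction refl ne
    inside⁺ (TV.x (suc zero)) _ = subst B (sym root) Bs
    inside⁺ (TV.x (suc (suc i))) _ = A⊆B (inside (TV.x (suc i)) λ ())

  no-sum : {A B : Fin n → Set} → Rooted s A → Rooted s B → (∀ {i j} → A i → B j → Apart i j) → ⊥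
  no-sum {s} {A} {B} ρ₁ ρ₂ apart = free (hasS R₁.T R₂.T (g , inj , emb))
    where
    module R₁ = Rooted ρ₁
    module R₂ = Rooted ρ₂

    g : SumV R₁.m R₂.m → Fin n
    g (SumV.l u) = R₁.f u
    g (SumV.r v) = R₂.f (liftne v)

    tail≢end : ∀ {m} (v : TVne m) → liftne v ≢ TV.x zero
    tail≢end TVne.w′ ()
    tail≢end TVne.y′ ()
    tail≢end TVne.z′ ()
    tail≢end (TVne.xs _) ()

    liftne-injective : ∀ {m} (u v : TVne m) → liftne u ≡ liftne v → u ≡ v
    liftne-injective TVne.w′ TVne.w′ _ = refl
    liftne-injective TVne.y′ TVne.y′ _ = refl
    liftne-injective TVne.z′ TVne.z′ _ = refl
    liftne-injective (TVne.xs _) (TVne.xs _) refl = refl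

    cross : ∀ u v → R₁.f u ≢ R₂.f (liftne v) × edge (R₁.f u) (R₂.f (liftne v)) ≡ sumE R₁.T R₂.T (SumV.l u) (SumV.r v)
    cross (TV.x zero) v = (λ eq → R₂.off-root _ (tail≢end v) (trans (sym eq) R₁.root))
      , trans (cong (λ o → edge o _) (trans R₁.root (sym R₂.root))) (R₂.f-emb _ _)
    cross u@TV.w v = let ne , ¬e = apart (R₁.inside u λ ()) (R₂.inside _ (tail≢end v)) in ne , nonadjacent ¬e
    cross u@TV.y v = let ne , ¬e = apart (R₁.inside u λ ()) (R₂.inside _ (tail≢end v)) in ne , nonadjacent ¬e
    cross u@TV.z v = let ne , ¬e = apart (R₁.inside u λ ()) (R₂.inside _ (tail≢end v)) in ne , nonadjacent ¬e
    cross u@(TV.x (suc _)) v = let ne , ¬e = apart (R₁.inside u λ ()) (R₂.inside _ (tail≢end v)) in ne , nonadjacent ¬e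

    sum-sym : ∀ u v → sumE R₁.T R₂.T (SumV.l u) (SumV.r v) ≡ sumE R₁.T R₂.T (SumV.r v) (SumV.l u)
    sum-sym u v with isEnd u
    ... | true  = Tad.H-sym R₂.T (TV.x zero) (liftne v)
    ... | false = refl

    inj : Injective _≡_ _≡_ g
    inj {SumV.l u} {SumV.l v} eq = cong SumV.l (R₁.f-inj eq)
    inj {SumV.l u} {SumV.r v} eq = contradiction eq (proj₁ (cross u v))
    inj {SumV.r u} {SumV.l v} eq = contradiction (sym eq) (proj₁ (cross v u))
    inj {SumV.r u} {SumV.r v} eq = cong SumV.r (liftne-injective u v (R₂.f-inj eq))

    emb : ∀ u v → edge (g u) (g v) ≡ sumE R₁.T R₂.T u v
    emb (SumV.l u) (SumV.l v) = R₁.f-emb u v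
    emb (SumV.l u) (SumV.r v) = proj₂ (cross u v)
    emb (SumV.r u) (SumV.l v) = trans (edge-sym _ _) (trans (proj₂ (cross v u)) (sum-sym v u))
    emb (SumV.r u) (SumV.r v) = R₂.f-emb (liftne u) (liftne v)

  -- t is positively adjacent to all vertices of ρ in the opposite part, up to the
  -- exception made for W₁ in the definition of joins.
  Universal : {A : Fin n → Set} → Fin n → Rooted s A → Set
  Universal t ρ = ∀ u → Opp t (f u) → Pos t (f u) ⊎ (isW1 T ≡ true × isW u ≡ true × t ~ f u)
    where open Rooted ρ

  -- Choosing `opp` from the actual sides of the ends makes `colour` account for all nonedges inside
  -- a part, and `Universal` for all edges at the two ends.
  no-join : {A B : Fin n → Set} (ρ₁ : Rooted s A) (ρ₂ : Rooted t B) →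
            s ≢ t → (∀ {i} → A i → i ≢ t) → (∀ {j} → B j → j ≢ s) → (∀ {i j} → A i → B j → Apart i j) →
            Universal t ρ₁ → Universal s ρ₂ →
            (isW1 (Rooted.T ρ₁) ≡ true ⊎ isW1 (Rooted.T ρ₂) ≡ true → Opp s t) → ⊥
  no-join {s} {t} {A} {B} ρ₁ ρ₂ s≢t A≢t B≢s apart univ₁ univ₂ w1-opp = free (hasJ J (g , inj , emb))
    where
    module R₁ = Rooted ρ₁
    module R₂ = Rooted ρ₂

    opp-xor : Opp s t → side s xor side t ≡ true
    opp-xor o with side s | side t
    ... | true  | true  = contradiction refl o
    ... | true  | false = refl
    ... | false | true  = refl
    ... | false | false = contradiction refl o

    J : JoinData
    J = record { T = R₁.T ; T′ = R₂.T ; opp = side s xor side t ; oppW1 = opp-xor ∘ w1-opp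
               ; s₁ = sgn (edge s (R₂.f TV.w)) ; s₂ = sgn (edge t (R₁.f TV.w)) }

    g : JoinV J → Fin n
    g (JoinV.jl u) = R₁.f u
    g (JoinV.jr v) = R₂.f v

    side-xor : ∀ a b c → (c xor (a xor b)) ≡ true → a ≢ c xor b
    side-xor true  true  true  _ ()
    side-xor true  false false _ ()
    side-xor false true  false _ ()
    side-xor false false true  _ ()

    side-xor′ : ∀ a b c → (c xor (a xor b)) ≡ true → b ≢ c xor a
    side-xor′ true  true  true  _ ()
    side-xor′ true  false false _ ()
    side-xor′ false true  false _ ()
    side-xor′ false false true  _ ()

    side-eq : ∀ a b c → (c xor (a xor b)) ≡ false → a ≡ c xor b
    side-eq true  true  false _ = refl
    side-eq true  false true  _ = refl
    side-eq false true  true  _ = refl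
    side-eq false false false _ = refl

    side-eq′ : ∀ a b c → (c xor (a xor b)) ≡ false → b ≡ c xor a
    side-eq′ true  true  false _ = refl
    side-eq′ true  false true  _ = refl
    side-eq′ false true  true  _ = refl
    side-eq′ false false false _ = refl

    from-s : ∀ v → edge s (R₂.f v) ≡ (if sideR J v then just (if isW1 R₂.T ∧ isW v then JoinData.s₁ J else pos) else nothing)
    from-s v with sideR J v in eq
    ... | false = nonadjacent (same-≁ (trans (side-eq (side s) (side t) (col v) eq) (sym (R₂.colour v))))
    ... | true with univ₂ v (λ e → side-xor (side s) (side t) (col v) eq (trans e (R₂.colour v)))
    ...   | inj₂ (w1 , isw , adj) rewrite w1 with v | isw
    ...     | TV.w | refl = proj₂ (adj-entry adj)
    from-s v | true | inj₁ ps with isW1 R₂.T | v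
    ... | false | _ = ps
    ... | true | TV.w rewrite ps = refl
    ... | true | TV.y = ps
    ... | true | TV.z = ps
    ... | true | TV.x _ = ps

    from-t : ∀ u → edge t (R₁.f u) ≡ (if (sideL J u xor (side s xor side t)) then just (if isW1 R₁.T ∧ isW u then JoinData.s₂ J else pos) else nothing)
    from-t u with sideL J u xor (side s xor side t) in eq
    ... | false = nonadjacent (same-≁ (trans (side-eq′ (side s) (side t) (col u) eq) (sym (R₁.colour u))))
    ... | true with univ₁ u (λ e → side-xor′ (side s) (side t) (col u) eq (trans e (R₁.colour u)))
    ...   | inj₂ (w1 , isw , adj) rewrite w1 with u | isw
    ...     | TV.w | refl = proj₂ (adj-entry adj)
    from-t u | true | inj₁ ps with isW1 R₁.T | u
    ... | false | _ = ps
    ... | true | TV.w rewrite ps = refl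
    ... | true | TV.y = ps
    ... | true | TV.z = ps
    ... | true | TV.x _ = ps

    cross-s : ∀ v → joinCross J (TV.x zero) v ≡ (if sideR J v then just (if isW1 R₂.T ∧ isW v then JoinData.s₁ J else pos) else nothing)
    cross-s TV.w rewrite Bool.∨-identityʳ (sideR J TV.w) | Bool.∧-zeroʳ (isW1 R₁.T) = refl
    cross-s TV.y rewrite Bool.∨-identityʳ (sideR J TV.y) | Bool.∧-zeroʳ (isW1 R₁.T) = refl
    cross-s TV.z rewrite Bool.∨-identityʳ (sideR J TV.z) | Bool.∧-zeroʳ (isW1 R₁.T) = refl
    cross-s (TV.x (suc i)) rewrite Bool.∨-identityʳ (sideR J (TV.x (suc i))) | Bool.∧-zeroʳ (isW1 R₁.T) = refl
    cross-s (TV.x zero) rewrite Bool.∨-idem (side s xor side t) | Bool.∧-zeroʳ (isW1 R₁.T) = refl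

    cross-t : ∀ u → u ≢ TV.x zero → joinCross J u (TV.x zero) ≡ (if (sideL J u xor (side s xor side t)) then just (if isW1 R₁.T ∧ isW u then JoinData.s₂ J else pos) else nothing)
    cross-t TV.w _ rewrite Bool.∧-zeroʳ (isW1 R₂.T) = refl
    cross-t TV.y _ rewrite Bool.∧-zeroʳ (isW1 R₂.T) = refl
    cross-t TV.z _ rewrite Bool.∧-zeroʳ (isW1 R₂.T) = refl
    cross-t (TV.x (suc i)) _ rewrite Bool.∧-zeroʳ (isW1 R₂.T) = refl
    cross-t (TV.x zero) ne = contradiction refl ne

    cross : ∀ u v → R₁.f u ≢ R₂.f v × edge (R₁.f u) (R₂.f v) ≡ joinCross J u v
    cross u v with Tad.end? R₁.T u | Tad.end? R₂.T v
    ... | no u≢e | no v≢e rewrite not-end u u≢e | not-end v v≢e =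
      let ne , ¬e = apart (R₁.inside u u≢e) (R₂.inside v v≢e) in ne , nonadjacent ¬e
    ... | no u≢e | yes refl = (λ eq → A≢t (R₁.inside u u≢e) (trans eq R₂.root))
      , trans (edge-sym _ _) (trans (cong (λ o → edge o (R₁.f u)) R₂.root) (trans (from-t u) (sym (cross-t u u≢e))))
    ... | yes refl | _ = distinct , trans (cong (λ o → edge o (R₂.f v)) R₁.root) (trans (from-s v) (sym (cross-s v)))
      where
      distinct : R₁.f (TV.x zero) ≢ R₂.f v
      distinct eq with Tad.end? R₂.T v
      ... | yes refl = s≢t (trans (sym R₁.root) (trans eq R₂.root))
      ... | no v≢e   = B≢s (R₂.inside v v≢e) (trans (sym eq) R₁.root)

    inj : Injective _≡_ _≡_ g
    inj {JoinV.jl u} {JoinV.jl v} eq = cong JoinV.jl (R₁.f-inj eq)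
    inj {JoinV.jl u} {JoinV.jr v} eq = contradiction eq (proj₁ (cross u v))
    inj {JoinV.jr u} {JoinV.jl v} eq = contradiction (sym eq) (proj₁ (cross v u))
    inj {JoinV.jr u} {JoinV.jr v} eq = cong JoinV.jr (R₂.f-inj eq)

    emb : ∀ u v → edge (g u) (g v) ≡ joinE J u v
    emb (JoinV.jl u) (JoinV.jl v) = R₁.f-emb u v
    emb (JoinV.jl u) (JoinV.jr v) = proj₂ (cross u v)
    emb (JoinV.jr u) (JoinV.jl v) = trans (edge-sym _ _) (proj₂ (cross v u))
    emb (JoinV.jr u) (JoinV.jr v) = R₂.f-emb u v

module _ {n : ℕ} {P : Fin n → Set} (P? : ∀ i → Dec (P i)) where

  ⟪_⟫ : Subset n
  ⟪_⟫ = tabulate (λ i → ⌊ P? i ⌋)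

  ∈⟪⟫ : ∀ {i} → P i → i Sub.∈ ⟪_⟫
  ∈⟪⟫ {i} pi = lookup⇒[]= i _ (trans (lookup∘tabulate _ i) eq)
    where
    eq : ⌊ P? i ⌋ ≡ true
    eq with P? i
    ... | yes _  = refl
    ... | no ¬pi = contradiction pi ¬pi

  ∈⟪⟫⁻ : ∀ {i} → i Sub.∈ ⟪_⟫ → P i
  ∈⟪⟫⁻ {i} i∈ with P? i | trans (sym (lookup∘tabulate (λ j → ⌊ P? j ⌋) i)) ([]=⇒lookup i∈)
  ... | yes pi | _ = pi

-- Leaves in chain graphs

module Leaves {n : ℕ} (G : SignedBigraph n) (free : FFree G) where

  open Bigraph G
  open Free free
  open Rootings G free

  private variable
    i j p q r s t u v : Fin n

  -- The coincidences between the pairs `p q` and `r s` decide: two of them give F₁, one gives F₂,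
  -- none gives F₃.
  two-lines : i ≢ j → p ≢ q → r ≢ s → Neg i p → Neg i q → Neg j r → Neg j s →
              i ~ r → i ~ s → j ~ p → j ~ q → ⊥
  two-lines {i} {j} {p} {q} {r} {s} i≢j p≢q r≢s ip iq jr js ir is jp jq with p ≟ r | p ≟ s | q ≟ r | q ≟ s
  ... | yes refl | _        | _        | yes refl = noF1 i≢j p≢q ip iq jr js
  ... | _        | yes refl | yes refl | _        = noF1 i≢j p≢q ip iq js jr
  ... | yes refl | _        | _        | no q≢s   = noF2 i≢j (p≢q ∘ sym) q≢s r≢s iq ip jr js jq is
  ... | no _     | yes refl | no q≢r   | _        = noF2 i≢j (p≢q ∘ sym) q≢r (r≢s ∘ sym) iq ip js jr jq ir
  ... | no p≢r   | no p≢s   | yes refl | _        = noF2 i≢j p≢q p≢s r≢s ip iq jr js jp is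
  ... | no p≢r   | no p≢s   | no _     | yes refl = noF2 i≢j p≢q p≢r (r≢s ∘ sym) ip iq js jr jp ir
  ... | no p≢r   | no p≢s   | no q≢r   | no q≢s   = noF3 i≢j p≢q p≢r p≢s q≢r q≢s r≢s ip iq jr js jp jq ir is

  Bd : (Fin n → Set) → Fin n → Set
  Bd C s = ¬ C s × ∃ λ c → C c × c ~ s

  -- `Nested` is the chain graph condition, in the form that two disjoint edges are never induced.
  Complete Biclique Nested Covered : (Fin n → Set) → Set
  Complete C = ∀ {s c} → Bd C s → C c → Opp s c → s ~ c
  Biclique C = ∀ {s t} → Bd C s → Bd C t → Opp s t → Pos s t
  Nested C = ∀ {g h i j} → C g → C h → C i → C j → g ~ h → i ~ j → Same g i → g ~ j ⊎ i ~ h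
  Covered C = ∀ {c} → C c → ∃ λ d → C d × c ~ d

  -- Supplies the vertex of F₅ outside `C` that has no edge to the column inside `C`.
  Outer : (Fin n → Set) → Set
  Outer C = ∀ {s t} → Bd C s → Bd C t → Same s t → ∃ λ v → v ~ s × v ~ t × (∀ {c} → C c → ¬ v ~ c)

  NoSimplicial : Set
  NoSimplicial = ∀ {u v} → u ~ v → ∃₂ λ g h → g ≢ u × h ≢ v × v ~ g × u ~ h × ¬ Pos g h

  module Leaf (C : Fin n → Set) (C? : ∀ i → Dec (C i)) (complete : Complete C) (biclique : Biclique C)
    (nested : Nested C) (covered : Covered C) (outer : Outer C) (no-simp : NoSimplicial)
    (no-leaf : ∀ {s} → Bd C s → LeafAt C s → ⊥) where

    R : Fin n → Set
    R i = C i ⊎ Bd C i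

    closed : C u → u ~ v → R v
    closed {u} {v} cu uv with C? v
    ... | yes cv = inj₁ cv
    ... | no ¬cv = inj₂ (¬cv , u , cu , uv)

    _⊑_ : Fin n → Fin n → Set
    i ⊑ j = ∀ {r} → C r → r ~ i → r ~ j

    -- The edges i v that are simplicial in the unsigned graph on R, for i of minimal
    -- neighbourhood among the neighbours of v.
    record Own (i v : Fin n) : Set where
      constructor own
      field
        in-C : C v
        adj  : i ~ v
        min  : ∀ {j} → C j → j ~ v → i ⊑ j

      min-R : ∀ {j} → R j → j ~ v → i ⊑ j
      min-R (inj₁ cj) jv = min cj jv
      min-R (inj₂ bj) jv cr ri = ~-sym (complete bj cr (opp-sym (opp-sym (same-opp (common jv adj) (~-opp (~-sym ri))))))

    NotOwn : Fin n → Fin n → Set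
    NotOwn i v = ∃₂ λ j r → C j × j ~ v × C r × r ~ i × ¬ r ~ j

    own? : ∀ i v → C v → i ~ v → Own i v ⊎ NotOwn i v
    own? i v cv iv with Fin.any? (λ j → Fin.any? (λ r → C? j ×-dec (j ~? v) ×-dec C? r ×-dec (r ~? i) ×-dec ¬? (r ~? j)))
    ... | yes no-own = inj₂ no-own
    ... | no ¬no-own = inj₁ (own cv iv λ {j} cj jv {r} cr ri →
      decidable-stable (r ~? j) λ ¬rj → ¬no-own (j , r , cj , jv , cr , ri , ¬rj))

    N : Fin n → Subset n
    N v = ⟪ (λ i → C? i ×-dec (i ~? v)) ⟫

    -- Among the neighbours of `i` one with inclusion-minimal `N` works: if `j` and `r` show that
    -- `i v` is not own, then by `Nested` the set `N r` is contained in `N v`, and `j` is missing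
    -- from it.
    own-exists : ∀ {i} → C i → (∀ {v} → Own i v → ⊥) → ⊥
    own-exists {i} ci k with covered ci
    ... | v₀ , cv₀ , iv₀ = go v₀ cv₀ iv₀ (⊂-wellFounded (N v₀))
      where
      go : ∀ v → C v → i ~ v → Acc Sub._⊂_ (N v) → ⊥
      go v cv iv (acc rec) with own? i v cv iv
      ... | inj₁ ow = k ow
      ... | inj₂ (j , r , cj , jv , cr , ri , ¬rj) = go r cr (~-sym ri) (rec (sub , j , ∈⟪⟫ _ (cj , jv) , λ j∈ → ¬rj (~-sym (proj₂ (∈⟪⟫⁻ _ j∈)))))
        where
        sub : N r Sub.⊆ N v
        sub {h} h∈ = let ch , hr = ∈⟪⟫⁻ _ h∈ in ∈⟪⟫ _ (ch ,
          [ id , (λ jr → contradiction (~-sym jr) ¬rj) ]′ (nested ch cr cj cv hr jv (trans (common hr (~-sym ri)) (common iv jv))))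

    Minimal : Fin n → Set
    Minimal i = C i × (∀ {j} → C j → Same i j → i ⊑ j)

    minimal-exists : ∀ {i} → C i → (∀ {i} → Minimal i → ⊥) → ⊥
    minimal-exists {i₀} ci₀ k = go i₀ ci₀ (⊂-wellFounded (N i₀))
      where
      go : ∀ i → C i → Acc Sub._⊂_ (N i) → ⊥
      go i ci (acc rec) with Fin.any? (λ j → Fin.any? (λ r → C? j ×-dec (side i Bool.≟ side j) ×-dec C? r ×-dec (r ~? i) ×-dec ¬? (r ~? j)))
      ... | no none = k (ci , λ {j} cj ij {r} cr ri →
              decidable-stable (r ~? j) λ ¬rj → none (j , r , cj , ij , cr , ri , ¬rj))
      ... | yes (j , r , cj , ij , cr , ri , ¬rj) = go j cj (rec (sub , r , ∈⟪⟫ _ (cr , ri) , λ r∈ → ¬rj (proj₂ (∈⟪⟫⁻ _ r∈))))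
        where
        sub : N j Sub.⊆ N i
        sub {h} h∈ = let ch , hj = ∈⟪⟫⁻ _ h∈ in ∈⟪⟫ _ (ch ,
          [ (λ jr → contradiction (~-sym jr) ¬rj) , ~-sym ]′ (nested cj ch ci cr (~-sym hj) (~-sym ri) (sym ij)))

    -- Both blocking vertices lie in `R`, where an own edge makes them adjacent. What blocks is
    -- therefore a negative edge and not a missing one.
    blocking : ∀ {i v} → C i → Own i v → ∃₂ λ j h → j ≢ i × h ≢ v × R j × R h × i ⊑ j × h ~ i × Neg j h
    blocking {i} {v} ci ow with no-simp (Own.adj ow)
    ... | j , h , j≢i , h≢v , vj , ih , ¬pos = j , h , j≢i , h≢v , Rj , Rh , sup , ~-sym ih , not-pos⇒neg (adj Rj Rh) ¬pos
      where
      open Own ow using (in-C; min-R) renaming (adj to iv)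
      Rj = closed in-C vj
      Rh = closed ci ih
      sup : i ⊑ j
      sup = min-R Rj (~-sym vj)
      jh : Opp j h
      jh = same-opp (common (~-sym vj) iv) (~-opp ih)
      adj : R j → R h → j ~ h
      adj _         (inj₁ ch) = ~-sym (sup ch (~-sym ih))
      adj (inj₁ cj) (inj₂ bh) = ~-sym (complete bh cj (opp-sym jh))
      adj (inj₂ bj) (inj₂ bh) = pos~ (biclique bj bh jh)

    R-same : ∀ {i j} → C i → i ⊑ j → Same i j
    R-same ci sup = let d , cd , id′ = covered ci in common id′ (~-sym (sup cd (~-sym id′)))

    -- The edges i v, v own, cannot be blocked by a negative edge at b; and two negative
    -- edges from different vertices to own vertices would give F₄ together with i b.
    module Twice {i b : Fin n} (ci : C i) (ib : Neg i b)
      (univ : ∀ {h} → R h → Opp b h → h ~ b)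
      (not-b : ∀ {j} → j ≢ i → R j → i ⊑ j → Neg j b → ⊥)
      (not-Bd : ∀ {j h} → j ≢ i → i ⊑ j → R j → Bd C h → h ≢ b → Neg j h → ⊥) where

      record Once (v : Fin n) : Set where
        constructor once
        field
          {g h} : Fin n
          j≢i : g ≢ i
          h≢v : h ≢ v
          h≢b : h ≢ b
          Rj  : R g
          sup : i ⊑ g
          ih  : Own i h
          jh  : Neg g h

      jb : ∀ {j} → R j → i ⊑ j → j ~ b
      jb Rj sup = univ Rj (opp-sym (same-opp (sym (R-same ci sup)) (~-opp (neg~ ib))))

      one : ∀ {v} → Own i v → Once v
      one ow with blocking ci ow
      ... | j , h , j≢i , h≢v , Rj , Rh , sup , hi , jh with h ≟ b
      ...   | yes refl = ⊥-elim (not-b j≢i Rj sup jh)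
      ...   | no h≢b with Rh
      ...     | inj₂ bh = ⊥-elim (not-Bd j≢i sup Rj bh h≢b jh)
      ...     | inj₁ ch with own? i h ch (~-sym hi)
      ...       | inj₁ ih = once j≢i h≢v h≢b Rj sup ih jh
      -- If `i h` is not own, the missing edge `r g` together with the negative edges `i b` and
      -- `j h` gives F₅.
      ...       | inj₂ (g , r , cg , gh , cr , ri , ¬rg) = ⊥-elim (noF5 (j≢i ∘ sym) (h≢b ∘ sym) ib jh
                    (univ (inj₁ cg) (opp-sym (same-opp (common gh (~-sym hi)) (~-opp (neg~ ib)))))
                    gh (~-sym hi) (~-sym ri) (jb Rj sup) (~-sym (sup cr ri)) (¬rg ∘ ~-sym))

      record Result : Set where
        constructor result
        field
          {g h₁ h₂} : Fin n
          j≢i : g ≢ i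
          Rj  : R g
          sup : i ⊑ g
          h₁≢h₂ : h₁ ≢ h₂
          h₁≢b : h₁ ≢ b
          h₂≢b : h₂ ≢ b
          ih₁ : Own i h₁
          ih₂ : Own i h₂
          jh₁ : Neg g h₁
          jh₂ : Neg g h₂

      twice : (Result → ⊥) → ⊥
      twice k = own-exists ci λ ow → go (one ow)
        where
        go : ∀ {v} → Once v → ⊥
        go (once {j} {h} j≢i _ h≢b Rj sup ih jh) with one ih
        -- Since `i h` is own as well, it is blocked in turn, and this gives a second own vertex
        -- `h′` different from `h`.
        ... | once {j′} {h′} j′≢i h′≢h h′≢b Rj′ sup′ ih′ jh′ with j ≟ j′
        ...   | yes refl = k (result j≢i Rj sup (h′≢h ∘ sym) h≢b h′≢b ih ih′ jh jh′)
        ...   | no j≢j′ = noF4 (j≢i ∘ sym) (j′≢i ∘ sym) j≢j′ (h≢b ∘ sym) (h′≢b ∘ sym) (h′≢h ∘ sym)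
                  ib jh jh′ (Own.adj ih) (Own.adj ih′) (jb Rj sup) (~-sym (sup (Own.in-C ih′) (~-sym (Own.adj ih′))))
                  (jb Rj′ sup′) (~-sym (sup′ (Own.in-C ih) (~-sym (Own.adj ih))))

    -- Applies `Twice` to `i b`. The vertex `j` with two negative edges that it returns gives a leaf
    -- of type 2 at `b` if it lies in `C`, and a W₁ with end `j` if it lies on the boundary.
    Bd-C-positive : ∀ {i b} → C i → Bd C b → Neg i b → ⊥
    Bd-C-positive {i} {b} ci bb ib = twice finish
      where
      univ : ∀ {h} → R h → Opp b h → h ~ b
      univ (inj₁ ch) o = ~-sym (complete bb ch o)
      univ (inj₂ bh) o = ~-sym (pos~ (biclique bb bh o))

      not-b : ∀ {j} → j ≢ i → R j → i ⊑ j → Neg j b → ⊥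
      not-b j≢i (inj₂ bj) _ jb = neg-not-pos jb (biclique bj bb (~-opp (neg~ jb)))
      not-b j≢i (inj₁ cj) sup jb = let d , cd , id′ = covered ci in
        no-leaf bb (leafA (j≢i ∘ sym) (neg-sym ib) (neg-sym jb) (~-sym id′) (sup cd (~-sym id′))
          (λ { refl → proj₁ bb cd }) ci cj cd)

      not-Bd : ∀ {j h} → j ≢ i → i ⊑ j → R j → Bd C h → h ≢ b → Neg j h → ⊥
      not-Bd j≢i sup (inj₂ bj) bh _ jh = neg-not-pos jh (biclique bj bh (~-opp (neg~ jh)))
      not-Bd {j} {h} j≢i sup (inj₁ cj) bh h≢b jh =
        let d , cd , id′ = covered ci
            i≈j = R-same ci sup
            b≈h = opp-opp (opp-sym (~-opp (neg~ ib))) (same-opp i≈j (~-opp (neg~ jh)))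
            o , ob , oh , far = outer bb bh b≈h
        in noF5 (j≢i ∘ sym) (h≢b ∘ sym) ib jh ob oh
             (~-sym (complete bh ci (opp-sym (same-opp i≈j (~-opp (neg~ jh))))))
             id′ (~-sym (complete bb cj (opp-sym (same-opp (sym i≈j) (~-opp (neg~ ib))))))
             (~-sym (sup cd (~-sym id′))) (far cd)

      open Twice ci ib univ not-b not-Bd

      finish : Result → ⊥
      finish (result j≢i (inj₁ cj) sup h₁≢h₂ h₁≢b h₂≢b ih₁ ih₂ jh₁ jh₂) =
        no-leaf bb (leafB h₁≢h₂ jh₁ jh₂ ib (jb (inj₁ cj) sup) (Own.adj ih₁) (Own.adj ih₂) j≢i h₁≢b h₂≢b
          (Own.in-C ih₁) (Own.in-C ih₂) cj ci)
      finish (result j≢i (inj₂ bj) sup h₁≢h₂ h₁≢b h₂≢b ih₁ ih₂ jh₁ jh₂) =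
        no-leaf bj (leafA h₁≢h₂ jh₁ jh₂ (Own.adj ih₁) (Own.adj ih₂) (j≢i ∘ sym) (Own.in-C ih₁) (Own.in-C ih₂) ci)

    module FromMinimal (x₀ : Fin n) (cx₀ : C x₀) (min : ∀ {j} → C j → Same x₀ j → x₀ ⊑ j) where

      N₀ : Fin n → Set
      N₀ v = C v × v ~ x₀

      univ : ∀ {v h} → N₀ v → R h → Opp v h → h ~ v
      univ (cv , vx₀) (inj₁ ch) o = ~-sym (min ch (opp-opp (~-opp (~-sym vx₀)) o) cv vx₀)
      univ (cv , vx₀) (inj₂ bh) o = complete bh cv (opp-sym o)

      -- By the minimality of x₀, the vertices of X₁ have the same neighbours in C as x₀.
      X₁ Big : Fin n → Set
      X₁ u = C u × u ⊑ x₀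
      Big u = C u × ∃ λ r → C r × r ~ u × ¬ r ~ x₀

      big-or-X₁ : ∀ {u} → C u → Big u ⊎ X₁ u
      big-or-X₁ {u} cu with Fin.any? (λ r → C? r ×-dec (r ~? u) ×-dec ¬? (r ~? x₀))
      ... | yes big = inj₁ (cu , big)
      ... | no ¬big = inj₂ (cu , λ {r} cr ru → decidable-stable (r ~? x₀) λ ¬rx₀ → ¬big (r , cr , ru , ¬rx₀))

      big≢X₁ : ∀ {i j} → Big i → X₁ j → i ≢ j
      big≢X₁ (_ , r , cr , ri , ¬rx₀) (_ , sub) refl = ¬rx₀ (sub cr ri)

      X₁-N₀ : ∀ {u v} → X₁ u → N₀ v → u ~ v
      X₁-N₀ (cu , sub) N₀v = let r , cr , ur = covered cu in
        univ N₀v (inj₁ cu) (same-opp (common (proj₂ N₀v) (sub cr (~-sym ur))) (opp-sym (~-opp ur)))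

      record Block (u v : Fin n) : Set where
        constructor block
        field
          {g h} : Fin n
          g≢u : g ≢ u
          h≢v : h ≢ v
          cg  : C g
          N₀h : N₀ h
          gh  : Neg g h

      -- The edge `u v` is simplicial in the unsigned graph. Boundary vertices cannot help to block
      -- it, as all their edges to `C` and to each other are positive.
      blocked : ∀ {u v} → X₁ u → N₀ v → Block u v
      blocked {u} {v} (cu , sub) N₀v@(cv , _) with no-simp (X₁-N₀ (cu , sub) N₀v)
      ... | g , h , g≢u , h≢v , vg , uh , ¬pos = go (closed cv vg) (closed cu uh)
        where
        gh : Opp g h
        gh = same-opp (common (~-sym vg) (X₁-N₀ (cu , sub) N₀v)) (~-opp uh)
        go : R g → R h → Block u v
        go (inj₁ cg) (inj₁ ch) = block g≢u h≢v cg (ch , sub ch (~-sym uh))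
          (not-pos⇒neg (univ (ch , sub ch (~-sym uh)) (inj₁ cg) (opp-sym gh)) ¬pos)
        go (inj₁ cg) (inj₂ bh) = ⊥-elim (Bd-C-positive cg bh (not-pos⇒neg (~-sym (complete bh cg (opp-sym gh))) ¬pos))
        go (inj₂ bg) (inj₁ ch) = ⊥-elim (Bd-C-positive ch bg (neg-sym (not-pos⇒neg (complete bg ch gh) ¬pos)))
        go (inj₂ bg) (inj₂ bh) = contradiction (biclique bg bh gh) ¬pos

      x₀∈X₁ : X₁ x₀
      x₀∈X₁ = cx₀ , λ _ rx₀ → rx₀

      C-N₀ : ∀ {u v v′} → C u → N₀ v → N₀ v′ → u ~ v → u ~ v′
      C-N₀ cu (_ , vx₀) N₀v′ uv = univ N₀v′ (inj₁ cu) (same-opp (common (proj₂ N₀v′) vx₀) (~-opp (~-sym uv)))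

      not-Bd : ∀ {i j h b} → j ≢ i → i ⊑ j → R j → Bd C h → h ≢ b → Neg j h → ⊥
      not-Bd _ _ (inj₁ cj) bh _ jh = Bd-C-positive cj bh jh
      not-Bd _ _ (inj₂ bj) bh _ jh = neg-not-pos jh (biclique bj bh (~-opp (neg~ jh)))

      -- By `Own.min`, a neighbour `u` of `h` would inherit from `i` a neighbour that `x₀` does not
      -- have, against `u ⊑ x₀`.
      own-big : ∀ {i h u} → Big i → Own i h → X₁ u → ¬ u ~ h
      own-big (_ , r , cr , ri , ¬rx₀) ih (cu , sub) uh = ¬rx₀ (sub cr (Own.min ih cu uh cr ri))

      -- `twice` yields a second vertex with two negative edges, which go outside `N₀` by `own-big`.
      -- This is F₃ on the rows `i` and `j`.
      big-two : ∀ {i v v′} → Big i → N₀ v → N₀ v′ → v ≢ v′ → Neg i v → Neg i v′ → ⊥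
      big-two {i} {v} {v′} big@(ci , r , cr , ri , ¬rx₀) Nv Nv′ v≢v′ iv iv′ = twice finish
        where
        R-N₀ : ∀ {j w} → R j → i ⊑ j → N₀ w → j ~ w
        R-N₀ Rj sup Nw@(_ , wx₀) = univ Nw Rj (opp-sym (same-opp (sym (R-same ci sup)) (~-opp (C-N₀ ci Nv Nw (neg~ iv)))))

        not-b : ∀ {j} → j ≢ i → R j → i ⊑ j → Neg j v → ⊥
        not-b j≢i Rj sup jv = noF5 (j≢i ∘ sym) (v≢v′ ∘ sym) iv′ jv (~-sym (proj₂ Nv′)) (~-sym (proj₂ Nv))
          (neg~ iv) (~-sym ri) (R-N₀ Rj sup Nv′) (~-sym (sup cr ri)) (¬rx₀ ∘ ~-sym)

        open Twice ci iv (univ Nv) not-b not-Bd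

        finish : Result → ⊥
        finish (result j≢i Rj sup h₁≢h₂ h₁≢b h₂≢b ih₁ ih₂ jh₁ jh₂) =
          noF3 (j≢i ∘ sym) v≢v′ (h₁≢b ∘ sym) (h₂≢b ∘ sym)
            (λ { refl → own-big big ih₁ x₀∈X₁ (~-sym (proj₂ Nv′)) }) (λ { refl → own-big big ih₂ x₀∈X₁ (~-sym (proj₂ Nv′)) })
            h₁≢h₂ iv iv′ jh₁ jh₂ (R-N₀ Rj sup Nv) (R-N₀ Rj sup Nv′) (Own.adj ih₁) (Own.adj ih₂)

      -- The vertices `u` and `u′` at `v′` and the two own vertices at `j` are the two ends of an
      -- F₆, with the negative edge `i v` between them.
      big-column : ∀ {i v v′ u u′} → Big i → N₀ v → N₀ v′ → v ≢ v′ → X₁ u → X₁ u′ → u ≢ u′ →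
                   Neg i v → Neg u v′ → Neg u′ v′ → ⊥
      big-column {i} {v} {v′} {u} {u′} big@(ci , r , cr , ri , ¬rx₀) Nv Nv′ v≢v′ Xu Xu′ u≢u′ iv uv′ u′v′ = twice finish
        where
        R-N₀ : ∀ {j w} → R j → i ⊑ j → N₀ w → j ~ w
        R-N₀ Rj sup Nw@(_ , wx₀) = univ Nw Rj (opp-sym (same-opp (sym (R-same ci sup)) (~-opp (C-N₀ ci Nv Nw (neg~ iv)))))

        not-b : ∀ {j} → j ≢ i → R j → i ⊑ j → Neg j v → ⊥
        not-b j≢i Rj sup jv = two-lines v≢v′ (j≢i ∘ sym) u≢u′ (neg-sym iv) (neg-sym jv) (neg-sym uv′) (neg-sym u′v′)
          (~-sym (X₁-N₀ Xu Nv)) (~-sym (X₁-N₀ Xu′ Nv)) (~-sym (C-N₀ ci Nv Nv′ (neg~ iv))) (~-sym (R-N₀ Rj sup Nv′))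

        open Twice ci iv (univ Nv) not-b not-Bd

        finish : Result → ⊥
        finish (result j≢i Rj sup h₁≢h₂ h₁≢b h₂≢b ih₁ ih₂ jh₁ jh₂) =
          noF6 u≢u′ (j≢i ∘ sym) (v≢v′ ∘ sym) h₁≢h₂ uv′ u′v′ iv jh₁ jh₂ (X₁-N₀ Xu Nv) (X₁-N₀ Xu′ Nv)
            (C-N₀ ci Nv Nv′ (neg~ iv)) (R-N₀ Rj sup Nv′) (R-N₀ Rj sup Nv) (Own.adj ih₁) (Own.adj ih₂)
            (own-big big ih₁ Xu) (own-big big ih₂ Xu) (own-big big ih₁ Xu′) (own-big big ih₂ Xu′)

      -- Nested neighbourhoods give `i` and `j` a common neighbour that `x₀` does not have, and with
      -- `x₀` this is F₅.
      big-matching : ∀ {i j v v′} → Big i → Big j → i ≢ j → N₀ v → N₀ v′ → v ≢ v′ → Neg i v → Neg j v′ → ⊥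
      big-matching {i} {j} (ci , r , cr , ri , ¬rx₀) (cj , r′ , cr′ , r′j , ¬r′x₀) i≢j Nv Nv′ v≢v′ iv jv′ =
        [ (λ ir′ → clash (~-sym ir′) r′j ¬r′x₀) , (λ jr → clash ri (~-sym jr) ¬rx₀) ]′
          (nested ci cr cj cr′ (~-sym ri) (~-sym r′j) (common (neg~ iv) (C-N₀ cj Nv′ Nv (neg~ jv′))))
        where
        clash : ∀ {r} → r ~ i → r ~ j → ¬ r ~ x₀ → ⊥
        clash ri rj ¬rx₀ = noF5 i≢j v≢v′ iv jv′ (~-sym (proj₂ Nv)) (~-sym (proj₂ Nv′))
          (C-N₀ ci Nv Nv′ (neg~ iv)) (~-sym ri) (C-N₀ cj Nv′ Nv (neg~ jv′)) (~-sym rj) (¬rx₀ ∘ ~-sym)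

      -- Blocking first `x₀ v` and then an edge at `v` keeps producing negative edges away from `v`.
      -- A big endpoint leads to `big-two` or `big-matching`; two negative edges at `X₁` either
      -- share a column, for `big-column`, or form a matching with `i v`, which is F₄.
      big-positive : ∀ {i v} → Big i → N₀ v → Neg i v → ⊥
      big-positive {i} {v} big Nv iv = first (blocked x₀∈X₁ Nv)
        where
        no-other-big : ∀ {g h} → Big g → N₀ h → h ≢ v → Neg g h → ⊥
        no-other-big {g} bg Nh h≢v gh with g ≟ i
        ... | yes refl = big-two bg Nv Nh (h≢v ∘ sym) iv gh
        ... | no g≢i   = big-matching big bg (g≢i ∘ sym) Nv Nh (h≢v ∘ sym) iv gh

        second : ∀ {g h} → X₁ g → N₀ h → h ≢ v → Neg g h → Block g v → ⊥
        second {g} {h} Xg Nh h≢v gh (block {g′} {h′} g′≢g h′≢v cg′ Nh′ g′h′) with big-or-X₁ cg′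
        ... | inj₁ bg′ = no-other-big bg′ Nh′ h′≢v g′h′
        ... | inj₂ Xg′ with h ≟ h′
        ...   | yes refl = big-column big Nv Nh (h≢v ∘ sym) Xg Xg′ (g′≢g ∘ sym) iv gh g′h′
        ...   | no h≢h′  = noF4 (big≢X₁ big Xg) (big≢X₁ big Xg′) (g′≢g ∘ sym) (h≢v ∘ sym) (h′≢v ∘ sym) h≢h′ iv gh g′h′
                (C-N₀ (proj₁ big) Nv Nh (neg~ iv)) (C-N₀ (proj₁ big) Nv Nh′ (neg~ iv))
                (X₁-N₀ Xg Nv) (X₁-N₀ Xg Nh′) (X₁-N₀ Xg′ Nv) (X₁-N₀ Xg′ Nh)

        first : Block x₀ v → ⊥
        first (block {g} {h} _ h≢v cg Nh gh) with big-or-X₁ cg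
        ... | inj₁ bg = no-other-big bg Nh h≢v gh
        ... | inj₂ Xg = second Xg Nh h≢v gh (blocked Xg Nv)

      toX₁ : ∀ {g h} → C g → N₀ h → Neg g h → X₁ g
      toX₁ cg Nh gh with big-or-X₁ cg
      ... | inj₁ bg = ⊥-elim (big-positive bg Nh gh)
      ... | inj₂ Xg = Xg

      matching : ∀ {g₁ g₂ g₃ h₁ h₂ h₃} → X₁ g₁ → X₁ g₂ → X₁ g₃ → N₀ h₁ → N₀ h₂ → N₀ h₃ →
        Neg g₁ h₁ → Neg g₂ h₂ → Neg g₃ h₃ → g₁ ≢ g₂ → g₁ ≢ g₃ → g₂ ≢ g₃ → h₁ ≢ h₂ → h₁ ≢ h₃ → h₂ ≢ h₃ → ⊥
      matching X1 X2 X3 N1 N2 N3 e₁ e₂ e₃ n₁ n₂ n₃ n₄ n₅ n₆ = noF4 n₁ n₂ n₃ n₄ n₅ n₆ e₁ e₂ e₃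
        (X₁-N₀ X1 N2) (X₁-N₀ X1 N3) (X₁-N₀ X2 N1) (X₁-N₀ X2 N3) (X₁-N₀ X3 N1) (X₁-N₀ X3 N2)

      rows : ∀ {g g′ h₁ h₂ h₃ h₄} → X₁ g → X₁ g′ → N₀ h₁ → N₀ h₂ → N₀ h₃ → N₀ h₄ → g ≢ g′ → h₁ ≢ h₂ → h₃ ≢ h₄ →
        Neg g h₁ → Neg g h₂ → Neg g′ h₃ → Neg g′ h₄ → ⊥
      rows X X′ N1 N2 N3 N4 n₁ n₂ n₃ e₁ e₂ e₃ e₄ = two-lines n₁ n₂ n₃ e₁ e₂ e₃ e₄
        (X₁-N₀ X N3) (X₁-N₀ X N4) (X₁-N₀ X′ N1) (X₁-N₀ X′ N2)

      columns : ∀ {h h′ g₁ g₂ g₃ g₄} → N₀ h → N₀ h′ → X₁ g₁ → X₁ g₂ → X₁ g₃ → X₁ g₄ → h ≢ h′ → g₁ ≢ g₂ → g₃ ≢ g₄ →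
        Neg g₁ h → Neg g₂ h → Neg g₃ h′ → Neg g₄ h′ → ⊥
      columns Nh Nh′ X1 X2 X3 X4 n₁ n₂ n₃ e₁ e₂ e₃ e₄ = two-lines n₁ n₂ n₃ (neg-sym e₁) (neg-sym e₂) (neg-sym e₃) (neg-sym e₄)
        (~-sym (X₁-N₀ X3 Nh)) (~-sym (X₁-N₀ X4 Nh)) (~-sym (X₁-N₀ X1 Nh′)) (~-sym (X₁-N₀ X2 Nh′))

      -- By König's theorem, negative edges not covered by two vertices of opposite parts
      -- contain a matching of size three or two lines with two of them each.
      four-negatives : ∀ {g₁ g₂ g₃ g₄ h₁ h₂ h₃ h₄} → X₁ g₁ → X₁ g₂ → X₁ g₃ → X₁ g₄ → N₀ h₁ → N₀ h₂ → N₀ h₃ → N₀ h₄ →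
        Neg g₁ h₁ → Neg g₂ h₂ → Neg g₃ h₃ → Neg g₄ h₄ →
        g₂ ≢ g₁ → h₂ ≢ h₁ → g₃ ≢ g₁ → h₃ ≢ h₂ → g₄ ≢ g₂ → h₄ ≢ h₁ → ⊥
      four-negatives {g₁} {g₂} {g₃} {g₄} {h₁} {h₂} {h₃} {h₄} X1 X2 X3 X4 N1 N2 N3 N4 e₁ e₂ e₃ e₄ g₂≢g₁ h₂≢h₁ g₃≢g₁ h₃≢h₂ g₄≢g₂ h₄≢h₁
        with g₃ ≟ g₂ | h₃ ≟ h₁ | g₄ ≟ g₁ | h₄ ≟ h₂
      ... | no g₃≢g₂ | no h₃≢h₁ | _ | _ = matching X1 X2 X3 N1 N2 N3 e₁ e₂ e₃
              (g₂≢g₁ ∘ sym) (g₃≢g₁ ∘ sym) (g₃≢g₂ ∘ sym) (h₂≢h₁ ∘ sym) (h₃≢h₁ ∘ sym) (h₃≢h₂ ∘ sym)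
      ... | _ | _ | no g₄≢g₁ | no h₄≢h₂ = matching X1 X2 X4 N1 N2 N4 e₁ e₂ e₄
              (g₂≢g₁ ∘ sym) (g₄≢g₁ ∘ sym) (g₄≢g₂ ∘ sym) (h₂≢h₁ ∘ sym) (h₄≢h₁ ∘ sym) (h₄≢h₂ ∘ sym)
      ... | yes refl | _ | yes refl | _ = rows X1 X2 N1 N4 N2 N3 (g₂≢g₁ ∘ sym) (h₄≢h₁ ∘ sym) (h₃≢h₂ ∘ sym) e₁ e₄ e₂ e₃
      ... | yes refl | yes refl | no g₄≢g₁ | yes refl = columns N1 N2 X1 X2 X2 X4 (h₂≢h₁ ∘ sym) (g₂≢g₁ ∘ sym) (g₄≢g₂ ∘ sym) e₁ e₃ e₂ e₄
      ... | yes refl | no h₃≢h₁ | no g₄≢g₁ | yes refl = matching X1 X2 X4 N1 N3 N2 e₁ e₃ e₄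
              (g₂≢g₁ ∘ sym) (g₄≢g₁ ∘ sym) (g₄≢g₂ ∘ sym) (h₃≢h₁ ∘ sym) (h₂≢h₁ ∘ sym) h₃≢h₂
      ... | no g₃≢g₂ | yes refl | _ | yes refl = columns N1 N2 X1 X3 X2 X4 (h₂≢h₁ ∘ sym) (g₃≢g₁ ∘ sym) (g₄≢g₂ ∘ sym) e₁ e₃ e₂ e₄
      ... | no g₃≢g₂ | yes refl | yes refl | no h₄≢h₂ = matching X1 X2 X3 N4 N2 N1 e₄ e₂ e₃
              (g₂≢g₁ ∘ sym) (g₃≢g₁ ∘ sym) (g₃≢g₂ ∘ sym) h₄≢h₂ h₄≢h₁ h₂≢h₁

      impossible : ⊥
      impossible = let v , cv , x₀v = covered cx₀ in first (blocked x₀∈X₁ (cv , ~-sym x₀v))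
        where
        first : ∀ {v} → Block x₀ v → ⊥
        first (block {g₁} {h₁} _ _ cg₁ N1 e₁) = second (blocked X1 N1)
          where
          X1 = toX₁ cg₁ N1 e₁
          second : Block g₁ h₁ → ⊥
          second (block {g₂} {h₂} g₂≢g₁ h₂≢h₁ cg₂ N2 e₂) = third (blocked X1 N2) (blocked X2 N1)
            where
            X2 = toX₁ cg₂ N2 e₂
            third : Block g₁ h₂ → Block g₂ h₁ → ⊥
            -- The pairs `g₁ h₂` and `g₂ h₁` are the only ways to cover the first two negative edges
            -- by one vertex of each part. The third and the fourth negative edge avoid them.
            third (block g₃≢g₁ h₃≢h₂ cg₃ N3 e₃) (block g₄≢g₂ h₄≢h₁ cg₄ N4 e₄) =
              four-negatives X1 X2 (toX₁ cg₃ N3 e₃) (toX₁ cg₄ N4 e₄) N1 N2 N3 N4 e₁ e₂ e₃ e₄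
                g₂≢g₁ h₂≢h₁ g₃≢g₁ h₃≢h₂ g₄≢g₂ h₄≢h₁

    leaf-exists : ∀ {i} → C i → ⊥
    leaf-exists ci = minimal-exists ci λ {x₀} (cx₀ , min) → FromMinimal.impossible x₀ cx₀ min

-- Separators

-- Decidability cannot be refuted at any single point, and finitely many points can be treated in
-- turn. This allows reachability to be turned into a `Subset` when the goal is `⊥`.
decidable-CPS : ∀ {n} {P : Fin n → Set} → ((∀ i → Dec (P i)) → ⊥) → ⊥
decidable-CPS {zero}  k = k λ ()
decidable-CPS {suc n} {P} k = decidable-CPS {n} {P ∘ suc} λ P? → ¬¬-dec (λ P₀ → k λ { zero → P₀ ; (suc i) → P? i })
  where
  ¬¬-dec : ∀ {A : Set} → (Dec A → ⊥) → ⊥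
  ¬¬-dec k = k (no λ pa → k (yes pa))

module Candidates {n : ℕ} (G : SignedBigraph n) (free : FFree G) where

  open Bigraph G
  open Free free
  open Paths G free
  open Rootings G free
  open Leaves G free

  private variable
    i j s t u v o : Fin n
    A B : Fin n → Set
    C D : Subset n

  -- Walks all of whose vertices after the first satisfy A.
  data Star (A : Fin n → Set) : Fin n → Fin n → Set where
    []  : Star A u u
    via : u ~ v → A v → Star A v t → Star A u t

  star-map : (∀ {i} → A i → B i) → Star A u v → Star B u v
  star-map f [] = []
  star-map f (via uv av st) = via uv (f av) (star-map f st)

  _++ˢ_ : Star A u v → Star A v t → Star A u t
  [] ++ˢ st′ = st′
  via uv av st ++ˢ st′ = via uv av (st ++ˢ st′)

  snoc : Star A u v → v ~ t → A t → Star A u t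
  snoc st vt at = st ++ˢ via vt at []

  star-end : A u → Star A u v → A v
  star-end au [] = au
  star-end _ (via _ av st) = star-end av st

  star-reverse : A u → Star A u v → Star A v u
  star-reverse au [] = []
  star-reverse au (via uv av st) = snoc (star-reverse av st) (~-sym uv) au

  -- Upgrades the vertices of a walk from `A` to reachable from `o`, which is what membership in a
  -- component means.
  star-visits : Star A o u → Star A u v → Star (Star A o) u v
  star-visits pre [] = []
  star-visits pre (via uv av st) = via uv (snoc pre uv av) (star-visits (snoc pre uv av) st)

  star-walk : Star A u v → v ~ t → Walk A u t
  star-walk [] vt = last vt
  star-walk (via uv av st) vt = via uv av (star-walk st vt)

  Mem : Subset n → Fin n → Set
  Mem C i = i Sub.∈ C

  bd? : ∀ C s → Dec (Bd (Mem C) s)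
  bd? C s = ¬? (s Sub.∈? C) ×-dec Fin.any? (λ c → (c Sub.∈? C) ×-dec (c ~? s))

  record Component (A : Fin n → Set) (o : Fin n) (C : Subset n) : Set where
    field
      ⊆A     : ∀ {i} → Mem C i → A i
      start  : Mem C o
      grow   : ∀ {i j} → Mem C i → i ~ j → A j → Mem C j
      joined : ∀ {i j} → Mem C i → Mem C j → Star (Mem C) i j

  component : ∀ A o → A o → (∀ C → Component A o C → ⊥) → ⊥
  component A o ao k = decidable-CPS λ reach? → k ⟪ reach? ⟫ record
    { ⊆A = λ i∈ → star-end ao (∈⟪⟫⁻ reach? i∈)
    ; start = ∈⟪⟫ reach? []
    ; grow = λ i∈ ij aj → ∈⟪⟫ reach? (snoc (∈⟪⟫⁻ reach? i∈) ij aj)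
    ; joined = λ i∈ j∈ → star-map (∈⟪⟫ reach?)
        (star-reverse [] (star-visits [] (∈⟪⟫⁻ reach? i∈)) ++ˢ star-visits [] (∈⟪⟫⁻ reach? j∈)) }

  -- A component of the graph without the closed neighbourhood of the edge `u v`. An isolated vertex
  -- is excluded by `edge₀`, which together with `joined` gives `covered`.
  record Cand (u v : Fin n) (C : Subset n) : Set where
    field
      uv     : u ~ v
      far-u  : ∀ {c} → Mem C c → ¬ c ~ u
      far-v  : ∀ {c} → Mem C c → ¬ c ~ v
      closed : ∀ {c d} → Mem C c → c ~ d → ¬ Mem C d → d ~ u ⊎ d ~ v
      joined : ∀ {c d} → Mem C c → Mem C d → Star (Mem C) c d
      edge₀  : ∃₂ λ c d → Mem C c × Mem C d × c ~ d

    bd-near : ∀ {s} → Bd (Mem C) s → s ~ u ⊎ s ~ v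
    bd-near (s∉ , c , c∈ , cs) = closed c∈ cs s∉

    u∉ : ¬ Mem C u
    u∉ u∈ = far-v u∈ uv

    u∉Bd : ¬ Bd (Mem C) u
    u∉Bd (_ , c , c∈ , cu) = far-u c∈ cu

    covered : Covered (Mem C)
    covered c∈ with edge₀
    ... | e , f , e∈ , f∈ , ef with joined c∈ e∈
    ...   | []          = f , f∈ , ef
    ...   | via cd d∈ _ = _ , d∈ , cd

    mixed : ∀ {s t} → s ~ u → t ~ v → Same s t → ⊥
    mixed su tv s≈t = same-≁ (trans s≈t (common tv uv)) su

    outer : Outer (Mem C)
    outer bs bt s≈t with bd-near bs | bd-near bt
    ... | inj₁ su | inj₁ tu = u , ~-sym su , ~-sym tu , λ c∈ → far-u c∈ ∘ ~-sym
    ... | inj₂ sv | inj₂ tv = v , ~-sym sv , ~-sym tv , λ c∈ → far-v c∈ ∘ ~-sym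
    ... | inj₁ su | inj₂ tv = ⊥-elim (mixed su tv s≈t)
    ... | inj₂ sv | inj₁ tu = ⊥-elim (mixed tu sv (sym s≈t))

    -- The path `s u v t` avoids `C`, and connectedness of `C` provides a second way from `s` to `t`
    -- that avoids the neighbours of `u` and `v`.
    crossing : ∀ {s t} → Bd (Mem C) s → Bd (Mem C) t → s ~ u → t ~ v → Pos s t
    crossing (_ , c , c∈ , cs) (_ , d , d∈ , dt) su tv = square-closes su uv (~-sym tv) (~-sym cs) (avoids c∈)
      (star-walk (star-map avoids (joined c∈ d∈)) dt)
      where
      avoids : ∀ {i} → Mem C i → ¬ i ~ u × ¬ i ~ v
      avoids i∈ = far-u i∈ , far-v i∈

    biclique : Biclique (Mem C)
    biclique bs bt st with bd-near bs | bd-near bt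
    ... | inj₁ su | inj₁ tu = contradiction (common su tu) st
    ... | inj₂ sv | inj₂ tv = contradiction (common sv tv) st
    ... | inj₁ su | inj₂ tv = crossing bs bt su tv
    ... | inj₂ sv | inj₁ tu = pos-sym (crossing bt bs tu sv)

  cand-swap : Cand u v C → Cand v u C
  cand-swap cd = record
    { uv = ~-sym uv ; far-u = far-v ; far-v = far-u ; closed = λ c∈ cd d∉ → [ inj₂ , inj₁ ]′ (closed c∈ cd d∉)
    ; joined = joined ; edge₀ = edge₀ }
    where open Cand cd

  Incomplete : Subset n → Fin n → Fin n → Set
  Incomplete C s i = Bd (Mem C) s × Mem C i × Opp s i × ¬ s ~ i

  complete? : ∀ C → (∃₂ (Incomplete C)) ⊎ Complete (Mem C)
  complete? C with Fin.any? (λ s → Fin.any? (λ i → bd? C s ×-dec (i Sub.∈? C) ×-dec ¬? (side s Bool.≟ side i) ×-dec ¬? (s ~? i)))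
  ... | yes inc = inj₁ inc
  ... | no none = inj₂ λ {s} {c} bs c∈ o → decidable-stable (s ~? c) λ ¬sc → none (s , c , bs , c∈ , o , ¬sc)

  bd-shrink : ∀ {C D i} → D Sub.⊆ C → Bd (Mem D) i → Mem C i ⊎ Bd (Mem C) i
  bd-shrink {C} {i = i} D⊆C (_ , c , c∈ , ci) with i Sub.∈? C
  ... | yes i∈ = inj₁ i∈
  ... | no i∉  = inj₂ (i∉ , c , D⊆C c∈ , ci)

  -- The component of `x` in `C` without the neighbours of `s` is a candidate for the edge `s u`. It
  -- keeps the neighbours of `x`, which lie in the part of `s`, and loses the neighbour `c` of `s`.
  shrink : ∀ {x} → Cand u v C → s ~ u → Incomplete C s x → (∀ D → Cand s u D → D Sub.⊂ C → ⊥) → ⊥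
  shrink {u} {v} {C} {s} {x} cd su (bs@(s∉ , c , c∈ , cs) , x∈ , sx , ¬sx) k =
    component P x (x∈ , ¬sx ∘ ~-sym) λ D comp → let open Component comp renaming (joined to joined′) in
      k D (record
        { uv = su
        ; far-u = λ i∈ → proj₂ (⊆A i∈)
        ; far-v = λ i∈ → far-u (proj₁ (⊆A i∈))
        ; closed = λ i∈ ij j∉ → near (proj₁ (⊆A i∈)) ij (λ aj → j∉ (grow i∈ ij aj))
        ; joined = joined′
        ; edge₀ = let d , d∈ , xd = covered x∈ in
            x , d , start , grow start xd (d∈ , λ ds → sx (opp-opp (opp-sym (~-opp ds)) (opp-sym (~-opp xd)))) , xd })
        ((λ i∈ → proj₁ (⊆A i∈)) , c , c∈ , λ c∈D → proj₂ (⊆A c∈D) cs)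
    where
    open Cand cd
    P : Fin n → Set
    P i = Mem C i × ¬ i ~ s
    near : ∀ {i j} → Mem C i → i ~ j → ¬ P j → j ~ s ⊎ j ~ u
    near {j = j} i∈ ij ¬aj with j Sub.∈? C | j ~? s
    ... | _      | yes js = inj₁ js
    ... | yes j∈ | no ¬js = contradiction (j∈ , ¬js) ¬aj
    ... | no j∉  | no ¬js with bd-near (j∉ , _ , i∈ , ij)
    ...   | inj₁ ju = inj₂ ju
    -- A boundary vertex at `v` is adjacent to `s` by `crossing`, so `v` may be forgotten.
    ...   | inj₂ jv = contradiction (~-sym (pos~ (crossing bs (j∉ , _ , i∈ , ij) su jv))) ¬js

  record Invariant (Inv : Fin n → Fin n → Subset n → Set) : Set where
    field
      inv-swap   : Cand u v C → Inv u v C → Inv v u C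
      inv-shrink : ∀ {x} → Cand u v C → Inv u v C → s ~ u → Incomplete C s x → D Sub.⊂ C → Cand s u D → Inv s u D

  minimize : ∀ {Inv} → Invariant Inv →
    (∀ {u v C} → Cand u v C → Inv u v C → Complete (Mem C) → ⊥) →
    ∀ {u v C} → Cand u v C → Inv u v C → ⊥
  minimize {Inv} invariant k {C = C₀} cd₀ inv₀ = go (⊂-wellFounded C₀) cd₀ inv₀
    where
    open Invariant invariant
    go : ∀ {u v C} → Acc Sub._⊂_ C → Cand u v C → Inv u v C → ⊥
    go {C = C} (acc rec) cd inv with complete? C
    ... | inj₂ complete = k cd inv complete
    ... | inj₁ (s , x , inc) with Cand.bd-near cd (proj₁ inc)
    ...   | inj₁ su = shrink cd su inc λ D cdD D⊂C → go (rec D⊂C) cdD (inv-shrink cd inv su inc D⊂C cdD)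
    ...   | inj₂ sv = shrink (cand-swap cd) sv inc λ D cdD D⊂C →
              go (rec D⊂C) cdD (inv-shrink (cand-swap cd) (inv-swap cd inv) sv inc D⊂C cdD)

-- Tadpoles grown along paths, and the shift of an end

module Combine {n : ℕ} (G : SignedBigraph n) (free : FFree G) where

  open Bigraph G
  open Free free
  open Paths G free
  open Rootings G free
  open Leaves G free
  open Candidates G free

  private variable
    i j s t u v o : Fin n
    us : List (Fin n)
    A B : Fin n → Set
    C C′ : Subset n

  path-base : Path o v us → o ∈ (v ∷ us)
  path-base []          = here refl
  path-base (add _ _ p) = there (path-base p)

  front≢base : Path o v (u ∷ us) → v ≢ o
  front≢base (add vu al p) with path-base p
  ... | here refl = ~-distinct vu
  ... | there o∈  = proj₁ (All.lookup al o∈)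

  -- Each vertex of the path becomes the next end. The second component records that `m` is positive
  -- after any extension, so only the trivial path can leave a member of W₁.
  along : Rooted s A → (∀ {i} → A i → Mem C i) → Path s t us →
          (∀ {i c} → i ∈ (t ∷ us) → i ≢ s → Mem C c → Apart i c) →
          Σ (Rooted t (λ i → A i ⊎ i ∈ us)) λ ρ → us ≡ [] ⊎ isW1 (Rooted.T ρ) ≡ false
  along ρ A⊆C [] _ = weaken inj₁ ρ , inj₁ refl
  along {s} {A} ρ A⊆C path@(add {v = v} {us = us} vu al p) far =
    let ρ′ , _ = along ρ A⊆C p (far ∘ there)
        ρ″ = extend ρ′ vu
               [ (λ ai → far (here refl) (front≢base path) (A⊆C ai)) , All.lookup al ]′
               [ inj₁ , inj₂ ∘ there ]′ (inj₂ (here refl))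
    in ρ″ , inj₂ (Bool.∧-zeroʳ (not (isType2 (Rooted.ty ρ′))))

  up : ∀ {m} → TV m → TV (suc m)
  up TV.w     = TV.w
  up TV.y     = TV.y
  up TV.z     = TV.z
  up (TV.x i) = TV.x (suc i)

  up≢end : ∀ {m} (u : TV m) → up u ≢ TV.x zero
  up≢end TV.w ()
  up≢end TV.y ()
  up≢end TV.z ()
  up≢end (TV.x _) ()

  up-injective : ∀ {m} (u v : TV m) → up u ≡ up v → u ≡ v
  up-injective TV.w TV.w _ = refl
  up-injective TV.y TV.y _ = refl
  up-injective TV.z TV.z _ = refl
  up-injective (TV.x _) (TV.x _) refl = refl

  tadpole : (ty : TType) (m : ℕ) → (ty ≡ type2 → 1 ≤ m) → (TV m → TV m → Sign) → Tadpole
  tadpole ty m valid σ = record { tt = ty ; m = m ; valid = valid ; σ = σ }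

  -- If the end t of a tadpole lies in the part of s, then t can serve as the vertex w of a
  -- member of W₁ with end s, and the neighbour h of t takes over as the end of the tadpole.
  module Shift {s t i j : Fin n} {B : Fin n → Set} (s≈t : Same s t) (s≢t : s ≢ t) (i≢j : i ≢ j)
    (si : Neg s i) (sj : Neg s j) (ti : t ~ i) (tj : t ~ j)
    (sep : ∀ {k} → B k → Apart i k × Apart j k × k ≢ s)
    (ty : TType) (m : ℕ) (valid : ty ≡ type2 → 1 ≤ suc m) (σ : TV (suc m) → TV (suc m) → Sign)
    (f : TV (suc m) → Fin n) (f-inj : Injective _≡_ _≡_ f)
    (f-emb : ∀ u v → edge (f u) (f v) ≡ tadE (tadpole ty (suc m) valid σ) u v)
    (root : f (TV.x zero) ≡ t) (inside : ∀ u → u ≢ TV.x zero → B (f u))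
    (univ : ∀ u → u ≢ TV.x zero → Opp s (f u) → Pos s (f u)) where

    private
      T : Tadpole
      T = tadpole ty (suc m) valid σ

      h : Fin n
      h = f (TV.x (suc zero))

      th : t ~ h
      th = _ , trans (cong (λ o → edge o h) (sym root)) (f-emb (TV.x zero) (TV.x (suc zero)))

      sh : Pos s h
      sh = univ _ (λ ()) (same-opp s≈t (~-opp th))

      i-away : ∀ u → u ≢ TV.x zero → ¬ i ~ f u
      i-away u ne = proj₂ (proj₁ (sep (inside u ne)))

      j-away : ∀ u → u ≢ TV.x zero → ¬ j ~ f u
      j-away u ne = proj₂ (proj₁ (proj₂ (sep (inside u ne))))

    -- In type 2 with two path vertices, the additional edge at `w` leads to the end that is to be
    -- dropped, so no shorter tadpole remains. Together with `i`, `j` and `s` its five vertices form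
    -- F₆.
    with-F6 : m ≡ 0 → ty ≡ type2 → ⊥
    with-F6 refl refl = noF6 i≢j (λ eq → case f-inj eq of λ ()) s≢t (λ eq → case f-inj eq of λ ())
        (neg-sym si) (neg-sym sj) wt (f-emb _ TV.y) (f-emb _ TV.z) (~-sym ti) (~-sym tj)
        (~-sym (pos~ (univ TV.w (λ ()) (same-opp s≈t (~-opp (~-sym (neg~ wt)))))))
        (~-sym (pos~ sh)) (~-sym th) (_ , f-emb TV.w TV.y) (_ , f-emb TV.w TV.z)
        (i-away TV.y λ ()) (i-away TV.z λ ()) (j-away TV.y λ ()) (j-away TV.z λ ())
      where
      wt : Neg (f TV.w) t
      wt = trans (cong (edge (f TV.w)) (sym root)) (f-emb TV.w (TV.x zero))

    with-join : (ty ≡ type2 → 1 ≤ m) → ⊥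
    with-join valid′ = no-join ρ₁ ρ₂ (~-distinct (pos~ sh)) A≢h (λ (bk , _) → proj₂ (proj₂ (sep bk))) apart univ₁ univ₂
                         (λ _ → ~-opp (pos~ sh))
      where
      T′ : Tadpole
      T′ = tadpole ty m valid′ (λ u v → σ (up u) (up v))

      emb : ∀ u v → edge (f (up u)) (f (up v)) ≡ tadE T′ u v
      emb TV.w TV.w = f-emb TV.w TV.w
      emb TV.w TV.y = f-emb TV.w TV.y
      emb TV.w TV.z = f-emb TV.w TV.z
      emb TV.w (TV.x j) = f-emb TV.w (TV.x (suc j))
      emb TV.y TV.w = f-emb TV.y TV.w
      emb TV.y TV.y = f-emb TV.y TV.y
      emb TV.y TV.z = f-emb TV.y TV.z
      emb TV.y (TV.x j) = f-emb TV.y (TV.x (suc j))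
      emb TV.z TV.w = f-emb TV.z TV.w
      emb TV.z TV.y = f-emb TV.z TV.y
      emb TV.z TV.z = f-emb TV.z TV.z
      emb TV.z (TV.x j) = f-emb TV.z (TV.x (suc j))
      emb (TV.x i) TV.w = f-emb (TV.x (suc i)) TV.w
      emb (TV.x i) TV.y = f-emb (TV.x (suc i)) TV.y
      emb (TV.x i) TV.z = f-emb (TV.x (suc i)) TV.z
      emb (TV.x i) (TV.x j) = f-emb (TV.x (suc i)) (TV.x (suc j))

      B′ : Fin n → Set
      B′ k = B k × Apart t k

      t≢ : ∀ u → u ≢ TV.x zero → t ≢ f u
      t≢ u ne eq = ne (f-inj (trans (sym eq) (sym root)))

      ¬t~x : ∀ k → ¬ t ~ f (TV.x (suc (suc k)))
      ¬t~x k (τ , eq) = not-both (f-emb (TV.x zero) (TV.x (suc (suc k))))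
        (trans (cong (λ o → edge o _) root) eq)

      ¬t~w : ¬ t ~ f TV.w
      ¬t~w (τ , eq) with Tad.x-w T zero
      ... | inj₂ none = not-both (trans (f-emb (TV.x zero) TV.w) none) (trans (cong (λ o → edge o _) root) eq)
      -- An edge `t w` would be the additional edge of type 2 with two path vertices, the case left
      -- to `with-F6`.
      ... | inj₁ (_ , ty≡ , 1≡) with valid′ ty≡ | ℕ.suc-injective 1≡
      ...   | () | refl

      ¬t~y : ¬ t ~ f TV.y
      ¬t~y (τ , eq) = not-both (f-emb (TV.x zero) TV.y) (trans (cong (λ o → edge o _) root) eq)

      ¬t~z : ¬ t ~ f TV.z
      ¬t~z (τ , eq) = not-both (f-emb (TV.x zero) TV.z) (trans (cong (λ o → edge o _) root) eq)

      t-apart : ∀ u → u ≢ TV.x zero → Apart t (f (up u))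
      t-apart TV.w _ = t≢ TV.w (λ ()) , ¬t~w
      t-apart TV.y _ = t≢ TV.y (λ ()) , ¬t~y
      t-apart TV.z _ = t≢ TV.z (λ ()) , ¬t~z
      t-apart (TV.x zero) ne = contradiction refl ne
      t-apart (TV.x (suc k)) _ = t≢ (TV.x (suc (suc k))) (λ ()) , ¬t~x k

      ρ₂ : Rooted h B′
      ρ₂ = rooted T′ (f ∘ up , (λ eq → up-injective _ _ (f-inj eq)) , emb) refl
             λ u ne → inside (up u) (up≢end u) , t-apart u ne

      A′ : Fin n → Set
      A′ k = k ≡ i ⊎ k ≡ j ⊎ k ≡ t

      ρ₁ : Rooted s A′
      ρ₁ = rootedA i≢j si sj ti tj (s≢t ∘ sym) (inj₁ refl) (inj₂ (inj₁ refl)) (inj₂ (inj₂ refl))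

      A≢h : ∀ {k} → A′ k → k ≢ h
      A≢h (inj₁ refl)        = proj₁ (proj₁ (sep (inside _ λ ())))
      A≢h (inj₂ (inj₁ refl)) = proj₁ (proj₁ (proj₂ (sep (inside _ λ ()))))
      A≢h (inj₂ (inj₂ refl)) = ~-distinct th

      apart : ∀ {k l} → A′ k → B′ l → Apart k l
      apart (inj₁ refl)        (bl , _) = proj₁ (sep bl)
      apart (inj₂ (inj₁ refl)) (bl , _) = proj₁ (proj₂ (sep bl))
      apart (inj₂ (inj₂ refl)) (_ , tl) = tl

      univ₁ : Universal h ρ₁
      univ₁ TV.w _ = inj₂ (refl , refl , ~-sym th)
      univ₁ TV.y o = contradiction (opp-opp (opp-sym (~-opp (pos~ sh))) (~-opp (neg~ si))) o
      univ₁ TV.z o = contradiction (opp-opp (opp-sym (~-opp (pos~ sh))) (~-opp (neg~ sj))) o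
      univ₁ (TV.x zero) _ = inj₁ (pos-sym sh)

      univ₂ : Universal s ρ₂
      univ₂ u o = inj₁ (univ (up u) (up≢end u) o)

  shift : Same s t → s ≢ t → i ≢ j → Neg s i → Neg s j → t ~ i → t ~ j →
          (ρ : Rooted t B) → isW1 (Rooted.T ρ) ≡ false →
          (∀ {k} → B k → Apart i k × Apart j k × k ≢ s) →
          (∀ u → u ≢ TV.x zero → Opp s (Rooted.f ρ u) → Pos s (Rooted.f ρ u)) → ⊥
  shift s≈t s≢t i≢j si sj ti tj (rooted record { tt = type1 ; m = suc m ; valid = valid ; σ = σ } (f , f-inj , f-emb) root inside) w1 sep univ =
    Shift.with-join s≈t s≢t i≢j si sj ti tj sep type1 m valid σ f f-inj f-emb root inside univ λ ()
  shift s≈t s≢t i≢j si sj ti tj (rooted record { tt = type2 ; m = zero ; valid = valid ; σ = σ } _ root inside) w1 sep univ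
    with () ← valid refl
  shift s≈t s≢t i≢j si sj ti tj (rooted record { tt = type2 ; m = suc zero ; valid = valid ; σ = σ } (f , f-inj , f-emb) root inside) w1 sep univ =
    Shift.with-F6 s≈t s≢t i≢j si sj ti tj sep type2 0 valid σ f f-inj f-emb root inside univ refl refl
  shift s≈t s≢t i≢j si sj ti tj (rooted record { tt = type2 ; m = suc (suc m) ; valid = valid ; σ = σ } (f , f-inj , f-emb) root inside) w1 sep univ =
    Shift.with-join s≈t s≢t i≢j si sj ti tj sep type2 (suc m) valid σ f f-inj f-emb root inside univ λ _ → s≤s z≤n

-- Joins from two separated leaves

module TwoLeaves {n : ℕ} (G : SignedBigraph n) (free : FFree G) where

  open Bigraph G
  open Free free
  open Paths G free
  open Rootings G free
  open Leaves G free
  open Candidates G free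
  open Combine G free

  private variable
    i j u v o : Fin n
    A B : Fin n → Set
    C : Subset n

  Beyond : Subset n → Fin n → Set
  Beyond C i = ¬ Mem C i × ¬ Bd (Mem C) i

  beyond-apart : Beyond C i → Mem C j → Apart i j
  beyond-apart (i∉ , ¬bi) j∈ = (λ { refl → i∉ j∈ }) , λ ij → ¬bi (i∉ , _ , j∈ , ~-sym ij)

  apart-sym : Apart i j → Apart j i
  apart-sym (ne , ¬ij) = ne ∘ sym , ¬ij ∘ ~-sym

  Disjoint : Subset n → Subset n → Set
  Disjoint C C′ = ∀ {i j} → Mem C i → Mem C′ j → Apart i j

  walk-map : (∀ {i} → A i → B i) → Walk A u v → Walk B u v
  walk-map f (last uv) = last uv
  walk-map f (via uv av w) = via uv (f av) (walk-map f w)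

  walk-snoc : Walk A u v → A v → v ~ o → Walk A u o
  walk-snoc (last uv) av vt = via uv av (last vt)
  walk-snoc (via uv av w) av′ vt = via uv av (walk-snoc w av′ vt)

  star-++-walk : Star A u v → Walk A v o → Walk A u o
  star-++-walk [] w = w
  star-++-walk (via uv av st) w = via uv av (star-++-walk st w)

  path-walk : ∀ {us} → Path o v us → All A us → u ~ o → Walk A u v
  path-walk [] _ uo = last uo
  path-walk (add vu _ p) (au ∷ aus) uo = walk-snoc (path-walk p aus uo) au (~-sym vu)

  record Side (C C′ : Subset n) : Set where
    field
      s        : Fin n
      bs       : Bd (Mem C) s
      leaf     : LeafAt (Mem C) s
      complete : Complete (Mem C)
      biclique : Biclique (Mem C)
      outer    : Outer (Mem C)
      joined   : ∀ {i j} → Mem C i → Mem C j → Star (Mem C) i j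
      {c′}     : Fin n
      c′∈      : Mem C′ c′
      walk     : Star (Beyond C) s c′

  module OneSide {C C′ : Subset n} (disjoint : Disjoint C C′) (S : Side C C′) where

    open Side S

    -- What can be reached from `s` before the boundary of `C′`; it is empty if `s` already lies on
    -- that boundary.
    R : Fin n → Set
    R i = ¬ Bd (Mem C′) s × Star (λ j → Beyond C j × Beyond C′ j) s i

    s∉C′ : ¬ Mem C′ s
    s∉C′ s∈ = let _ , c , c∈ , cs = bs in proj₂ (disjoint c∈ s∈) cs

    R-beyond′ : R i → Beyond C′ i
    R-beyond′ (¬b , st) = proj₂ (star-end′ st)
      where
      star-end′ : ∀ {i} → Star (λ j → Beyond C j × Beyond C′ j) s i → (i ≡ s ⊎ Beyond C i) × Beyond C′ i
      star-end′ [] = inj₁ refl , s∉C′ , ¬b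
      star-end′ (via _ bb st) = let b , b′ = star-end bb st in inj₂ b , b′

    R-beyond : R i → i ≡ s ⊎ Beyond C i
    R-beyond (_ , [])          = inj₁ refl
    R-beyond (_ , via _ bb st) = inj₂ (proj₁ (star-end bb st))

    R-step : R i → i ~ j → Beyond C j → Beyond C′ j → R j
    R-step (¬b , st) ij b b′ = ¬b , snoc st ij (b , b′)

    record Link : Set where
      constructor link
      field
        {t}  : Fin n
        {us} : List (Fin n)
        path : Path s t us
        bt   : Bd (Mem C′) t
        all  : All R us
        kind : us ≡ [] ⊎ Beyond C t

    reach-path : R i → ∃ λ us → Path s i us × All R us
    reach-path (¬b , st) = go [] (¬b , []) [] st
      where
      go : ∀ {v us i} → Path s v us → R v → All R us → Star (λ j → Beyond C j × Beyond C′ j) v i → ∃ λ us → Path s i us × All R us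
      go p rv rus [] = _ , p , rus
      go p rv rus (via vw (b , b′) st) =
        let us′ , p′ , sub = attach-adjacent (~-sym vw) p
        in go p′ (R-step rv vw b b′) (All.tabulate (λ i∈ → All.lookup (rv ∷ rus) (sub i∈))) st

    -- Follows the walk to its first vertex on the boundary of `C′`, attaching each new vertex to
    -- the induced path so far. The walk cannot enter `C′` without meeting that boundary.
    find-link : Link
    find-link with bd? C′ s
    ... | yes b = link [] b [] (inj₁ refl)
    ... | no ¬b = go [] (¬b , []) [] walk c′∈
      where
      go : ∀ {v us i} → Path s v us → R v → All R us → Star (Beyond C) v i → Mem C′ i → Link
      go p rv rus [] i∈ = contradiction i∈ (proj₁ (R-beyond′ rv))
      go p rv rus (via {v = y} vy by st) i∈ with attach-adjacent (~-sym vy) p | y Sub.∈? C′ | bd? C′ y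
      ... | _ | yes y∈ | _ = contradiction vy (proj₂ (beyond-apart (R-beyond′ rv) y∈))
      ... | us′ , p′ , sub | no _ | yes bd = link p′ bd (All.tabulate (λ i∈ → All.lookup (rv ∷ rus) (sub i∈))) (inj₂ by)
      ... | us′ , p′ , sub | no y∉ | no ¬bd =
        go p′ (R-step rv vy by (y∉ , ¬bd)) (All.tabulate (λ i∈ → All.lookup (rv ∷ rus) (sub i∈))) st i∈

    R-far : R i → i ≢ s → Mem C j → Apart i j
    R-far ri i≢s j∈ with R-beyond ri
    ... | inj₁ i≡s = contradiction i≡s i≢s
    ... | inj₂ b   = beyond-apart b j∈

    link-far : (ℓ : Link) → ∀ {i c} → i ∈ (Link.t ℓ ∷ Link.us ℓ) → i ≢ s → Mem C c → Apart i c
    link-far (link [] _ _ _) (here refl) i≢s _ = contradiction refl i≢s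
    link-far (link (add _ _ _) _ _ (inj₂ b)) (here refl) _ c∈ = beyond-apart b c∈
    link-far ℓ (there i∈) i≢s c∈ = R-far (All.lookup (Link.all ℓ) i∈) i≢s c∈

  module TwoSides {C C′ : Subset n} (disjoint : Disjoint C C′) (disjoint′ : Disjoint C′ C)
    (S : Side C C′) (S′ : Side C′ C) where

    private
      module S = Side S
      module S′ = Side S′
      module O = OneSide disjoint S
      module O′ = OneSide disjoint′ S′

    ends-differ : S.s ≢ S′.s
    ends-differ eq = no-sum (leaf-rooted S.leaf) (subst (λ o → Rooted o (Mem C′)) (sym eq) (leaf-rooted S′.leaf)) disjoint

    private
      reaches : ∀ {i} → O.R i → i ≡ S′.s ⊎ S′.s ~ i → Beyond C S′.s → ⊥
      reaches {i} ri near b = let us , p , all = end near in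
        no-sum (proj₁ (along (leaf-rooted S.leaf) id p (far all))) (leaf-rooted S′.leaf) (apart all)
        where
        end : i ≡ S′.s ⊎ S′.s ~ i → ∃ λ us → Path S.s S′.s us × All O.R us
        end (inj₁ refl) = O.reach-path ri
        end (inj₂ s′i)  = let us , p , all = O.reach-path ri ; us′ , p′ , sub = attach-adjacent s′i p in
          us′ , p′ , All.tabulate (λ i∈ → All.lookup (ri ∷ all) (sub i∈))
        far : ∀ {us} → All O.R us → ∀ {i c} → i ∈ (S′.s ∷ us) → i ≢ S.s → Mem C c → Apart i c
        far all (here refl) _ c∈ = beyond-apart b c∈
        far all (there i∈) ne c∈ = O.R-far (All.lookup all i∈) ne c∈
        apart : ∀ {us} → All O.R us → ∀ {i j} → Mem C i ⊎ i ∈ us → Mem C′ j → Apart i j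
        apart all (inj₁ i∈) j∈ = disjoint i∈ j∈
        apart all (inj₂ i∈) j∈ = beyond-apart (O.R-beyond′ (All.lookup all i∈)) j∈

    -- Otherwise `O.R` reaches a vertex equal or adjacent to `S′.s`, and the first leaf extended
    -- along an induced path to `S′.s` forms a sum with the second leaf.
    no-meet : ∀ {i j} → O.R i → O′.R j → i ~ j ⊎ i ≡ j → ⊥
    no-meet ri (¬b , st) near = go st near
      where
      b : Beyond C S′.s
      b = O′.s∉C′ , ¬b
      go : ∀ {j} → Star (λ j → Beyond C′ j × Beyond C j) S′.s j → _ ~ j ⊎ _ ≡ j → ⊥
      go [] (inj₁ is′) = reaches ri (inj₂ (~-sym is′)) b
      go [] (inj₂ eq)  = reaches ri (inj₁ eq) b
      go (via s′x (bx′ , bx) st) near = reaches (proj₁ rj , proj₂ rj ++ˢ star-map (λ (p , q) → q , p) (star-reverse (bx′ , bx) st)) (inj₂ s′x) b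
        where
        rj : O.R _
        rj = [ (λ ij → O.R-step ri ij (proj₂ (star-end (bx′ , bx) st)) (proj₁ (star-end (bx′ , bx) st))) , (λ { refl → ri }) ]′ near

    module Universality (ℓ : O.Link) (ℓ′ : O′.Link) where

      module L = O.Link ℓ
      module L′ = O′.Link ℓ′

      In′ : Fin n → Set
      In′ i = Mem C′ i ⊎ O′.R i

      In′-far : ∀ {i c} → In′ i → Mem C c → Apart i c
      In′-far (inj₁ i∈) c∈ = disjoint′ i∈ c∈
      In′-far (inj₂ ri) c∈ = beyond-apart (O′.R-beyond′ ri) c∈

      In′-R : ∀ {i j} → In′ i → O.R j → Apart i j
      In′-R (inj₁ i∈) rj = apart-sym (beyond-apart (O.R-beyond′ rj) i∈)
      In′-R (inj₂ ri) rj = (λ { refl → no-meet rj ri (inj₂ refl) }) , λ ij → no-meet rj ri (inj₁ (~-sym ij))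

      -- The second half of a sum whenever a negative edge at `t′` creates a tadpole with end `t′`
      -- on the first side.
      opposite : Rooted L′.t In′
      opposite = weaken [ inj₁ , (λ i∈ → inj₂ (All.lookup L′.all i∈)) ]′
        (proj₁ (along (leaf-rooted S′.leaf) id L′.path (O′.link-far ℓ′)))

      t′≢s : L′.t ≢ S.s
      t′≢s = go ℓ′ (bd? C′ S.s)
        where
        go : (ℓ′ : O′.Link) → Dec (Bd (Mem C′) S.s) → O′.Link.t ℓ′ ≢ S.s
        go (O′.link [] _ _ _) _ eq = ends-differ (sym eq)
        go (O′.link (add _ _ _) _ _ (inj₂ (_ , ¬b))) (yes b) refl = ¬b b
        go (O′.link (add tu _ _) _ (ru ∷ _) _) (no ¬b) refl = no-meet (¬b , []) ru (inj₁ tu)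

      t′∉ : ¬ Mem C L′.t
      t′∉ = proj₁ L′.bt

      back : ∃ λ c → L.t ~ c × In′ c × Walk In′ c L′.t
      back = let _ , c , c∈ , ct = L.bt ; _ , d , d∈ , ds = S′.bs in
        c , ~-sym ct , inj₁ c∈ , star-++-walk (star-map inj₁ (S′.joined c∈ d∈)) (path-walk L′.path (All.map inj₂ L′.all) ds)

      Good : Fin n → Set
      Good i = Opp L′.t i → Pos L′.t i

      -- square-closes turns a neighbour of t′ on the path into a positive neighbour two
      -- steps further from s.
      climb : ∀ {A v us x} → Path S.s v us → (∀ {i c} → i ∈ (v ∷ us) → i ≢ S.s → Mem C c → Apart i c) →
        (∀ {i j} → A i → j ∈ us ⊎ Mem C j → ¬ i ~ j) → v ~ x → A x → Walk A x L′.t → All Good (v ∷ us)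
      climb [] _ _ _ _ _ = S.biclique L′.bt S.bs ∷ []
      climb {A} {v} {_ ∷ us} {x} path@(add {u = u} vu al p) far avoid vx ax wlk =
        (λ o → pos-sym (good p rest o)) ∷ rest
        where
        rest : All Good (u ∷ us)
        rest = climb {λ i → A i ⊎ i ≡ v} p (far ∘ there)
          (λ { (inj₁ ai) (inj₁ j∈) → avoid ai (inj₁ (there j∈)) ; (inj₁ ai) (inj₂ j∈) → avoid ai (inj₂ j∈)
             ; (inj₂ refl) (inj₁ j∈) → proj₂ (All.lookup al j∈) ; (inj₂ refl) (inj₂ j∈) → proj₂ (far (here refl) (front≢base path) j∈) })
          (~-sym vu) (inj₂ refl) (via vx (inj₁ ax) (walk-map inj₁ wlk))
        good : Path S.s u us → All Good (u ∷ us) → Opp L′.t v → Pos v L′.t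
        good [] _ o = let _ , c , c∈ , cs = S.bs
                          t′c = S.complete L′.bt c∈ (same-opp (opp-opp o (~-opp vu)) (~-opp (~-sym cs))) in
          square-closes vu (~-sym cs) (~-sym t′c) vx (avoid ax (inj₁ (here refl)) , avoid ax (inj₂ c∈))
            (walk-map (λ ai → avoid ai (inj₁ (here refl)) , avoid ai (inj₂ c∈)) wlk)
        good (add {u = w} uw _ _) (_ ∷ good-w ∷ _) o =
          square-closes vu uw (~-sym (pos~ (good-w (opp-sym (same-opp (common (~-sym uw) vu) (opp-sym o)))))) vx
            (avoid ax (inj₁ (here refl)) , avoid ax (inj₁ (there (here refl))))
            (walk-map (λ ai → avoid ai (inj₁ (here refl)) , avoid ai (inj₁ (there (here refl)))) wlk)

      path-good : All Good (L.t ∷ L.us)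
      path-good = let c , tc , c∈ , wlk = back in climb L.path (O.link-far ℓ)
        (λ { i∈ (inj₁ j∈) → proj₂ (In′-R i∈ (All.lookup L.all j∈)) ; i∈ (inj₂ j∈) → proj₂ (In′-far i∈ j∈) }) tc c∈ wlk

      MemGood : Fin n → Set
      MemGood i = Mem C i × Good i

      vacuous : Same L′.t i → Good i
      vacuous same o = contradiction same o

      via-complete : Mem C i → Opp L′.t i → L′.t ~ i
      via-complete i∈ o = S.complete L′.bt i∈ o

      t′-distinct : Mem C i → i ≢ L′.t
      t′-distinct i∈ refl = t′∉ i∈

      -- `exceptional` is a W₁ whose end is already on the boundary of `C′`; the sign between its
      -- `w` and the other end cannot be controlled.
      data Core : Set where
        exceptional : ∀ {i j o} → L.us ≡ [] → i ≢ j → Neg S.s i → Neg S.s j → o ~ i → o ~ j → o ≢ S.s →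
                      Mem C i → Mem C j → Mem C o → Core
        regular     : (ρ : Rooted S.s MemGood) → (L.us ≡ [] → isW1 (Rooted.T ρ) ≡ false) → Core

      -- Both ends lie on the boundary of `C` and in the same part, so they have a common neighbour
      -- without neighbours in `C`, which completes F₅.
      no-matching : ∀ {i j d} → Same L′.t S.s → Mem C i → Mem C j → Mem C d → d ~ i → d ~ j → i ≢ j →
                    Neg S.s i → Neg L′.t j → ⊥
      no-matching same i∈ j∈ d∈ di dj i≢j si tj =
        let v , vs , vt , far = S.outer S.bs L′.bt (sym same) in
        noF5 i≢j (t′≢s ∘ sym) (neg-sym si) (neg-sym tj) vs vt
          (~-sym (via-complete i∈ (same-opp same (~-opp (neg~ si))))) (~-sym di)
          (~-sym (S.complete S.bs j∈ (same-opp (sym same) (~-opp (neg~ tj))))) (~-sym dj) (far d∈)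

      core : Core
      core = from S.leaf
        where
        from : LeafAt (Mem C) S.s → Core
        from (leafB {i} {j} {k} {o} i≢j ki kj os ks oi oj k≢o i≢s j≢s i∈ j∈ k∈ o∈) =
          regular (rootedB i≢j ki kj os ks oi oj k≢o i≢s j≢s (i∈ , good-i) (j∈ , good-j) (k∈ , good-k) (o∈ , good-o)) (λ _ → refl)
          where
          s≈i : Same S.s i
          s≈i = common (~-sym ks) (neg~ (neg-sym ki))
          s≈j : Same S.s j
          s≈j = common (~-sym ks) (neg~ (neg-sym kj))
          k≈o : Same k o
          k≈o = common (neg~ ki) oi
          t~s : ∀ {i} → Same S.s i → Opp L′.t i → L′.t ~ S.s
          t~s s≈i to = pos~ (S.biclique L′.bt S.bs (opp-sym (same-opp s≈i (opp-sym to))))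
          good-i : Good i
          -- The rows `k`, `o` and `t′` have negative edges to `j`, `s` and `i`, which is F₄.
          good-i to = not-neg⇒pos (via-complete i∈ to) λ ti →
            noF4 k≢o (t′-distinct k∈) (t′-distinct o∈) j≢s (i≢j ∘ sym) (i≢s ∘ sym) kj os ti
              ks (neg~ ki) oj oi (via-complete j∈ (opp-sym (same-opp (trans (sym s≈j) s≈i) (opp-sym to)))) (t~s s≈i to)
          good-j : Good j
          good-j to = not-neg⇒pos (via-complete j∈ to) λ tj →
            noF4 k≢o (t′-distinct k∈) (t′-distinct o∈) i≢s i≢j (j≢s ∘ sym) ki os tj
              ks (neg~ kj) oi oj (via-complete i∈ (opp-sym (same-opp (trans (sym s≈i) s≈j) (opp-sym to)))) (t~s s≈j to)
          good-k : Good k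
          good-k to = not-neg⇒pos (via-complete k∈ to) λ tk →
            no-matching (opp-opp to (~-opp ks)) o∈ k∈ i∈ (~-sym oi) (neg~ (neg-sym ki)) (k≢o ∘ sym) (neg-sym os) tk
          good-o : Good o
          good-o to = not-neg⇒pos (via-complete o∈ to) λ to′ →
            no-sum (rootedB {In = Mem C} i≢j ki kj (neg-sym to′) (~-sym (via-complete k∈ (opp-sym (same-opp k≈o (opp-sym to)))))
              oi oj k≢o (t′-distinct i∈) (t′-distinct j∈) i∈ j∈ k∈ o∈) opposite (λ c∈ i∈ → apart-sym (In′-far i∈ c∈))
        from (leafA {i} {j} {o} i≢j si sj oi oj o≢s i∈ j∈ o∈) = split L.path L.all refl
          where
          split : ∀ {us} → Path S.s L.t us → All O.R us → us ≡ L.us → Core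
          split [] _ eq = exceptional (sym eq) i≢j si sj oi oj o≢s i∈ j∈ o∈
          split (add {u = u} {us = us} tu _ p) all eq =
            regular (rootedA i≢j si sj oi oj o≢s (i∈ , good-i) (j∈ , good-j) (o∈ , good-o))
              (λ us≡[] → case trans eq us≡[] of λ ())
            where
            rs : O.R S.s
            rs = All.lookup all (path-base p)
            s≈o : Same S.s o
            s≈o = common (neg~ si) oi
            good-i : Good i
            good-i to = not-neg⇒pos (via-complete i∈ to) λ ti →
              no-matching (opp-opp to (opp-sym (~-opp (neg~ si)))) j∈ i∈ o∈ oj oi (i≢j ∘ sym) sj ti
            good-j : Good j
            good-j to = not-neg⇒pos (via-complete j∈ to) λ tj →
              no-matching (opp-opp to (opp-sym (~-opp (neg~ sj)))) i∈ j∈ o∈ oi oj i≢j si tj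
            good-o : Good o
            -- If `t′ o` is negative, `s`, `i`, `j` and `o` form a tadpole of type 2 with end `t′`.
            -- The sum with `opposite` requires `s` to be apart from it, which holds because the
            -- nonempty path puts `s` into `O.R`.
            good-o to = not-neg⇒pos (via-complete o∈ to) λ to′ →
              no-sum (rootedB {In = λ k → Mem C k ⊎ k ≡ S.s} i≢j si sj (neg-sym to′)
                (~-sym (pos~ (S.biclique L′.bt S.bs (opp-sym (same-opp s≈o (opp-sym to))))))
                oi oj (o≢s ∘ sym) (t′-distinct i∈) (t′-distinct j∈) (inj₁ i∈) (inj₁ j∈) (inj₂ refl) (inj₁ o∈)) opposite
                λ { (inj₁ c∈) i∈ → apart-sym (In′-far i∈ c∈) ; (inj₂ refl) i∈ → apart-sym (In′-R i∈ rs) }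

      In⁺ : Fin n → Set
      In⁺ i = (Mem C i ⊎ O.R i) × Good i

      data Half : Set where
        exceptional : ∀ {i j o} → L.t ≡ S.s → i ≢ j → Neg S.s i → Neg S.s j → o ~ i → o ~ j → o ≢ S.s →
                      Mem C i → Mem C j → Mem C o → Half
        regular     : (ρ : Rooted L.t In⁺) → isW1 (Rooted.T ρ) ≡ false → Half

      half : Half
      half with core
      ... | exceptional us≡[] n₁ e₁ e₂ e₃ e₄ n₂ c₁ c₂ c₃ = exceptional (single L.path us≡[]) n₁ e₁ e₂ e₃ e₄ n₂ c₁ c₂ c₃
        where
        single : ∀ {t us} → Path S.s t us → us ≡ [] → t ≡ S.s
        single [] _ = refl
      ... | regular ρ w1 = go w1 (along ρ proj₁ L.path (O.link-far ℓ))
        where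
        In⁺-intro : ∀ {i} → MemGood i ⊎ i ∈ L.us → In⁺ i
        In⁺-intro (inj₁ (i∈ , good)) = inj₁ i∈ , good
        In⁺-intro (inj₂ i∈) = inj₂ (All.lookup L.all i∈) , All.lookup (All.tail path-good) i∈
        go : (L.us ≡ [] → isW1 (Rooted.T ρ) ≡ false) →
             Σ (Rooted L.t (λ i → MemGood i ⊎ i ∈ L.us)) (λ ρ′ → L.us ≡ [] ⊎ isW1 (Rooted.T ρ′) ≡ false) → Half
        go _ (ρ′ , inj₂ nw) = regular (weaken In⁺-intro ρ′) nw
        go w1 (ρ′ , inj₁ us≡[]) = regular (weaken′ L.path us≡[]) (w1′ L.path us≡[])
          where
          weaken′ : ∀ {t us} → Path S.s t us → us ≡ [] → Rooted t In⁺
          weaken′ [] _ = weaken (In⁺-intro ∘ inj₁) ρ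
          w1′ : ∀ {t us} (p : Path S.s t us) (eq : us ≡ []) → isW1 (Rooted.T (weaken′ p eq)) ≡ false
          w1′ [] _ = w1 us≡[]

      In⁺-distinct : ∀ {i} → In⁺ i → i ≢ L′.t
      In⁺-distinct (inj₁ i∈ , _) = t′-distinct i∈
      In⁺-distinct (inj₂ ri , _) with O.R-beyond ri
      ... | inj₁ refl = t′≢s ∘ sym
      ... | inj₂ (_ , ¬b) = λ { refl → ¬b L′.bt }

      t≢t′ : L.t ≢ L′.t
      t≢t′ = go ℓ
        where
        go : (ℓ : O.Link) → O.Link.t ℓ ≢ L′.t
        go (O.link [] _ _ _) eq = t′≢s (sym eq)
        go (O.link (add _ _ _) _ _ (inj₂ (_ , ¬b))) refl = ¬b L′.bt

      universal : (ρ : Rooted L.t In⁺) → Universal L′.t ρ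
      universal ρ u o with Tad.end? (Rooted.T ρ) u
      ... | yes refl = inj₁ (subst Good (sym (Rooted.root ρ)) (All.head path-good) o)
      ... | no ne    = inj₁ (proj₂ (Rooted.inside ρ u ne) o)

      universal-A : ∀ {i j o} (i≢j : i ≢ j) (si : Neg S.s i) (sj : Neg S.s j) (oi : o ~ i) (oj : o ~ j) (o≢s : o ≢ S.s)
        (i∈ : Mem C i) (j∈ : Mem C j) (o∈ : Mem C o) → Opp S.s L′.t →
        Universal L′.t (rootedA {In = Mem C} i≢j si sj oi oj o≢s i∈ j∈ o∈)
      universal-A _ _ _ _ _ _ _ _ o∈ _ TV.w to = inj₂ (refl , refl , via-complete o∈ to)
      universal-A _ si _ _ _ _ _ _ _ st TV.y to = contradiction (opp-opp (opp-sym st) (~-opp (neg~ si))) to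
      universal-A _ _ sj _ _ _ _ _ _ st TV.z to = contradiction (opp-opp (opp-sym st) (~-opp (neg~ sj))) to
      universal-A _ _ _ _ _ _ _ _ _ _ (TV.x zero) to = inj₁ (S.biclique L′.bt S.bs to)

  module Join {C C′ : Subset n} (disjoint : Disjoint C C′) (disjoint′ : Disjoint C′ C)
    (S : Side C C′) (S′ : Side C′ C) (ℓ : OneSide.Link disjoint S) (ℓ′ : OneSide.Link disjoint′ S′) where

    module U = TwoSides.Universality disjoint disjoint′ S S′ ℓ ℓ′
    module U′ = TwoSides.Universality disjoint′ disjoint S′ S ℓ′ ℓ
    private
      module S = Side S
      module S′ = Side S′
      module O = OneSide disjoint S
      module O′ = OneSide disjoint′ S′

    C-In : ∀ {i j} → Mem C i → U′.In⁺ j → Apart i j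
    C-In i∈ (inj₁ j∈ , _) = disjoint i∈ j∈
    C-In i∈ (inj₂ rj , _) = apart-sym (beyond-apart (O′.R-beyond′ rj) i∈)

    In-In : ∀ {i j} → U.In⁺ i → U′.In⁺ j → Apart i j
    In-In (inj₁ i∈ , _) j∈ = C-In i∈ j∈
    In-In (inj₂ ri , _) (inj₁ j∈ , _) = beyond-apart (O.R-beyond′ ri) j∈
    In-In (inj₂ ri , _) (inj₂ rj , _) = apart-sym (U.In′-R (inj₂ rj) ri)

    regular-regular : (ρ : Rooted U.L.t U.In⁺) (ρ′ : Rooted U.L′.t U′.In⁺) →
      isW1 (Rooted.T ρ) ≡ false → isW1 (Rooted.T ρ′) ≡ false → ⊥
    regular-regular ρ ρ′ w1 w1′ = no-join ρ ρ′ U.t≢t′ U.In⁺-distinct U′.In⁺-distinct In-In (U.universal ρ) (U′.universal ρ′)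
      λ { (inj₁ eq) → case trans (sym eq) w1 of λ () ; (inj₂ eq) → case trans (sym eq) w1′ of λ () }

    -- For ends in opposite parts the exception for W₁ in 𝒥 covers the uncontrolled sign. For ends
    -- in the same part, 𝒥 admits no W₁, but then `t′` is adjacent to `i` and `j` and can replace
    -- `o`, so that `shift` applies.
    exceptional-regular : ∀ {i j o} → U.L.t ≡ S.s → i ≢ j → Neg S.s i → Neg S.s j → o ~ i → o ~ j → o ≢ S.s →
      Mem C i → Mem C j → Mem C o → (ρ′ : Rooted U.L′.t U′.In⁺) → isW1 (Rooted.T ρ′) ≡ false → ⊥
    exceptional-regular t≡s i≢j si sj oi oj o≢s i∈ j∈ o∈ ρ′ w1′ with opp? S.s U.L′.t
    ... | inj₂ st = no-join (rootedA {In = Mem C} i≢j si sj oi oj o≢s i∈ j∈ o∈) ρ′ (U.t′≢s ∘ sym) U.t′-distinct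
        (subst (λ s → ∀ {j} → U′.In⁺ j → j ≢ s) t≡s U′.In⁺-distinct) C-In
        (U.universal-A i≢j si sj oi oj o≢s i∈ j∈ o∈ st) (subst (λ s → Universal s ρ′) t≡s (U′.universal ρ′)) (λ _ → st)
    ... | inj₁ s≈t = shift s≈t (U.t′≢s ∘ sym) i≢j si sj (adj i∈ si) (adj j∈ sj) ρ′ w1′
        (λ k∈ → C-In i∈ k∈ , C-In j∈ k∈ , subst (λ s → _ ≢ s) t≡s (U′.In⁺-distinct k∈))
        (λ u ne → subst (λ s → Opp s (Rooted.f ρ′ u) → Pos s (Rooted.f ρ′ u)) t≡s (proj₂ (Rooted.inside ρ′ u ne)))
      where
      adj : ∀ {i} → Mem C i → Neg S.s i → U.L′.t ~ i
      adj i∈ si = U.via-complete i∈ (same-opp (sym s≈t) (~-opp (neg~ si)))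

    -- Each end lies on both boundaries. In the same part, both are adjacent to all four of `i`,
    -- `j`, `i′` and `j′`, which gives two rows with two negative edges each.
    exceptional-exceptional : ∀ {i j o i′ j′ o′} → U.L.t ≡ S.s → i ≢ j → Neg S.s i → Neg S.s j → o ~ i → o ~ j → o ≢ S.s →
      Mem C i → Mem C j → Mem C o → U.L′.t ≡ S′.s → i′ ≢ j′ → Neg S′.s i′ → Neg S′.s j′ → o′ ~ i′ → o′ ~ j′ → o′ ≢ S′.s →
      Mem C′ i′ → Mem C′ j′ → Mem C′ o′ → ⊥
    exceptional-exceptional t≡s i≢j si sj oi oj o≢s i∈ j∈ o∈ t′≡s′ i′≢j′ si′ sj′ oi′ oj′ o≢s′ i∈′ j∈′ o∈′ with opp? S.s S′.s
    ... | inj₂ ss′ = no-join ρ ρ′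
        (TwoSides.ends-differ disjoint disjoint′ S S′) (subst (λ s → ∀ {i} → Mem C i → i ≢ s) t′≡s′ U.t′-distinct)
        (subst (λ s → ∀ {i} → Mem C′ i → i ≢ s) t≡s U′.t′-distinct) disjoint
        (subst (λ s → Universal s ρ) t′≡s′ (U.universal-A i≢j si sj oi oj o≢s i∈ j∈ o∈ (subst (Opp S.s) (sym t′≡s′) ss′)))
        (subst (λ s → Universal s ρ′) t≡s (U′.universal-A i′≢j′ si′ sj′ oi′ oj′ o≢s′ i∈′ j∈′ o∈′ (subst (Opp S′.s) (sym t≡s) (opp-sym ss′))))
        (λ _ → ss′)
      where
      ρ : Rooted S.s (Mem C)
      ρ = rootedA i≢j si sj oi oj o≢s i∈ j∈ o∈
      ρ′ : Rooted S′.s (Mem C′)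
      ρ′ = rootedA i′≢j′ si′ sj′ oi′ oj′ o≢s′ i∈′ j∈′ o∈′
    ... | inj₁ s≈s′ = two-lines (TwoSides.ends-differ disjoint disjoint′ S S′) i≢j i′≢j′ si sj si′ sj′
        (adj i∈′ si′) (adj j∈′ sj′) (adj′ i∈ si) (adj′ j∈ sj)
      where
      adj : ∀ {i} → Mem C′ i → Neg S′.s i → S.s ~ i
      adj {i} i∈ si = subst (_~ i) t≡s (U′.via-complete i∈ (subst (λ s → Opp s i) (sym t≡s) (same-opp s≈s′ (~-opp (neg~ si)))))
      adj′ : ∀ {i} → Mem C i → Neg S.s i → S′.s ~ i
      adj′ {i} i∈ si = subst (_~ i) t′≡s′ (U.via-complete i∈ (subst (λ s → Opp s i) (sym t′≡s′) (same-opp (sym s≈s′) (~-opp (neg~ si)))))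

  two-leaves : {C C′ : Subset n} → Disjoint C C′ → Side C C′ → Side C′ C → ⊥
  two-leaves {C} {C′} disjoint S S′ = cases J.U.half J.U′.half
    where
    disjoint′ : Disjoint C′ C
    disjoint′ i∈ j∈ = apart-sym (disjoint j∈ i∈)
    ℓ = OneSide.find-link disjoint S
    ℓ′ = OneSide.find-link disjoint′ S′
    module J = Join disjoint disjoint′ S S′ ℓ ℓ′
    module J′ = Join disjoint′ disjoint S′ S ℓ′ ℓ
    cases : J.U.Half → J.U′.Half → ⊥
    cases (J.U.regular ρ w1) (J.U′.regular ρ′ w1′) = J.regular-regular ρ ρ′ w1 w1′
    cases (J.U.exceptional e₁ e₂ e₃ e₄ e₅ e₆ e₇ e₈ e₉ e₁₀) (J.U′.regular ρ′ w1′) =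
      J.exceptional-regular e₁ e₂ e₃ e₄ e₅ e₆ e₇ e₈ e₉ e₁₀ ρ′ w1′
    cases (J.U.regular ρ w1) (J.U′.exceptional e₁ e₂ e₃ e₄ e₅ e₆ e₇ e₈ e₉ e₁₀) =
      J′.exceptional-regular e₁ e₂ e₃ e₄ e₅ e₆ e₇ e₈ e₉ e₁₀ ρ w1
    cases (J.U.exceptional e₁ e₂ e₃ e₄ e₅ e₆ e₇ e₈ e₉ e₁₀) (J.U′.exceptional f₁ f₂ f₃ f₄ f₅ f₆ f₇ f₈ f₉ f₁₀) =
      J.exceptional-exceptional e₁ e₂ e₃ e₄ e₅ e₆ e₇ e₈ e₉ e₁₀ f₁ f₂ f₃ f₄ f₅ f₆ f₇ f₈ f₉ f₁₀

-- Existence of a signed simplicial edge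

module Existence {n : ℕ} (G : SignedBigraph n) (free : FFree G) where

  open Bigraph G
  open Rootings G free
  open Leaves G free
  open Candidates G free
  open TwoLeaves G free

  TwoEdges : Subset n → Set
  TwoEdges C = ∃₂ λ g h → ∃₂ λ i j → Mem C g × Mem C h × Mem C i × Mem C j × g ~ h × i ~ j × Same g i × ¬ g ~ j × ¬ i ~ h

  nested? : ∀ C → TwoEdges C ⊎ Nested (Mem C)
  nested? C with Fin.any? (λ g → Fin.any? (λ h → Fin.any? (λ i → Fin.any? (λ j →
      (g Sub.∈? C) ×-dec (h Sub.∈? C) ×-dec (i Sub.∈? C) ×-dec (j Sub.∈? C) ×-dec
      (g ~? h) ×-dec (i ~? j) ×-dec (side g Bool.≟ side i) ×-dec ¬? (g ~? j) ×-dec ¬? (i ~? h)))))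
  ... | yes (g , h , i , j , two) = inj₁ (g , h , i , j , two)
  ... | no none = inj₂ λ {g} {h} {i} {j} g∈ h∈ i∈ j∈ gh ij g≈i → decidable-stable ((g ~? j) ⊎-dec (i ~? h))
      λ ¬or → none (g , h , i , j , g∈ , h∈ , i∈ , j∈ , gh , ij , g≈i , ¬or ∘ inj₁ , ¬or ∘ inj₂)

  module _ (no-simp : NoSimplicial) where

    cand-leaf : ∀ {u v C} → Cand u v C → Complete (Mem C) → Nested (Mem C) →
                (∀ {s} → Bd (Mem C) s → LeafAt (Mem C) s → ⊥) → ⊥
    cand-leaf {C = C} cand complete nested k = let _ , _ , c∈ , _ = Cand.edge₀ cand in
      Leaf.leaf-exists (Mem C) (Sub._∈? C) complete (Cand.biclique cand) nested (Cand.covered cand) (Cand.outer cand) no-simp k c∈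

    complete-bd : ∀ {C c d i} → Complete (Mem C) → Mem C c → Mem C d → c ~ d → Bd (Mem C) i → i ~ c ⊎ i ~ d
    complete-bd {c = c} {i = i} complete c∈ d∈ cd bi with opp? i c
    ... | inj₂ o    = inj₁ (complete bi c∈ o)
    ... | inj₁ same = inj₂ (complete bi d∈ (same-opp same (~-opp cd)))

    -- Two anticomplete minimal candidates inside B both contain leaves.
    no-two-edges : ∀ {B} → Acc Sub._⊂_ B → Complete (Mem B) → TwoEdges B → ⊥
    no-two-edges {B} (acc rec) completeB (g , h , i , j , g∈ , h∈ , i∈ , j∈ , gh , ij , g≈i , ¬gj , ¬ih) =
      component P i (i∈ , same-≁ (sym g≈i) , ¬ih) λ C comp → let open Component comp in
        minimize inv₁ found₁ {g} {h} {C} (record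
          { uv = gh
          ; far-u = λ c∈ → proj₁ (proj₂ (⊆A c∈))
          ; far-v = λ c∈ → proj₂ (proj₂ (⊆A c∈))
          ; closed = λ {c} {d} c∈ cd d∉ → near (⊆A c∈) cd (λ pd → d∉ (grow c∈ cd pd))
          ; joined = joined
          ; edge₀ = i , j , start , grow start ij (j∈ , (λ jg → ¬gj (~-sym jg)) ,
              same-≁ (opp-opp (opp-sym (~-opp ij)) (same-opp (sym g≈i) (~-opp gh)))) , ij })
          (g∈ , h∈ , λ c∈ → proj₁ (⊆A c∈))
      where
      P : Fin n → Set
      P k = Mem B k × ¬ k ~ g × ¬ k ~ h

      near : ∀ {c d} → P c → c ~ d → ¬ P d → d ~ g ⊎ d ~ h
      near {c} {d} (c∈ , _) cd ¬pd with d Sub.∈? B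
      ... | no d∉  = complete-bd completeB g∈ h∈ gh (d∉ , c , c∈ , cd)
      ... | yes d∈ with d ~? g | d ~? h
      ...   | yes dg | _      = inj₁ dg
      ...   | no _   | yes dh = inj₂ dh
      ...   | no ¬dg | no ¬dh = contradiction (d∈ , ¬dg , ¬dh) ¬pd

      Inv₁ : Fin n → Fin n → Subset n → Set
      Inv₁ u v C = Mem B u × Mem B v × C Sub.⊆ B

      shrink₁ : ∀ {u v C D s x} → Inv₁ u v C → Incomplete C s x → D Sub.⊂ C → Inv₁ s u D
      shrink₁ {s = s} (u∈ , _ , C⊆B) ((s∉C , c , c∈ , cs) , x∈ , sx , ¬sx) (D⊆C , _) =
        -- Outside `B`, the vertex `s` would lie on the boundary of `B` and hence be adjacent to
        -- `x`.
        decidable-stable (s Sub.∈? B) (λ s∉ → ¬sx (completeB (s∉ , c , C⊆B c∈ , cs) (C⊆B x∈) sx)) , u∈ , C⊆B ∘ D⊆C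

      inv₁ : Invariant Inv₁
      inv₁ = record
        { inv-swap = λ { _ (u∈ , v∈ , C⊆B) → v∈ , u∈ , C⊆B }
        ; inv-shrink = λ _ inv _ inc D⊂C _ → shrink₁ inv inc D⊂C }

      found₁ : ∀ {u v C₁} → Cand u v C₁ → Inv₁ u v C₁ → Complete (Mem C₁) → ⊥
      found₁ {u} {v} {C₁} cand (u∈ , v∈ , C₁⊆B) complete with nested? C₁
      ... | inj₁ two = no-two-edges (rec (C₁⊆B , u , u∈ , Cand.u∉ cand)) complete two
      ... | inj₂ nested = cand-leaf cand complete nested λ bs leaf →
          -- The roles are exchanged: the edge `u v` lies beyond `C₁`, and its component there is a
          -- candidate with respect to an edge of `C₁`.
          component P₂ u (u∈ , u-beyond) λ D comp →
            second bs leaf D comp (Component.grow comp (Component.start comp) (Cand.uv cand) (v∈ , v-beyond))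
        where
        P₂ : Fin n → Set
        P₂ k = Mem B k × Beyond C₁ k

        u-beyond : Beyond C₁ u
        u-beyond = Cand.u∉ cand , Cand.u∉Bd cand
        v-beyond : Beyond C₁ v
        v-beyond = Cand.u∉ (cand-swap cand) , Cand.u∉Bd (cand-swap cand)

        second : ∀ {s} → Bd (Mem C₁) s → LeafAt (Mem C₁) s → ∀ D → Component P₂ u D → Mem D v → ⊥
        second {s} bs leaf D comp v∈D =
          let e , f , e∈ , f∈ , ef = Cand.edge₀ cand in
          minimize inv₂ found₂ {e} {f} {D} (record
            { uv = ef
            ; far-u = λ c∈ ce → proj₂ (beyond-apart (proj₂ (⊆A c∈)) e∈) ce
            ; far-v = λ c∈ cf → proj₂ (beyond-apart (proj₂ (⊆A c∈)) f∈) cf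
            ; closed = λ {c} {d} c∈ cd d∉ → near₂ e∈ f∈ ef c∈ cd d∉
            ; joined = joined
            ; edge₀ = u , v , start , v∈D , Cand.uv cand })
            (id , e , e∈ , [])
          where
          open Component comp

          -- A neighbour of `D` outside `D` lies on the boundary of `C₁` or on that of `B`. Both
          -- boundaries are complete, so it is adjacent to an end of any edge in `C₁`.
          near₂ : ∀ {e f c d} → Mem C₁ e → Mem C₁ f → e ~ f → Mem D c → c ~ d → ¬ Mem D d → d ~ e ⊎ d ~ f
          near₂ {c = c} {d} e∈ f∈ ef c∈ cd d∉ with d Sub.∈? C₁ | bd? C₁ d | d Sub.∈? B
          ... | yes d∈C | _ | _ = contradiction cd (proj₂ (beyond-apart (proj₂ (⊆A c∈)) d∈C))
          ... | no _ | yes bd | _ = complete-bd complete e∈ f∈ ef bd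
          ... | no d∉C | no ¬bd | yes d∈B = contradiction (grow c∈ cd (d∈B , d∉C , ¬bd)) d∉
          ... | no _ | no _ | no d∉B = complete-bd completeB (C₁⊆B e∈) (C₁⊆B f∈) ef (d∉B , c , proj₁ (⊆A c∈) , cd)

          -- C₁ stays on the same side of the boundary of C as u′ and v′.
          Inv₂ : Fin n → Fin n → Subset n → Set
          Inv₂ u′ v′ C = C Sub.⊆ D × ∃ λ e → Mem C₁ e × Star (Beyond C) u′ e

          inv₂ : Invariant Inv₂
          inv₂ = record
            { inv-swap = λ { cd (C⊆D , e , e∈ , st) → C⊆D , e , e∈ , via (~-sym (Cand.uv cd)) (Cand.u∉ cd , Cand.u∉Bd cd) st }
            ; inv-shrink = λ { cd (C⊆D , e , e∈ , st) su _ (D⊆C , _) cdD → C⊆D ∘ D⊆C , e , e∈ ,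
                via su (let cdD′ = cand-swap cdD in Cand.u∉ cdD′ , Cand.u∉Bd cdD′) (star-map (beyond-shrink D⊆C) st) } }
            where
            beyond-shrink : ∀ {C C′ k} → C′ Sub.⊆ C → Beyond C k → Beyond C′ k
            beyond-shrink C′⊆C (k∉ , ¬bk) = k∉ ∘ C′⊆C , λ bk → [ k∉ , ¬bk ]′ (bd-shrink C′⊆C bk)

          found₂ : ∀ {u₂ v₂ C₂} → Cand u₂ v₂ C₂ → Inv₂ u₂ v₂ C₂ → Complete (Mem C₂) → ⊥
          found₂ {u₂} {v₂} {C₂} cand₂ (C₂⊆D , e , e∈ , st) complete₂ with nested? C₂
          ... | inj₁ two = no-two-edges (rec ((λ c∈ → proj₁ (⊆A (C₂⊆D c∈))) , e , C₁⊆B e∈ ,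
                  λ e∈C₂ → proj₁ (proj₂ (⊆A (C₂⊆D e∈C₂))) e∈)) complete₂ two
          ... | inj₂ nested₂ = cand-leaf cand₂ complete₂ nested₂ λ {s₂} bs₂ leaf₂ →
              two-leaves (λ i∈ j∈ → apart-sym (beyond-apart (proj₂ (⊆A (C₂⊆D j∈))) i∈))
                (record { s = s ; bs = bs ; leaf = leaf ; complete = complete ; biclique = Cand.biclique cand
                        ; outer = Cand.outer cand ; joined = Cand.joined cand ; c′∈ = c₂∈ ; walk = walk₁ })
                (record { s = s₂ ; bs = bs₂ ; leaf = leaf₂ ; complete = complete₂ ; biclique = Cand.biclique cand₂
                        ; outer = Cand.outer cand₂ ; joined = Cand.joined cand₂ ; c′∈ = e∈ ; walk = walk₂ bs₂ })
            where
            c₂∈ : Mem C₂ (proj₁ (Cand.edge₀ cand₂))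
            c₂∈ = proj₁ (proj₂ (proj₂ (Cand.edge₀ cand₂)))
            walk₁ : Star (Beyond C₁) s (proj₁ (Cand.edge₀ cand₂))
            walk₁ with Cand.bd-near cand bs
            ... | inj₁ su = via su u-beyond (star-map (proj₂ ∘ ⊆A) (joined start (C₂⊆D c₂∈)))
            ... | inj₂ sv = via sv v-beyond (star-map (proj₂ ∘ ⊆A) (joined v∈D (C₂⊆D c₂∈)))
            walk₂ : ∀ {s₂} → Bd (Mem C₂) s₂ → Star (Beyond C₂) s₂ e
            walk₂ bs₂ with Cand.bd-near cand₂ bs₂
            ... | inj₁ su = via su (Cand.u∉ cand₂ , Cand.u∉Bd cand₂) st
            ... | inj₂ sv = let swapped = cand-swap cand₂ in
              via sv (Cand.u∉ swapped , Cand.u∉Bd swapped) (via (~-sym (Cand.uv cand₂)) (Cand.u∉ cand₂ , Cand.u∉Bd cand₂) st)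

    -- The set of nonisolated vertices has an empty boundary, which makes all boundary conditions
    -- vacuous: it is either a chain graph without leaves or a set `B` for `no-two-edges`.
    no-edge : ∀ {u v} → u ~ v → ⊥
    no-edge {u} {v} uv = split (nested? W)
      where
      nonisolated? : ∀ i → Dec (∃ (i ~_))
      nonisolated? i = Fin.any? (i ~?_)
      W : Subset n
      W = ⟪ nonisolated? ⟫
      no-bd : ∀ {s} → ¬ Bd (Mem W) s
      no-bd (s∉ , c , _ , cs) = s∉ (∈⟪⟫ nonisolated? (c , ~-sym cs))
      covered : Covered (Mem W)
      covered c∈ = let d , cd = ∈⟪⟫⁻ nonisolated? c∈ in d , ∈⟪⟫ nonisolated? (_ , ~-sym cd) , cd
      split : TwoEdges W ⊎ Nested (Mem W) → ⊥
      split (inj₁ two) = no-two-edges (⊂-wellFounded W) (λ bs → contradiction bs no-bd) two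
      split (inj₂ nested) = Leaf.leaf-exists (Mem W) (Sub._∈? W)
        (λ bs → contradiction bs no-bd) (λ bs → contradiction bs no-bd) nested covered (λ bs → contradiction bs no-bd)
        no-simp (λ bs → contradiction bs no-bd) (∈⟪⟫ nonisolated? (v , uv))

  Blocked : Fin n → Fin n → Set
  Blocked u v = ∃₂ λ g h → g ≢ u × h ≢ v × v ~ g × u ~ h × ¬ Pos g h

  pos? : ∀ u v → Dec (Pos u v)
  pos? u v with edge u v
  ... | nothing  = no λ ()
  ... | just pos = yes refl
  ... | just neg = no λ ()

  blocked? : ∀ u v → Dec (Blocked u v)
  blocked? u v = Fin.any? λ g → Fin.any? λ h →
    ¬? (g ≟ u) ×-dec ¬? (h ≟ v) ×-dec (v ~? g) ×-dec (u ~? h) ×-dec ¬? (pos? g h)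

  unblocked⇒simplicial : ∀ {u v} → ¬ Blocked u v → SignedSimplicial side edge u v
  unblocked⇒simplicial {u} {v} ¬blocked g h (g≢u , g≢v , ng) (h≢u , h≢v , nh) gh with ng | nh
  ... | inj₁ ug | inj₁ uh = contradiction (common (~-sym ug) (~-sym uh)) gh
  ... | inj₂ vg | inj₂ vh = contradiction (common (~-sym vg) (~-sym vh)) gh
  ... | inj₂ vg | inj₁ uh = decidable-stable (pos? g h) λ ¬p → ¬blocked (g , h , g≢u , h≢v , vg , uh , ¬p)
  ... | inj₁ ug | inj₂ vh = pos-sym (decidable-stable (pos? h g) λ ¬p → ¬blocked (h , g , h≢u , g≢v , vh , ug , ¬p))

  simplicial-exists : ∀ {u v} → u ~ v → ∃₂ λ u v → u ~ v × SignedSimplicial side edge u v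
  simplicial-exists uv with Fin.any? (λ u → Fin.any? (λ v → (u ~? v) ×-dec ¬? (blocked? u v)))
  ... | yes (u , v , uv′ , ¬blocked) = u , v , uv′ , unblocked⇒simplicial ¬blocked
  ... | no none = ⊥-elim (no-edge (λ {u} {v} uv′ →
          decidable-stable (blocked? u v) λ ¬b → none (u , v , uv′ , ¬b)) uv)

-- Induction on the set of edges

edge-set : ∀ {n} → (Fin n → Fin n → Maybe Sign) → Subset (n * n)
edge-set {n} E = ⟪ (λ k → edge? (E (proj₁ (remQuot {n} n k)) (proj₂ (remQuot {n} n k)))) ⟫

-- Deleting the simplicial edge that exists keeps the graph ℱ-free by `hasF-undelete`. Edges are
-- coded as ordered pairs in `Fin (n * n)` to make the induction one over proper inclusion of
-- subsets.
FFree⇒order : ∀ {n} (G : SignedBigraph n) → FFree G → Acc Sub._⊂_ (edge-set (SignedBigraph.edge G)) →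
              ∃ (ChordalOrder (SignedBigraph.side G) (SignedBigraph.edge G))
FFree⇒order {n} G free (acc rec) with Fin.any? (λ u → Fin.any? (λ v → Bigraph._~?_ G u v))
... | no none = [] , done λ u v → Bigraph.nonadjacent G λ uv → none (u , v , uv)
... | yes (_ , _ , uv₀) with Existence.simplicial-exists G free uv₀
...   | u , v , uv , simp =
  let es , order = FFree⇒order G′ (free ∘ hasF-undelete bi edge-sym uv simp) (rec smaller)
  in (u , v) ∷ es , step uv simp order
  where
  open Bigraph G
  bi : Bichromatic side edge
  bi _ _ = ~-opp
  G′ : SignedBigraph n
  G′ = record { edge = deleteEdge u v edge ; edge-sym = delete-sym bi edge-sym uv simp ; edge-irr = irr ; side = side
              ; bip = λ i j σ eq → delete-bichromatic bi edge-sym uv simp i j (σ , eq) }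
    where
    irr : ∀ i → deleteEdge u v edge i i ≡ nothing
    irr i with nothing-or-edge (deleteEdge u v edge i i)
    ... | inj₁ eq = eq
    ... | inj₂ e  = contradiction refl (delete-bichromatic bi edge-sym uv simp i i e)
  smaller : edge-set (deleteEdge u v edge) Sub.⊂ edge-set edge
  smaller = (λ k∈ → let σ , eq = ∈⟪⟫⁻ _ k∈ in ∈⟪⟫ _ (σ , delete-⊆ {E = edge} u v _ _ eq))
    , combine u v , ∈⟪⟫ _ (at {edge} uv) , λ k∈ → not-both (delete-edge {E = edge} u v) (proj₂ (at⁻ {deleteEdge u v edge} (∈⟪⟫⁻ _ k∈)))
    where
    at : ∀ {E : Fin n → Fin n → Maybe Sign} → Edge E u v → Edge E (proj₁ (remQuot {n} n (combine u v))) (proj₂ (remQuot {n} n (combine u v)))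
    at {E} = subst (λ (i , j) → Edge E i j) (sym (Fin.remQuot-combine u v))
    at⁻ : ∀ {E : Fin n → Fin n → Maybe Sign} → Edge E (proj₁ (remQuot {n} n (combine u v))) (proj₂ (remQuot {n} n (combine u v))) → Edge E u v
    at⁻ {E} = subst (λ (i , j) → Edge E i j) (Fin.remQuot-combine u v)

theorem5p1 : (n : ℕ) (G : SignedBigraph n) → Chordal G ⇔ FFree G
theorem5p1 n G = mk⇔
  (λ (es , order) → order⇒FFree (λ i j (σ , eq) → SignedBigraph.bip G i j σ eq) (SignedBigraph.edge-sym G) order)
  (λ free → FFree⇒order G free (⊂-wellFounded _))
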